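{- Let $G$ be a hairball whose unique cycle $C_G$ has an odd number of vertices, suppose $G$ is in simplest form and $G$ is not just a cycle, and let $v(G)$ be its number of vertices. Then the nim-value $g(G)$ in graph chomp is determined as follows: (1) If $v(G)$ is even and $G$ is obtained from $C_G$ by attaching, at a single vertex $A$ of $C_G$, a path with $k$ vertices and a path with $k+1$ vertices for some integer $k\ge 0$ (each path joined to $A$ by one edge from one of its endpoints; for $k=0$ only a single pendant vertex is attached to $A$), all other vertices of $C_G$ having degree $2$, then $g(G)=4$. (2) If $v(G)$ is even and $G$ is not of the form in (1), then $g(G)=0$. (3) If $v(G)$ is odd, then $g(G)=3$.
   Context: A pseudotree is a finite connected simple graph containing exactly one cycle, denoted $C_G$. A hairball is a pseudotree in which every vertex not on $C_G$ has degree at most $2$. Graph chomp is played on a finite simple graph: two players alternate, and a move consists either of deleting one edge, or of deleting one vertex together with all edges incident to it. The player who makes the last move wins. The nim-value $g$ of a position is defined recursively: the empty graph has nim-value $0$, and $g(G)$ is the minimal nonnegative integer not equal to the nim-value of any position reachable from $G$ in one move. An involution of a graph $G$ is a permutation $\tau$ of its vertices with $\tau^2=\mathrm{id}$ such that $\{x,y\}$ is an edge iff $\{\tau(x),\tau(y)\}$ is an edge. $G$ is in simplest form if there is no involution $\tau\neq\mathrm{id}$ of $G$ such that no edge has its two endpoints interchanged by $\tau$ (i.e. whose fixed set of vertices and edges is a simplicial complex). -}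

module Defs where

open import Data.Nat using (ℕ; zero; suc; _+_; _*_; _≤_; _<ᵇ_; _≡ᵇ_)
open import Data.Bool using (Bool; true; false; if_then_else_; _∧_; _∨_)
open import Data.Fin using (Fin; toℕ; punchIn; inject₁; fromℕ)
open import Data.Fin.Properties using () renaming (_≟_ to _≟ᶠ_)
open import Data.Bool.ListAction using (any)
open import Data.List using (List; []; _∷_; _++_; map; length; filterᵇ; cartesianProduct; allFin; upTo)
open import Data.Product using (Σ; ∃; _×_; _,_; proj₁; proj₂)
open import Data.Sum using (_⊎_)
open import Data.Empty using (⊥)
open import Relation.Nullary using (¬_; does)
open import Relation.Binary.PropositionalEquality using (_≡_; _≢_)
open import Function.Bundles using (_↔_; Inverse)

record Graph : Set where
  constructor mkGraph
  field
    n   : ℕ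
    adj : Fin n → Fin n → Bool
open Graph public

IsSimple : Graph → Set
IsSimple G = (∀ i j → adj G i j ≡ adj G j i) × (∀ i → adj G i i ≡ false)

Edge : (G : Graph) → Fin (n G) → Fin (n G) → Set
Edge G i j = adj G i j ≡ true

degree : (G : Graph) → Fin (n G) → ℕ
degree G v = length (filterᵇ (adj G v) (allFin (n G)))

data Reach (G : Graph) : Fin (n G) → Fin (n G) → Set where
  here : ∀ {i} → Reach G i i
  step : ∀ {i j k} → Edge G i j → Reach G j k → Reach G i k

Connected : Graph → Set
Connected G = ∀ i j → Reach G i j

record Cycle (G : Graph) : Set where
  field
    r      : ℕ
    vtx    : Fin (3 + r) → Fin (n G)
    inj    : ∀ a b → vtx a ≡ vtx b → a ≡ b
    edges  : ∀ (k : Fin (2 + r)) → Edge G (vtx (inject₁ k)) (vtx (Fin.suc k))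
    close  : Edge G (vtx (fromℕ (2 + r))) (vtx Fin.zero)
open Cycle public

cycleLength : {G : Graph} → Cycle G → ℕ
cycleLength C = 3 + r C

SamePair : {A : Set} → A → A → A → A → Set
SamePair i j a b = (i ≡ a × j ≡ b) ⊎ (i ≡ b × j ≡ a)

CycEdge : {G : Graph} → Cycle G → Fin (n G) → Fin (n G) → Set
CycEdge C i j =
  (∃ λ (k : Fin (2 + r C)) → SamePair i j (vtx C (inject₁ k)) (vtx C (Fin.suc k)))
  ⊎ SamePair i j (vtx C (fromℕ (2 + r C))) (vtx C Fin.zero)

OnCycle : {G : Graph} → Cycle G → Fin (n G) → Set
OnCycle C v = ∃ λ k → vtx C k ≡ v

SameCycle : {G : Graph} → Cycle G → Cycle G → Set
SameCycle C D = ∀ i j → (CycEdge C i j → CycEdge D i j) × (CycEdge D i j → CycEdge C i j)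

IsPseudotreeWithCycle : (G : Graph) → Cycle G → Set
IsPseudotreeWithCycle G C = IsSimple G × Connected G × (∀ (D : Cycle G) → SameCycle C D)

IsHairballWithCycle : (G : Graph) → Cycle G → Set
IsHairballWithCycle G C =
  IsPseudotreeWithCycle G C × (∀ v → ¬ OnCycle C v → degree G v ≤ 2)

IsJustCycle : (G : Graph) → Cycle G → Set
IsJustCycle G C = (∀ v → OnCycle C v) × (∀ i j → Edge G i j → CycEdge C i j)

record Involution (G : Graph) : Set where
  field
    τ      : Fin (n G) → Fin (n G)
    invol  : ∀ x → τ (τ x) ≡ x
    auto   : ∀ x y → adj G x y ≡ adj G (τ x) (τ y)
open Involution public

Reducing : {G : Graph} → Involution G → Set
Reducing {G} t =
  (∃ λ x → τ t x ≢ x) ×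
  (∀ x y → Edge G x y → ¬ (τ t x ≡ y × τ t y ≡ x))

SimplestForm : Graph → Set
SimplestForm G = ¬ (Σ (Involution G) Reducing)

Even Odd : ℕ → Set
Even m = ∃ λ k → m ≡ 2 * k
Odd  m = ∃ λ k → m ≡ suc (2 * k)

mex : List ℕ → ℕ
mex xs = go (suc (length xs)) 0
  where
  go : ℕ → ℕ → ℕ
  go zero    k = k
  go (suc f) k = if any (k ≡ᵇ_) xs then go f (suc k) else k

edgePairs : (m : ℕ) → (Fin m → Fin m → Bool) → List (Fin m × Fin m)
edgePairs m a =
  filterᵇ (λ p → (toℕ (proj₁ p) <ᵇ toℕ (proj₂ p)) ∧ a (proj₁ p) (proj₂ p))
          (cartesianProduct (allFin m) (allFin m))

edgeCount : Graph → ℕ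
edgeCount G = length (edgePairs (n G) (adj G))

removeEdge : {m : ℕ} → (Fin m → Fin m → Bool) → Fin m → Fin m → Fin m → Fin m → Bool
removeEdge a u w x y =
  if (does (x ≟ᶠ u) ∧ does (y ≟ᶠ w)) ∨ (does (x ≟ᶠ w) ∧ does (y ≟ᶠ u))
  then false else a x y

removeVertex : {m : ℕ} → (Fin (suc m) → Fin (suc m) → Bool) → Fin (suc m) → Fin m → Fin m → Bool
removeVertex a i x y = a (punchIn i x) (punchIn i y)

-- grundy f m a : nim-value of the graph (m , a), computed with fuel f.
-- Every move decreases (number of vertices + number of edges) by at
-- least one, so fuel f ≥ that size gives the true nim-value.
grundy : ℕ → (m : ℕ) → (Fin m → Fin m → Bool) → ℕ
grundy zero    m       a = 0
grundy (suc f) m       a = mex (edgeMoves ++ vertexMoves m a)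
  where
  edgeMoves : List ℕ
  edgeMoves = map (λ p → grundy f m (removeEdge a (proj₁ p) (proj₂ p))) (edgePairs m a)
  vertexMoves : (m' : ℕ) → (Fin m' → Fin m' → Bool) → List ℕ
  vertexMoves zero     b = []
  vertexMoves (suc m') b = map (λ i → grundy f m' (removeVertex b i)) (allFin (suc m'))

nimValue : Graph → ℕ
nimValue G = grundy (n G + edgeCount G) (n G) (adj G)

Iso : Graph → Graph → Set
Iso G H = Σ (Fin (n G) ↔ Fin (n H)) λ e →
  ∀ x y → adj G x y ≡ adj H (Inverse.to e x) (Inverse.to e y)

graphFromEdges : (N : ℕ) → List (ℕ × ℕ) → Graph
graphFromEdges N es = mkGraph N (λ i j → any (λ p →
  ((toℕ i ≡ᵇ proj₁ p) ∧ (toℕ j ≡ᵇ proj₂ p)) ∨ ((toℕ i ≡ᵇ proj₂ p) ∧ (toℕ j ≡ᵇ proj₁ p))) es)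

-- Cycle on vertices 0..m-1 (edges i—i+1 and (m-1)—0), A = vertex 0,
-- a path with k vertices m, ..., m+k-1 (m joined to 0), and a path with
-- k+1 vertices m+k, ..., m+2k (m+k joined to 0).  Total m+2k+1 vertices.
shapeEdges : ℕ → ℕ → List (ℕ × ℕ)
shapeEdges zero    k = []
shapeEdges (suc l) k =
  ((l , 0) ∷ map (λ i → (i , suc i)) (upTo l))
  ++ pathP k
  ++ ((0 , m + k) ∷ map (λ i → (m + k + i , m + k + suc i)) (upTo k))
  where
  m : ℕ
  m = suc l
  pathP : ℕ → List (ℕ × ℕ)
  pathP zero     = []
  pathP (suc k') = (0 , m) ∷ map (λ i → (m + i , m + suc i)) (upTo k')

shape : ℕ → ℕ → Graph
shape m k = graphFromEdges (m + (k + suc k)) (shapeEdges m k)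

IsTwoPathShape : Graph → Set
IsTwoPathShape G = ∃ λ m → ∃ λ k → 3 ≤ m × Iso G (shape m k)

{-# OPTIONS --safe #-}
module Submission where

-- Write S for the set of pairs (c , n) such that an odd number of hairs of length n hang from the
-- cycle vertex c.  The nim-value of an odd-cycle hairball depends only on S and on the parity of its
-- number of vertices: it is 0 or 3 for odd parity according to whether S is empty, and 4 or 0 for even
-- parity according to whether S has the form {(A , k) , (A , k + 1)}, where (A , 0) is omitted.
-- Deleting a leaf of a hair of length n at c adds (c , n) and (c , n - 1) to S modulo 2; any other
-- deletion outside the cycle splits off a path, and a deletion on the cycle leaves a forest.  A bipartite
-- graph with v vertices and e edges has nim-value (v mod 2) + 2 (e mod 2), because it has an even-degree
-- vertex if v is odd and an odd-degree vertex if e is odd.  So all positions are a hairball plus a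
-- bipartite graph, and their values follow from the mex rule for nim-sums.  In simplest form the hairs
-- at each cycle vertex have distinct lengths, so S records the hairball itself.

open import Defs
open import Data.Nat using (ℕ; zero; suc; _+_; _*_; _≤_; _<_; z≤n; s≤s; _<ᵇ_; _≡ᵇ_; _⊔_; _∸_)
open import Data.Nat.Properties using (≤-refl; ≤-trans; ≤-antisym; ≤-pred; <-irrefl; ≤∧≢⇒<; n≤1+n; +-suc; +-identityʳ; ≡⇒≡ᵇ; ≡ᵇ⇒≡; <⇒<ᵇ; <-cmp; suc-injective; <ᵇ⇒<; n<1+n; m<n⇒m<1+n; 1+n≢n; ≮⇒≥; m≤m⊔n; m≤n⊔m; <⇒≤; anyUpTo?; allUpTo?; m<1+n⇒m<n∨m≡n; +-cancelˡ-≡; +-monoʳ-≤; +-monoʳ-<; m+[n∸m]≡n; +-assoc; m≤m+n; +-cancelˡ-<) renaming (_<?_ to _<?ℕ_; _≟_ to _≟ℕ_)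
open import Data.Bool using (Bool; true; false; if_then_else_; _∧_; _∨_; T; not; _xor_)
open import Data.Bool.Properties using (T-≡; ¬-not; T-∧; ∨-comm; xor-assoc; xor-comm; xor-identityʳ; xor-same; not-involutive; ∧-zeroʳ; not-distribˡ-xor; ∧-comm; ⇔→≡; T-∨) renaming (_≟_ to _≟ᵇ_)
open import Data.Bool.ListAction using (any)
open import Data.Fin using (Fin; zero; suc; toℕ; punchIn; fromℕ; inject₁; fromℕ<)
open import Data.Fin.Properties using (toℕ-injective; punchIn-injective; toℕ-fromℕ; toℕ-inject₁; toℕ<n; inject₁-injective; fromℕ≢inject₁; toℕ-fromℕ<) renaming (_≟_ to _≟ᶠ_; all? to allFin?; any? to anyFin?)
open import Data.List using (List; []; _∷_; _++_; map; length; filterᵇ; cartesianProduct; allFin; upTo; tabulate; lookup)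
open import Data.List.Properties using (length-tabulate; length-map; length-upTo; length-++; ++-identityʳ; ++-assoc)
open import Data.List.Membership.Propositional using (_∈_; _∉_; find; lose)
open import Data.List.Membership.Propositional.Properties using (∈-∃++; ∈-map⁺; ∈-map⁻; ∈-++⁺ˡ; ∈-++⁺ʳ; ∈-++⁻; ∈-tabulate⁺; ∈-tabulate⁻; ∈-allFin; ∈-upTo⁻; ∈-filter⁺; ∈-filter⁻; ∈-cartesianProduct⁺; ∈-upTo⁺; ∈-lookup)
open import Data.List.Relation.Unary.Any as Any using (here; there)
open import Data.List.Relation.Unary.Any.Properties using (any⁺; any⁻)
open import Data.List.Relation.Unary.All as All using (All; []; _∷_)
open import Data.List.Relation.Unary.AllPairs using ([]; _∷_)
open import Data.List.Relation.Unary.Unique.Propositional using (Unique)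
open import Data.List.Relation.Unary.Unique.Propositional.Properties using (upTo⁺; allFin⁺; map⁺; Unique[x∷xs]⇒x∉xs; tabulate⁺)
open import Data.List.Relation.Binary.Permutation.Propositional using (_↭_; ↭-refl; ↭-sym; ↭-trans; ↭-prep; ↭-swap; ↭-reflexive; ↭⇒↭ₛ)
open import Data.List.Relation.Binary.Permutation.Propositional.Properties using (∈-resp-↭; ↭-length; shift; drop-∷; ++⁺ˡ; ++⁺ʳ)
open import Data.Product using (Σ; ∃; _×_; _,_; proj₁; proj₂)
open import Data.Sum using (_⊎_; inj₁; inj₂; [_,_]′)
open import Data.Empty using (⊥; ⊥-elim)
open import Function using (_∘_)
open import Function.Bundles using (Equivalence; mk⇔; _↔_; Inverse; mk↔ₛ′)
open import Relation.Nullary using (¬_; Dec; yes; no; does)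
open import Relation.Nullary.Decidable using (dec-true; dec-false; T?; _×-dec_; map′; does-⇔)
open import Relation.Binary.Definitions using (tri<; tri≈; tri>; DecidableEquality)
open import Relation.Binary.PropositionalEquality as Eq using (_≡_; _≢_; refl; sym; trans; cong; cong₂; subst)
open import Data.Bool.Solver using (module xor-∧-Solver)
open import Data.Fin.Relation.Unary.Top using (view; ‵fromℕ; ‵inject₁)
open import Data.List.Membership.Propositional.Properties.WithK using (unique∧set⇒bag)
open import Data.List.Relation.Binary.BagAndSetEquality using (∼bag⇒↭)
open import Data.Unit using (⊤; tt)
open import Data.Maybe using (Maybe; just; nothing)
open import Data.Fin.Permutation using (↔⇒≡)
open xor-∧-Solver using (solve; _:+_; _:*_; _:=_; con)
import Data.List.Relation.Binary.Permutation.Setoid.Properties as Permutationₛ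
open Eq.≡-Reasoning

-- The mex rule and games on labelled graphs

-- Moves can create equal hairs, so an induction confined to simplest form would not be closed.
-- Counting hairs modulo 2 makes such pairs harmless, and no reduction by an involution is ever
-- carried out during play. `grundy` renumbers the vertices at every deletion. Positions are
-- therefore compared with lists of fixed labels, which remember the hair and the depth of each
-- vertex. The moves on a hair are told apart by one parity. A core has as many edges as vertices,
-- and the two low bits of 0, 3 and 4 agree. Deleting an inner hair vertex or a hair edge removes an
-- odd number of vertices and edges together, which makes the two bits disagree, so the value
-- changes. Deleting a leaf removes one of each and reverses the parity of the number of vertices;
-- the only possible collision is between the two kinds of hairball of value 0. The exceptional
-- shape {(A , k) , (A , k + 1)} is precisely what S becomes when a leaf is deleted from a hairball
-- with S empty, and its value is 4 because 0, 1, 2 and 3 can all be reached from it.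

≡true⇒T : ∀ {b} → b ≡ true → T b
≡true⇒T = Equivalence.from T-≡

T⇒≡true : ∀ {b} → T b → b ≡ true
T⇒≡true = Equivalence.to T-≡

≢true⇒≡false : ∀ {b} → b ≢ true → b ≡ false
≢true⇒≡false = ¬-not

true≢false : ∀ {b} → b ≡ true → b ≡ false → ⊥
true≢false refl ()

∈⇒↭∷ : ∀ {A : Set} {v : A} {xs} → v ∈ xs → ∃ λ ys → xs ↭ v ∷ ys
∈⇒↭∷ v∈xs with ∈-∃++ v∈xs
... | as , bs , refl = as ++ bs , shift _ as bs

Unique-⊆⇒length≤ : ∀ {A : Set} {ys xs : List A} → Unique ys → (∀ {v} → v ∈ ys → v ∈ xs) → length ys ≤ length xs
Unique-⊆⇒length≤ [] _ = z≤n
Unique-⊆⇒length≤ {ys = y ∷ ys} {xs} (y∉ ∷ u) sub with ∈⇒↭∷ (sub (here refl))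
... | zs , p = subst (suc (length ys) ≤_) (sym (↭-length p)) (s≤s (Unique-⊆⇒length≤ u sub′))
  where
  sub′ : ∀ {v} → v ∈ ys → v ∈ zs
  sub′ v∈ with ∈-resp-↭ p (sub (there v∈))
  ... | there v∈zs = v∈zs
  ... | here refl  = ⊥-elim (All.lookup y∉ v∈ refl)

-- The local function of mex has no accessible name; unification recovers it.
mutual
  mexGo : List ℕ → ℕ → ℕ → ℕ
  mexGo = _

  mex-unfold : ∀ xs → mex xs ≡ (if any (0 ≡ᵇ_) xs then mexGo xs (length xs) 1 else 0)
  mex-unfold xs with length xs | 1
  ... | n | j = refl

any-≡ᵇ⁺ : ∀ {j xs} → j ∈ xs → any (j ≡ᵇ_) xs ≡ true
any-≡ᵇ⁺ {j} j∈ = T⇒≡true (any⁺ (j ≡ᵇ_) (Any.map (≡⇒≡ᵇ j _) j∈))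

any-≡ᵇ⁻ : ∀ {j xs} → any (j ≡ᵇ_) xs ≡ true → j ∈ xs
any-≡ᵇ⁻ {j} {xs} p = Any.map (≡ᵇ⇒≡ j _) (any⁻ (j ≡ᵇ_) xs (≡true⇒T p))

-- The search stands at `j` with `f` steps left; `k < f + j` ensures that it gets to `k` in time.
mexGo-≡ : ∀ {xs k} → k ∉ xs → (∀ j → j < k → j ∈ xs) → ∀ f j → j ≤ k → k < f + j → mexGo xs f j ≡ k
mexGo-≡ k∉ below zero j j≤k k<j = ⊥-elim (<-irrefl refl (≤-trans k<j j≤k))
mexGo-≡ {xs} {k} k∉ below (suc f) j j≤k k<f with any (j ≡ᵇ_) xs in eq
... | true = mexGo-≡ k∉ below f (suc j) (≤∧≢⇒< j≤k (λ { refl → k∉ (any-≡ᵇ⁻ eq) })) (subst (k <_) (sym (+-suc f j)) k<f)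
... | false with <-cmp j k
...   | tri< j<k _ _ = ⊥-elim (true≢false (any-≡ᵇ⁺ (below j j<k)) eq)
...   | tri≈ _ j≡k _ = j≡k
...   | tri> _ _ k<j = ⊥-elim (<-irrefl refl (≤-trans k<j j≤k))

-- The fuel suffices: the numbers below `k` are distinct entries of `xs`, so `k` is at most its
-- length.
mex-≡ : ∀ {xs k} → k ∉ xs → (∀ j → j < k → j ∈ xs) → mex xs ≡ k
mex-≡ {xs} {k} k∉ below = mexGo-≡ {xs} k∉ below (suc (length xs)) 0 z≤n
  (s≤s (subst (k ≤_) (sym (+-identityʳ _)) (subst (_≤ length xs) (length-upTo k)
    (Unique-⊆⇒length≤ (upTo⁺ k) (λ v∈ → below _ (∈-upTo⁻ v∈))))))

tabulate-punchIn : ∀ {A : Set} {m} (e : Fin (suc m) → A) i → tabulate e ↭ e i ∷ tabulate (e ∘ punchIn i)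
tabulate-punchIn e zero = ↭-refl
tabulate-punchIn {m = suc m} e (suc i) =
  ↭-trans (↭-prep (e zero) (tabulate-punchIn (e ∘ suc) i)) (↭-swap _ _ ↭-refl)

∈-filterᵇ⁺ : ∀ {A : Set} (p : A → Bool) {x xs} → x ∈ xs → p x ≡ true → x ∈ filterᵇ p xs
∈-filterᵇ⁺ p x∈ px = ∈-filter⁺ (λ x → T? (p x)) x∈ (≡true⇒T px)

∈-filterᵇ⁻ : ∀ {A : Set} (p : A → Bool) {x xs} → x ∈ filterᵇ p xs → x ∈ xs × p x ≡ true
∈-filterᵇ⁻ p {xs = xs} x∈ with ∈-filter⁻ (λ x → T? (p x)) {xs = xs} x∈
... | x∈xs , px = x∈xs , T⇒≡true px

∈-edgePairs⁺ : ∀ {m} (b : Fin m → Fin m → Bool) {x y} → toℕ x < toℕ y → b x y ≡ true → (x , y) ∈ edgePairs m b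
∈-edgePairs⁺ b {x} {y} x<y bxy = ∈-filterᵇ⁺ _ (∈-cartesianProduct⁺ (∈-allFin x) (∈-allFin y))
  (cong₂ _∧_ (T⇒≡true (<⇒<ᵇ x<y)) bxy)

∈-edgePairs⁻ : ∀ {m} (b : Fin m → Fin m → Bool) {x y} → (x , y) ∈ edgePairs m b → b x y ≡ true
∈-edgePairs⁻ {m} b p∈ = T⇒≡true (proj₂ (Equivalence.to T-∧ (≡true⇒T
  (proj₂ (∈-filterᵇ⁻ _ {xs = cartesianProduct (allFin m) (allFin m)} p∈)))))

module Play {V : Set} where

  Adj : Set
  Adj = V → V → Bool

  -- A relation instead of a function, because adjacency functions are only compared pointwise and
  -- an edge may be deleted under either orientation.
  record IsRem (a : Adj) (u v : V) (a′ : Adj) : Set where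
    field
      rem-uv : a′ u v ≡ false
      rem-vu : a′ v u ≡ false
      rem-other : ∀ p q → ¬ (p ≡ u × q ≡ v) → ¬ (p ≡ v × q ≡ u) → a′ p q ≡ a p q
  open IsRem public

  IsRem-swap : ∀ {a u v a′} → IsRem a u v a′ → IsRem a v u a′
  IsRem-swap r = record
    { rem-uv = rem-vu r ; rem-vu = rem-uv r
    ; rem-other = λ p q n₁ n₂ → rem-other r p q n₂ n₁ }

  -- The defining properties of the nim-value: no option of a position of value `k` has value `k`,
  -- and every smaller number is the value of some option. `Inv` may present one position in several
  -- ways; `grundy-Inv` shows that they carry the same value.
  record Closed (Inv : List V → Adj → ℕ → Set) : Set where
    field
      symm : ∀ {xs a k} → Inv xs a k → ∀ u v → a u v ≡ a v u
      irrefl : ∀ {xs a k} → Inv xs a k → ∀ u → a u u ≡ false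
      after-vertex : ∀ {xs a k v ys} → Inv xs a k → xs ↭ v ∷ ys →
        ∃ λ k′ → k′ ≢ k × Inv ys a k′
      after-edge : ∀ {xs a k u v} → Inv xs a k → u ∈ xs → v ∈ xs → a u v ≡ true →
        ∃ λ k′ → ∃ λ a′ → IsRem a u v a′ × k′ ≢ k × Inv xs a′ k′
      below : ∀ {xs a k} → Inv xs a k → ∀ j → j < k →
        (∃ λ v → ∃ λ ys → xs ↭ v ∷ ys × Inv ys a j)
        ⊎ (∃ λ u → ∃ λ v → ∃ λ a′ → u ∈ xs × v ∈ xs × a u v ≡ true × IsRem a u v a′ × Inv xs a′ j)
  open Closed public

  -- Identifies the graph `b` with the subgraph of `a` induced on the labels `xs`, which matter only
  -- up to order.
  record Rep (m : ℕ) (b : Fin m → Fin m → Bool) (xs : List V) (a : Adj) : Set where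
    field
      e : Fin m → V
      e-inj : ∀ {x y} → e x ≡ e y → x ≡ y
      e-list : xs ↭ tabulate e
      e-adj : ∀ x y → b x y ≡ a (e x) (e y)
  open Rep

  -- Edges are bounded by a list containing each of them in some orientation. Such a bound loses an
  -- entry with each deleted edge and may stay loose when a vertex is deleted, so edges never have
  -- to be counted exactly.
  EnoughFuel : ℕ → List V → Adj → Set
  EnoughFuel f xs a = ∃ λ (es : List (V × V)) → length xs + length es ≤ f
    × (∀ u v → u ∈ xs → v ∈ xs → a u v ≡ true → (u , v) ∈ es ⊎ (v , u) ∈ es)

  fuel-vertex : ∀ {f xs a v ys} → EnoughFuel (suc f) xs a → xs ↭ v ∷ ys → EnoughFuel f ys a
  fuel-vertex {f} (es , le , cov) p =
    es , ≤-pred (subst (λ z → z + length es ≤ suc f) (↭-length p) le)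
       , λ u v u∈ v∈ → cov u v (∈-resp-↭ (↭-sym p) (there u∈)) (∈-resp-↭ (↭-sym p) (there v∈))

  fuel-edge : ∀ {f xs a u v a′} → EnoughFuel (suc f) xs a → u ∈ xs → v ∈ xs → a u v ≡ true →
    IsRem a u v a′ → EnoughFuel f xs a′
  fuel-edge {f} {xs} {a} {u} {v} {a′} (es , le , cov) u∈ v∈ auv r = go (cov u v u∈ v∈ auv)
    where
    differ : ∀ {p q} → a′ p q ≡ true → ¬ (p ≡ u × q ≡ v) × ¬ (p ≡ v × q ≡ u)
    differ a′pq = (λ { (refl , refl) → true≢false a′pq (rem-uv r) }) , (λ { (refl , refl) → true≢false a′pq (rem-vu r) })
    drop : ∀ {w z fs p q} → es ↭ (w , z) ∷ fs → ¬ (p ≡ w × q ≡ z) → (p , q) ∈ es → (p , q) ∈ fs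
    drop π n pq∈ with ∈-resp-↭ π pq∈
    ... | here refl = ⊥-elim (n (refl , refl))
    ... | there pq∈fs = pq∈fs
    shrink : ∀ {w z fs} → es ↭ (w , z) ∷ fs →
      (∀ {p q} → a′ p q ≡ true → ¬ (p ≡ w × q ≡ z) × ¬ (q ≡ w × p ≡ z)) → EnoughFuel f xs a′
    shrink {w} {z} {fs} π n = fs
      , ≤-pred (subst (_≤ suc f) (trans (cong (length xs +_) (↭-length π)) (+-suc (length xs) (length fs))) le)
      , cov′
      where
      cov′ : ∀ p q → p ∈ xs → q ∈ xs → a′ p q ≡ true → (p , q) ∈ fs ⊎ (q , p) ∈ fs
      cov′ p q p∈ q∈ a′pq with cov p q p∈ q∈ (trans (sym (rem-other r p q (proj₁ (differ a′pq)) (proj₂ (differ a′pq)))) a′pq)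
      ... | inj₁ i = inj₁ (drop π (proj₁ (n a′pq)) i)
      ... | inj₂ i = inj₂ (drop π (proj₂ (n a′pq)) i)
    go : (u , v) ∈ es ⊎ (v , u) ∈ es → EnoughFuel f xs a′
    go (inj₁ i) = shrink (proj₂ (∈⇒↭∷ i)) λ t → proj₁ (differ t) , λ { (x , y) → proj₂ (differ t) (y , x) }
    go (inj₂ i) = shrink (proj₂ (∈⇒↭∷ i)) λ t → proj₂ (differ t) , λ { (x , y) → proj₁ (differ t) (y , x) }

  rep-vertex : ∀ {m b xs a} (R : Rep (suc m) b xs a) i → 
    ∃ λ ys → xs ↭ e R i ∷ ys × Rep m (removeVertex b i) ys a
  rep-vertex R i = tabulate (e R ∘ punchIn i) , ↭-trans (e-list R) (tabulate-punchIn (e R) i) , record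
    { e = e R ∘ punchIn i
    ; e-inj = λ eq → punchIn-injective i _ _ (e-inj R eq)
    ; e-list = ↭-refl
    ; e-adj = λ x y → e-adj R (punchIn i x) (punchIn i y) }

  rep-↭ : ∀ {m b xs ys a} → Rep m b xs a → ys ↭ xs → Rep m b ys a
  rep-↭ R p = record { e = e R ; e-inj = e-inj R ; e-list = ↭-trans p (e-list R) ; e-adj = e-adj R }

  rep-edge : ∀ {m b xs a a′} (R : Rep m b xs a) i j → IsRem a (e R i) (e R j) a′ →
    Rep m (removeEdge b i j) xs a′
  rep-edge {b = b} {a = a} {a′} R i j r = record
    { e = e R ; e-inj = e-inj R ; e-list = e-list R ; e-adj = adj′ }
    where
    adj′ : ∀ x y → removeEdge b i j x y ≡ a′ (e R x) (e R y)
    adj′ x y with x ≟ᶠ i | y ≟ᶠ j | x ≟ᶠ j | y ≟ᶠ i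
    ... | yes refl | yes refl | _ | _ = sym (rem-uv r)
    ... | yes refl | no y≢j | yes refl | yes refl = sym (rem-vu r)
    ... | no x≢i | _ | yes refl | yes refl = sym (rem-vu r)
    ... | yes refl | no y≢j | no x≢j | _ = trans (e-adj R x y) (sym (rem-other r _ _ (λ { (_ , q) → y≢j (e-inj R q) }) (λ { (q , _) → x≢j (e-inj R q) })))
    ... | yes refl | no y≢j | yes _ | no y≢i = trans (e-adj R x y) (sym (rem-other r _ _ (λ { (_ , q) → y≢j (e-inj R q) }) (λ { (_ , q) → y≢i (e-inj R q) })))
    ... | no x≢i | _ | yes _ | no y≢i = trans (e-adj R x y) (sym (rem-other r _ _ (λ { (q , _) → x≢i (e-inj R q) }) (λ { (_ , q) → y≢i (e-inj R q) })))
    ... | no x≢i | _ | no x≢j | _ = trans (e-adj R x y) (sym (rem-other r _ _ (λ { (q , _) → x≢i (e-inj R q) }) (λ { (q , _) → x≢j (e-inj R q) })))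

  ∈-rep : ∀ {m b xs a} (R : Rep m b xs a) x → e R x ∈ xs
  ∈-rep R x = ∈-resp-↭ (↭-sym (e-list R)) (∈-tabulate⁺ x)

  rep-∈ : ∀ {m b xs a u} (R : Rep m b xs a) → u ∈ xs → ∃ λ x → u ≡ e R x
  rep-∈ R u∈ = ∈-tabulate⁻ (∈-resp-↭ (e-list R) u∈)

  -- Copies of the local lists of `grundy`, to which it unfolds once `m` is known to be zero or a
  -- successor.
  edgeOptions vertexOptions : ℕ → (m : ℕ) → (Fin m → Fin m → Bool) → List ℕ
  edgeOptions f m b = map (λ p → grundy f m (removeEdge b (proj₁ p) (proj₂ p))) (edgePairs m b)
  vertexOptions f zero b = []
  vertexOptions f (suc m) b = map (λ i → grundy f m (removeVertex b i)) (allFin (suc m))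

  grundy-edge-∈ : ∀ f {m} b {x y} → toℕ x < toℕ y → b x y ≡ true →
    grundy f m (removeEdge b x y) ∈ edgeOptions f m b
  grundy-edge-∈ f b x<y bxy = ∈-map⁺ (λ p → grundy f _ (removeEdge b (proj₁ p) (proj₂ p))) (∈-edgePairs⁺ b x<y bxy)

  module _ {Inv : List V → Adj → ℕ → Set} (C : Closed Inv) where

    grundy-Inv : ∀ f {m b xs a k} → Inv xs a k → Rep m b xs a → EnoughFuel f xs a → grundy f m b ≡ k

    edge-options-≢ : ∀ f {m b xs a k} → Inv xs a k → Rep m b xs a → EnoughFuel (suc f) xs a →
      k ∉ edgeOptions f m b
    edge-options-≢ f {b = b} I R F k∈ with ∈-map⁻ (λ p → grundy f _ (removeEdge b (proj₁ p) (proj₂ p))) k∈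
    ... | (x , y) , p∈ , refl with trans (sym (e-adj R x y)) (∈-edgePairs⁻ b p∈)
    ... | axy with after-edge C I (∈-rep R x) (∈-rep R y) axy
    ... | k′ , a′ , r , k′≢k , I′ = k′≢k (sym (grundy-Inv f I′ (rep-edge R x y r)
            (fuel-edge F (∈-rep R x) (∈-rep R y) axy r)))

    vertex-options-≢ : ∀ f {m b xs a k} → Inv xs a k → Rep (suc m) b xs a → EnoughFuel (suc f) xs a →
      k ∉ vertexOptions f (suc m) b
    vertex-options-≢ f {m} {b} I R F k∈ with ∈-map⁻ (λ i → grundy f m (removeVertex b i)) {xs = allFin (suc m)} k∈
    ... | i , _ , refl with rep-vertex R i
    ... | ys , p , R′ with after-vertex C I p
    ... | k′ , k′≢k , I′ = k′≢k (sym (grundy-Inv f I′ R′ (fuel-vertex F p)))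

    edge-option-below : ∀ f {m b xs a k u v a′ j} → Inv xs a k → Rep m b xs a → EnoughFuel (suc f) xs a →
      u ∈ xs → v ∈ xs → a u v ≡ true → IsRem a u v a′ → Inv xs a′ j →
      j ∈ edgeOptions f m b
    edge-option-below f {m} {b} {a = a} I R F u∈ v∈ auv r I′ with rep-∈ R u∈ | rep-∈ R v∈
    ... | x , refl | y , refl with <-cmp (toℕ x) (toℕ y)
    ...   | tri< x<y _ _ = subst (_∈ _) (grundy-Inv f I′ (rep-edge R x y r) (fuel-edge F u∈ v∈ auv r))
              (grundy-edge-∈ f b x<y (trans (e-adj R x y) auv))
    ...   | tri> _ _ y<x = subst (_∈ _) (grundy-Inv f I′ (rep-edge R y x (IsRem-swap r)) (fuel-edge F u∈ v∈ auv r))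
              (grundy-edge-∈ f b y<x (trans (e-adj R y x) (trans (symm C I _ _) auv)))
    ...   | tri≈ _ x≡y _ with toℕ-injective x≡y
    ...     | refl with trans (sym auv) (irrefl C I (e R x))
    ...       | ()

    grundy-Inv zero {m} {k = zero} I R F = refl
    -- Without fuel `grundy` answers 0. A positive value would require a move to 0, hence a vertex
    -- in `xs`, but `xs` is empty.
    grundy-Inv zero {m} {xs = xs} {k = suc k} I R (es , le , _) = ⊥-elim (empty (below C I 0 (s≤s z≤n)))
      where
      none : ∀ {u} {ys : List V} → u ∈ ys → ¬ (length ys + length es ≤ 0)
      none (here _) ()
      none (there _) ()
      empty : _ → ⊥
      empty (inj₁ (v , ys , p , _)) = none (∈-resp-↭ (↭-sym p) (here refl)) le
      empty (inj₂ (u , v , a′ , u∈ , _)) = none u∈ le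
    grundy-Inv (suc f) {zero} {b} {k = k} I R F = mex-≡ {xs = edgeOptions f 0 b ++ []} notin reach
      where
      notin : k ∉ edgeOptions f 0 b ++ []
      notin k∈ with ∈-++⁻ (edgeOptions f 0 b) k∈
      ... | inj₁ k∈ₑ = edge-options-≢ f I R F k∈ₑ
      ... | inj₂ ()
      reach : ∀ j → j < k → j ∈ edgeOptions f 0 b ++ []
      reach j j<k with below C I j j<k
      ... | inj₂ (u , v , a′ , u∈ , v∈ , auv , r , I′) = ∈-++⁺ˡ (edge-option-below f I R F u∈ v∈ auv r I′)
      ... | inj₁ (v , ys , p , I′) with rep-∈ R (∈-resp-↭ (↭-sym p) (here refl))
      ...   | () , _
    grundy-Inv (suc f) {suc m} {b} {k = k} I R F =
      mex-≡ {xs = edgeOptions f (suc m) b ++ vertexOptions f (suc m) b} notin reach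
      where
      notin : k ∉ edgeOptions f (suc m) b ++ vertexOptions f (suc m) b
      notin k∈ with ∈-++⁻ (edgeOptions f (suc m) b) k∈
      ... | inj₁ k∈ₑ = edge-options-≢ f I R F k∈ₑ
      ... | inj₂ k∈ᵥ = vertex-options-≢ f I R F k∈ᵥ
      reach : ∀ j → j < k → j ∈ edgeOptions f (suc m) b ++ vertexOptions f (suc m) b
      reach j j<k with below C I j j<k
      ... | inj₂ (u , v , a′ , u∈ , v∈ , auv , r , I′) = ∈-++⁺ˡ (edge-option-below f I R F u∈ v∈ auv r I′)
      ... | inj₁ (v , ys , p , I′) with rep-∈ R (∈-resp-↭ (↭-sym p) (here refl))
      ...   | i , refl with rep-vertex R i
      ...     | zs , q , R′ = ∈-++⁺ʳ (edgeOptions f (suc m) b) (subst (_∈ vertexOptions f (suc m) b)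
                  (grundy-Inv f I′ (rep-↭ R′ (drop-∷ (↭-trans (↭-sym p) q))) (fuel-vertex F p))
                  (∈-map⁺ (λ i → grundy f m (removeVertex b i)) (∈-allFin i)))

    nimValue-Inv : ∀ {G xs a k} → Inv xs a k → Rep (n G) (adj G) xs a → nimValue G ≡ k
    nimValue-Inv {G} {xs} {a} I R = grundy-Inv (n G + edgeCount G) I R (es , le , cov)
      where
      ε : Fin (n G) × Fin (n G) → V × V
      ε (x , y) = e R x , e R y
      es : List (V × V)
      es = map ε (edgePairs (n G) (adj G))
      le : length xs + length es ≤ n G + edgeCount G
      le = subst (_≤ n G + edgeCount G) (sym (cong₂ _+_ (trans (↭-length (e-list R)) (length-tabulate (e R)))
             (length-map ε (edgePairs (n G) (adj G))))) ≤-refl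
      cov : ∀ u v → u ∈ xs → v ∈ xs → a u v ≡ true → (u , v) ∈ es ⊎ (v , u) ∈ es
      cov u v u∈ v∈ auv with rep-∈ R u∈ | rep-∈ R v∈
      ... | x , refl | y , refl with <-cmp (toℕ x) (toℕ y)
      ...   | tri< x<y _ _ = inj₁ (∈-map⁺ ε (∈-edgePairs⁺ (adj G) x<y (trans (e-adj R x y) auv)))
      ...   | tri> _ _ y<x = inj₂ (∈-map⁺ ε (∈-edgePairs⁺ (adj G) y<x (trans (e-adj R y x) (trans (symm C I _ _) auv))))
      ...   | tri≈ _ x≡y _ with toℕ-injective x≡y
      ...     | refl with trans (sym auv) (irrefl C I (e R x))
      ...       | ()

-- Sums modulo 2, edge parities, and nimbers below 8

odd : ℕ → Bool
odd zero = false
odd (suc k) = not (odd k)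

⨁ : {A : Set} → List A → (A → Bool) → Bool
⨁ [] f = false
⨁ (x ∷ xs) f = f x xor ⨁ xs f

module _ {A : Set} where

  ⨁-cong : ∀ {f g : A → Bool} xs → (∀ {x} → x ∈ xs → f x ≡ g x) → ⨁ xs f ≡ ⨁ xs g
  ⨁-cong [] _ = refl
  ⨁-cong (x ∷ xs) h = cong₂ _xor_ (h (here refl)) (⨁-cong xs (λ x∈ → h (there x∈)))

  ⨁-false : ∀ {f : A → Bool} xs → (∀ {x} → x ∈ xs → f x ≡ false) → ⨁ xs f ≡ false
  ⨁-false [] _ = refl
  ⨁-false (x ∷ xs) h = cong₂ _xor_ (h (here refl)) (⨁-false xs (λ x∈ → h (there x∈)))

  ⨁-true : ∀ (xs : List A) → ⨁ xs (λ _ → true) ≡ odd (length xs)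
  ⨁-true [] = refl
  ⨁-true (x ∷ xs) = cong not (⨁-true xs)

  ⨁-xor : ∀ {f g : A → Bool} xs → ⨁ xs (λ x → f x xor g x) ≡ ⨁ xs f xor ⨁ xs g
  ⨁-xor [] = refl
  ⨁-xor {f} {g} (x ∷ xs) = trans (cong ((f x xor g x) xor_) (⨁-xor xs))
    (solve 4 (λ a b c d → (a :+ b) :+ (c :+ d) := (a :+ c) :+ (b :+ d)) refl (f x) (g x) (⨁ xs f) (⨁ xs g))

  ⨁-∧ : ∀ b {f : A → Bool} xs → ⨁ xs (λ x → b ∧ f x) ≡ b ∧ ⨁ xs f
  ⨁-∧ false xs = ⨁-false xs (λ _ → refl)
  ⨁-∧ true xs = refl

  ⨁-++ : ∀ {f : A → Bool} xs ys → ⨁ (xs ++ ys) f ≡ ⨁ xs f xor ⨁ ys f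
  ⨁-++ [] ys = refl
  ⨁-++ {f} (x ∷ xs) ys = trans (cong (f x xor_) (⨁-++ xs ys)) (sym (xor-assoc (f x) _ _))

  ⨁-↭ : ∀ {f : A → Bool} {xs ys} → xs ↭ ys → ⨁ xs f ≡ ⨁ ys f
  ⨁-↭ _↭_.refl = refl
  ⨁-↭ {f} (_↭_.prep x p) = cong (f x xor_) (⨁-↭ p)
  ⨁-↭ {f} (_↭_.swap {xs} {ys} x y p) = trans (cong (λ z → f x xor (f y xor z)) (⨁-↭ p))
    (solve 3 (λ a b c → a :+ (b :+ c) := b :+ (a :+ c)) refl (f x) (f y) (⨁ ys f))
  ⨁-↭ (_↭_.trans p q) = trans (⨁-↭ p) (⨁-↭ q)

  ⨁-witness : ∀ {f : A → Bool} xs → ⨁ xs f ≡ true → ∃ λ x → x ∈ xs × f x ≡ true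
  ⨁-witness {f} (x ∷ xs) h with f x in eq
  ... | true = x , here refl , eq
  ... | false with ⨁-witness xs h
  ...   | y , y∈ , fy = y , there y∈ , fy

⨁-comm : ∀ {A B : Set} (f : A → B → Bool) xs ys → ⨁ xs (λ x → ⨁ ys (f x)) ≡ ⨁ ys (λ y → ⨁ xs (λ x → f x y))
⨁-comm f [] ys = sym (⨁-false ys (λ _ → refl))
⨁-comm f (x ∷ xs) ys = trans (cong (⨁ ys (f x) xor_) (⨁-comm f xs ys)) (sym (⨁-xor ys))

⨁-map : ∀ {A B : Set} (g : A → B) {f} xs → ⨁ (map g xs) f ≡ ⨁ xs (λ x → f (g x))
⨁-map g [] = refl
⨁-map g {f} (x ∷ xs) = cong (f (g x) xor_) (⨁-map g xs)

module _ {V : Set} where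
  open Play {V}

  -- The parity of the number of edges: each entry is paired only with later ones, so every pair
  -- counts once.
  E : Adj → List V → Bool
  E a [] = false
  E a (x ∷ xs) = ⨁ xs (a x) xor E a xs

  E-cong : ∀ {a a′} xs → (∀ {x y} → x ∈ xs → y ∈ xs → a x y ≡ a′ x y) → E a xs ≡ E a′ xs
  E-cong [] h = refl
  E-cong (x ∷ xs) h = cong₂ _xor_ (⨁-cong xs (λ y∈ → h (here refl) (there y∈)))
    (E-cong xs (λ x∈ y∈ → h (there x∈) (there y∈)))

  E-++ : ∀ {a} xs ys → (∀ {x y} → x ∈ xs → y ∈ ys → a x y ≡ false) → E a (xs ++ ys) ≡ E a xs xor E a ys
  E-++ [] ys h = refl
  E-++ {a} (x ∷ xs) ys h = begin
    ⨁ (xs ++ ys) (a x) xor E a (xs ++ ys)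
      ≡⟨ cong₂ _xor_ (⨁-++ xs ys) (E-++ xs ys (λ x∈ → h (there x∈))) ⟩
    (⨁ xs (a x) xor ⨁ ys (a x)) xor (E a xs xor E a ys)
      ≡⟨ cong (λ z → (⨁ xs (a x) xor z) xor (E a xs xor E a ys)) (⨁-false ys (h (here refl))) ⟩
    (⨁ xs (a x) xor false) xor (E a xs xor E a ys)
      ≡⟨ solve 3 (λ p q r → (p :+ con false) :+ (q :+ r) := (p :+ q) :+ r) refl (⨁ xs (a x)) (E a xs) (E a ys) ⟩
    (⨁ xs (a x) xor E a xs) xor E a ys ∎

  module _ {a : Adj} (sym-a : ∀ u v → a u v ≡ a v u) where

    E-↭ : ∀ {xs ys} → xs ↭ ys → E a xs ≡ E a ys
    E-↭ _↭_.refl = refl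
    E-↭ (_↭_.prep x p) = cong₂ _xor_ (⨁-↭ p) (E-↭ p)
    E-↭ (_↭_.swap {xs} {ys} x y p) = begin
      (a x y xor ⨁ xs (a x)) xor (⨁ xs (a y) xor E a xs)
        ≡⟨ cong₂ _xor_ (cong₂ _xor_ (sym-a x y) (⨁-↭ p)) (cong₂ _xor_ (⨁-↭ p) (E-↭ p)) ⟩
      (a y x xor ⨁ ys (a x)) xor (⨁ ys (a y) xor E a ys)
        ≡⟨ solve 4 (λ p q r s → (p :+ q) :+ (r :+ s) := (p :+ r) :+ (q :+ s)) refl (a y x) (⨁ ys (a x)) (⨁ ys (a y)) (E a ys) ⟩
      (a y x xor ⨁ ys (a y)) xor (⨁ ys (a x) xor E a ys) ∎
    E-↭ (_↭_.trans p q) = trans (E-↭ p) (E-↭ q)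

    module _ (irr : ∀ u → a u u ≡ false) where

      handshake : ∀ xs → ⨁ xs (λ x → ⨁ xs (a x)) ≡ false
      handshake [] = refl
      handshake (x ∷ xs) = begin
        (a x x xor ⨁ xs (a x)) xor ⨁ xs (λ y → a y x xor ⨁ xs (a y))
          ≡⟨ cong₂ _xor_ (cong (_xor ⨁ xs (a x)) (irr x)) (⨁-xor xs) ⟩
        ⨁ xs (a x) xor (⨁ xs (λ y → a y x) xor ⨁ xs (λ y → ⨁ xs (a y)))
          ≡⟨ cong₂ (λ p q → ⨁ xs (a x) xor (p xor q)) (⨁-cong xs (λ _ → sym-a _ x)) (handshake xs) ⟩
        ⨁ xs (a x) xor (⨁ xs (a x) xor false)
          ≡⟨ cong (⨁ xs (a x) xor_) (xor-identityʳ _) ⟩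
        ⨁ xs (a x) xor ⨁ xs (a x)
          ≡⟨ xor-same (⨁ xs (a x)) ⟩
        false ∎

      -- Each edge has exactly one end of colour `true`, so the degrees in that colour class count
      -- it once.
      degree-sum-coloured : ∀ (col : V → Bool) xs → (∀ {x y} → x ∈ xs → y ∈ xs → a x y ≡ true → col x xor col y ≡ true) →
        ⨁ xs (λ x → col x ∧ ⨁ xs (a x)) ≡ E a xs
      degree-sum-coloured col [] h = refl
      degree-sum-coloured col (x ∷ xs) h = begin
        (col x ∧ (a x x xor ⨁ xs (a x))) xor ⨁ xs (λ y → col y ∧ (a y x xor ⨁ xs (a y)))
          ≡⟨ cong₂ _xor_ (cong (λ z → col x ∧ (z xor ⨁ xs (a x))) (irr x))
               (trans (⨁-cong xs (λ {y} _ → solve 3 (λ c p q → c :* (p :+ q) := c :* p :+ c :* q) refl (col y) (a y x) (⨁ xs (a y)))) (⨁-xor xs)) ⟩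
        (col x ∧ ⨁ xs (a x)) xor (⨁ xs (λ y → col y ∧ a y x) xor ⨁ xs (λ y → col y ∧ ⨁ xs (a y)))
          ≡⟨ cong₂ (λ p q → (col x ∧ ⨁ xs (a x)) xor (p xor q))
               (⨁-cong xs (λ {y} y∈ → flip-colour (h (here refl) (there y∈))))
               (degree-sum-coloured col xs (λ x∈ y∈ → h (there x∈) (there y∈))) ⟩
        (col x ∧ ⨁ xs (a x)) xor (⨁ xs (λ y → not (col x) ∧ a x y) xor E a xs)
          ≡⟨ cong (λ p → (col x ∧ ⨁ xs (a x)) xor (p xor E a xs)) (⨁-∧ (not (col x)) xs) ⟩
        (col x ∧ ⨁ xs (a x)) xor ((not (col x) ∧ ⨁ xs (a x)) xor E a xs)
          ≡⟨ split (col x) _ _ ⟩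
        ⨁ xs (a x) xor E a xs ∎
        where
        split : ∀ c p q → (c ∧ p) xor ((not c ∧ p) xor q) ≡ p xor q
        split false p q = refl
        split true p q = refl
        flip-colour : ∀ {y} → (a x y ≡ true → col x xor col y ≡ true) → col y ∧ a y x ≡ not (col x) ∧ a x y
        flip-colour {y} g rewrite sym-a y x with a x y
        ... | false = trans (∧-zeroʳ (col y)) (sym (∧-zeroʳ (not (col x))))
        ... | true with col x | col y | g refl
        ...   | true | false | _ = refl
        ...   | false | true | _ = refl

      ⨁-degree-remove : ∀ {v xs ys} → xs ↭ v ∷ ys → ⨁ xs (a v) ≡ ⨁ ys (a v)
      ⨁-degree-remove {v} {ys = ys} p = trans (⨁-↭ p) (cong (_xor ⨁ ys (a v)) (irr v))

      E-edge : ∀ xs → E a xs ≡ true → ∃ λ u → ∃ λ v → u ∈ xs × v ∈ xs × a u v ≡ true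
      E-edge (x ∷ xs) h with ⨁ xs (a x) in eq
      ... | true with ⨁-witness xs eq
      ...   | y , y∈ , axy = x , y , here refl , there y∈ , axy
      E-edge (x ∷ xs) h | false with E-edge xs h
      ...   | u , v , u∈ , v∈ , auv = u , v , there u∈ , there v∈ , auv

      -- Otherwise an odd number of odd degrees would contradict `handshake`. Summing the negated
      -- degrees makes the vertex appear as a witness.
      even-degree-vertex : ∀ xs → odd (length xs) ≡ true → ∃ λ v → v ∈ xs × ⨁ xs (a v) ≡ false
      even-degree-vertex xs h with ⨁-witness {f = λ x → not (⨁ xs (a x))} xs
        (trans (⨁-xor {f = λ _ → true} {g = λ x → ⨁ xs (a x)} xs)
          (cong₂ _xor_ (trans (⨁-true xs) h) (handshake xs)))
      ... | v , v∈ , eq = v , v∈ , trans (sym (not-involutive _)) (cong not eq)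

      -- The colouring is essential: a triangle has an odd number of edges and only even degrees.
      odd-degree-vertex : ∀ (col : V → Bool) xs →
        (∀ {x y} → x ∈ xs → y ∈ xs → a x y ≡ true → col x xor col y ≡ true) →
        E a xs ≡ true → ∃ λ v → v ∈ xs × ⨁ xs (a v) ≡ true
      odd-degree-vertex col xs h e with ⨁-witness xs (trans (degree-sum-coloured col xs h) e)
      ... | v , v∈ , eq with col v
      ...   | true = v , v∈ , eq

  Unique-resp-↭ : ∀ {xs ys : List V} → xs ↭ ys → Unique xs → Unique ys
  Unique-resp-↭ p = Permutationₛ.Unique-resp-↭ (Eq.setoid V) (↭⇒↭ₛ p)

  -- With `u` and `v` moved to the front of the list, `a u v` is the only summand that changes.
  E-rem : ∀ {a a′ u v xs} → (∀ u v → a u v ≡ a v u) → (∀ u v → a′ u v ≡ a′ v u) → (∀ u → a u u ≡ false) →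
    Unique xs → u ∈ xs → v ∈ xs → a u v ≡ true → IsRem a u v a′ → E a′ xs ≡ not (E a xs)
  E-rem {a} {a′} {u} {v} {xs} sa sa′ irr U u∈ v∈ auv r with ∈⇒↭∷ u∈
  ... | ys , p with ∈-resp-↭ p v∈
  ...   | here refl = ⊥-elim (true≢false auv (irr u))
  ...   | there v∈ys with ∈⇒↭∷ v∈ys
  ...     | zs , q with Unique-resp-↭ (↭-trans p (↭-prep u q)) U
  ...       | (u≢v ∷ u∉) ∷ (v∉ ∷ _) = begin
    E a′ xs ≡⟨ E-↭ sa′ π ⟩
    (a′ u v xor ⨁ zs (a′ u)) xor (⨁ zs (a′ v) xor E a′ zs)
      ≡⟨ cong₂ _xor_
           (cong₂ _xor_ (rem-uv r) (⨁-cong zs (λ {z} z∈ → rem-other r u z (λ { (_ , refl) → All.lookup v∉ z∈ refl }) (λ { (refl , _) → u≢v refl }))))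
           (cong₂ _xor_ (⨁-cong zs (λ {z} z∈ → rem-other r v z (λ { (refl , _) → u≢v refl }) (λ { (_ , refl) → All.lookup u∉ z∈ refl })))
             (E-cong zs (λ {x} {y} x∈ y∈ → rem-other r x y (λ { (refl , _) → All.lookup u∉ x∈ refl }) (λ { (refl , _) → All.lookup v∉ x∈ refl })))) ⟩
    ⨁ zs (a u) xor (⨁ zs (a v) xor E a zs)
      ≡⟨ sym (not-involutive _) ⟩
    not (not (⨁ zs (a u) xor (⨁ zs (a v) xor E a zs)))
      ≡⟨ cong not (solve 3 (λ p q r → con true :+ (p :+ q) := (con true :+ p) :+ q) refl (⨁ zs (a u)) (⨁ zs (a v) xor E a zs) false) ⟩
    not ((true xor ⨁ zs (a u)) xor (⨁ zs (a v) xor E a zs))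
      ≡⟨ cong (λ t → not ((t xor ⨁ zs (a u)) xor (⨁ zs (a v) xor E a zs))) (sym auv) ⟩
    not ((a u v xor ⨁ zs (a u)) xor (⨁ zs (a v) xor E a zs))
      ≡⟨ cong not (sym (E-↭ sa π)) ⟩
    not (E a xs) ∎
    where
    π : xs ↭ u ∷ v ∷ zs
    π = ↭-trans p (↭-prep u q)

-- Three bits suffice: cores have values 0, 3 and 4, bipartite graphs 0 to 3, so all nim-sums lie
-- below 8.
record Nim : Set where
  constructor nim
  field
    b₂ b₁ b₀ : Bool

bit : Bool → ℕ
bit b = if b then 1 else 0

⟦_⟧ : Nim → ℕ
⟦ nim x y z ⟧ = bit x * 4 + bit y * 2 + bit z

_⊕_ : Nim → Nim → Nim
nim x y z ⊕ nim x′ y′ z′ = nim (x xor x′) (y xor y′) (z xor z′)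

infixl 6 _⊕_

⊕-assoc : ∀ x y z → (x ⊕ y) ⊕ z ≡ x ⊕ (y ⊕ z)
⊕-assoc (nim a b c) (nim d e f) (nim g h i) with xor-assoc a d g | xor-assoc b e h | xor-assoc c f i
... | p | q | r rewrite p | q | r = refl

⊕-comm : ∀ x y → x ⊕ y ≡ y ⊕ x
⊕-comm (nim a b c) (nim d e f) rewrite xor-comm a d | xor-comm b e | xor-comm c f = refl

xor-cancelʳ : ∀ p q → (p xor q) xor q ≡ p
xor-cancelʳ p q = trans (xor-assoc p q q) (trans (cong (p xor_) (xor-same q)) (xor-identityʳ p))

⊕-cancelʳ : ∀ x y → (x ⊕ y) ⊕ y ≡ x
⊕-cancelʳ (nim a b c) (nim d e f) rewrite xor-cancelʳ a d | xor-cancelʳ b e | xor-cancelʳ c f = refl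

-- Boolean quantifiers turn a closed statement about all nimbers into a computation, so that `refl`
-- proves it.
∀Bool : (Bool → Bool) → Bool
∀Bool f = f false ∧ f true

∀Bool-sound : ∀ f → ∀Bool f ≡ true → ∀ b → f b ≡ true
∀Bool-sound f h false with f false
... | true = refl
∀Bool-sound f h true with f false
... | true = h

∀Nim : (Nim → Bool) → Bool
∀Nim f = ∀Bool λ x → ∀Bool λ y → ∀Bool λ z → f (nim x y z)

∀Nim-sound : ∀ f → ∀Nim f ≡ true → ∀ x → f x ≡ true
∀Nim-sound f h (nim x y z) =
  ∀Bool-sound (λ z → f (nim x y z))
    (∀Bool-sound (λ y → ∀Bool λ z → f (nim x y z))
      (∀Bool-sound (λ x → ∀Bool λ y → ∀Bool λ z → f (nim x y z)) h x) y) z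

implies : ∀ {p q} → not p ∨ q ≡ true → p ≡ true → q ≡ true
implies {true} h refl = h

⟦⟧-injective : ∀ x y → ⟦ x ⟧ ≡ ⟦ y ⟧ → x ≡ y
⟦⟧-injective x y eq = decode (implies (∀Nim-sound (λ y → not (⟦ x ⟧ ≡ᵇ ⟦ y ⟧) ∨ same x y)
    (∀Nim-sound (λ x → ∀Nim λ y → not (⟦ x ⟧ ≡ᵇ ⟦ y ⟧) ∨ same x y) refl x) y)
    (T⇒≡true (≡⇒≡ᵇ ⟦ x ⟧ ⟦ y ⟧ eq)))
  where
  same : Nim → Nim → Bool
  same (nim a b c) (nim d e f) = not (a xor d) ∧ (not (b xor e) ∧ not (c xor f))
  decode : ∀ {x y} → same x y ≡ true → x ≡ y
  decode {nim a b c} {nim d e f} h with a | d | b | e | c | f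
  ... | false | false | false | false | false | false = refl
  ... | false | false | false | false | true | true = refl
  ... | false | false | true | true | false | false = refl
  ... | false | false | true | true | true | true = refl
  ... | true | true | false | false | false | false = refl
  ... | true | true | false | false | true | true = refl
  ... | true | true | true | true | false | false = refl
  ... | true | true | true | true | true | true = refl

-- A nimber z below x ⊕ y lacks the leading bit of z ⊕ x ⊕ y, which x or y must then possess.
<⊕ : ∀ x y z → ⟦ z ⟧ < ⟦ x ⊕ y ⟧ → ⟦ z ⊕ y ⟧ < ⟦ x ⟧ ⊎ ⟦ z ⊕ x ⟧ < ⟦ y ⟧
<⊕ x y z lt = decode (implies
    (∀Nim-sound (test x y)
      (∀Nim-sound (λ y → ∀Nim (test x y))
        (∀Nim-sound (λ x → ∀Nim λ y → ∀Nim (test x y)) refl x) y) z)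
    (T⇒≡true (<⇒<ᵇ lt)))
  where
  test : Nim → Nim → Nim → Bool
  test x y z = not (⟦ z ⟧ <ᵇ ⟦ x ⊕ y ⟧) ∨ ((⟦ z ⊕ y ⟧ <ᵇ ⟦ x ⟧) ∨ (⟦ z ⊕ x ⟧ <ᵇ ⟦ y ⟧))
  decode : (⟦ z ⊕ y ⟧ <ᵇ ⟦ x ⟧) ∨ (⟦ z ⊕ x ⟧ <ᵇ ⟦ y ⟧) ≡ true → ⟦ z ⊕ y ⟧ < ⟦ x ⟧ ⊎ ⟦ z ⊕ x ⟧ < ⟦ y ⟧
  decode h with ⟦ z ⊕ y ⟧ <ᵇ ⟦ x ⟧ in eq
  ... | true = inj₁ (<ᵇ⇒< ⟦ z ⊕ y ⟧ ⟦ x ⟧ (≡true⇒T eq))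
  ... | false = inj₂ (<ᵇ⇒< ⟦ z ⊕ x ⟧ ⟦ y ⟧ (≡true⇒T h))

fromℕ-below : ∀ x j → j < ⟦ x ⟧ → ∃ λ z → ⟦ z ⟧ ≡ j
fromℕ-below x 0 _ = nim false false false , refl
fromℕ-below x 1 _ = nim false false true , refl
fromℕ-below x 2 _ = nim false true false , refl
fromℕ-below x 3 _ = nim false true true , refl
fromℕ-below x 4 _ = nim true false false , refl
fromℕ-below x 5 _ = nim true false true , refl
fromℕ-below x 6 _ = nim true true false , refl
fromℕ-below (nim false false false) (suc (suc (suc (suc (suc (suc (suc j))))))) ()
fromℕ-below (nim false false true) (suc (suc (suc (suc (suc (suc (suc j))))))) (s≤s ())
fromℕ-below (nim false true false) (suc (suc (suc (suc (suc (suc (suc j))))))) (s≤s (s≤s ()))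
fromℕ-below (nim false true true) (suc (suc (suc (suc (suc (suc (suc j))))))) (s≤s (s≤s (s≤s ())))
fromℕ-below (nim true false false) (suc (suc (suc (suc (suc (suc (suc j))))))) (s≤s (s≤s (s≤s (s≤s ()))))
fromℕ-below (nim true false true) (suc (suc (suc (suc (suc (suc (suc j))))))) (s≤s (s≤s (s≤s (s≤s (s≤s ())))))
fromℕ-below (nim true true false) (suc (suc (suc (suc (suc (suc (suc j))))))) (s≤s (s≤s (s≤s (s≤s (s≤s (s≤s ()))))))
fromℕ-below (nim true true true) (suc (suc (suc (suc (suc (suc (suc j))))))) (s≤s (s≤s (s≤s (s≤s (s≤s (s≤s (s≤s ())))))))

-- Hairballs

does-true : ∀ {P : Set} {p? : Dec P} → does p? ≡ true → P
does-true {p? = yes p} _ = p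

unique-↭ : ∀ {A : Set} {xs ys : List A} → Unique xs → Unique ys →
  (∀ {v} → v ∈ xs → v ∈ ys) → (∀ {v} → v ∈ ys → v ∈ xs) → xs ↭ ys
unique-↭ u u′ f g = ∼bag⇒↭ (unique∧set⇒bag u u′ (mk⇔ f g))

⨁-update : ∀ {A : Set} {f g : A → Bool} {y : A} {xs} → Unique xs → y ∈ xs → (∀ x → x ≢ y → f x ≡ g x) →
  ⨁ xs f ≡ ⨁ xs g xor (g y xor f y)
⨁-update {f = f} {g} {y} {xs} U y∈ h with ∈⇒↭∷ y∈
... | zs , p with Unique-resp-↭ p U
...   | y∉ ∷ _ = begin
  ⨁ xs f ≡⟨ ⨁-↭ p ⟩
  f y xor ⨁ zs f ≡⟨ cong (f y xor_) (⨁-cong zs (λ {x} x∈ → h x (λ { refl → All.lookup y∉ x∈ refl }))) ⟩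
  f y xor ⨁ zs g ≡⟨ rearrange (f y) (g y) (⨁ zs g) ⟩
  (g y xor ⨁ zs g) xor (g y xor f y) ≡⟨ cong (_xor (g y xor f y)) (sym (⨁-↭ p)) ⟩
  ⨁ xs g xor (g y xor f y) ∎
  where
  rearrange : ∀ a b c → a xor c ≡ (b xor c) xor (b xor a)
  rearrange false false c = sym (xor-identityʳ c)
  rearrange false true c = trans (sym (not-involutive c)) (sym (xor-comm (not c) true))
  rearrange true false c = xor-comm true c
  rearrange true true c = sym (xor-identityʳ (not c))

module _ {A : Set} (_≟_ : DecidableEquality A) where

  ⨁-δ∈ : ∀ {y : A} {xs} → Unique xs → y ∈ xs → ⨁ xs (λ x → does (x ≟ y)) ≡ true
  ⨁-δ∈ {y} {xs} U y∈ = begin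
    ⨁ xs (λ x → does (x ≟ y)) ≡⟨ ⨁-update U y∈ (λ x x≢y → dec-false (x ≟ y) x≢y) ⟩
    ⨁ xs (λ _ → false) xor does (y ≟ y) ≡⟨ cong₂ _xor_ (⨁-false xs (λ _ → refl)) (dec-true (y ≟ y) refl) ⟩
    true ∎

  ⨁-δ∉ : ∀ {y : A} {xs} → y ∉ xs → ⨁ xs (λ x → does (x ≟ y)) ≡ false
  ⨁-δ∉ {y} {xs} y∉ = ⨁-false xs (λ {x} x∈ → dec-false (x ≟ y) (λ { refl → y∉ x∈ }))

-- If each edge carries exactly one arc of `o`, the edges can be counted at their tails.
E-oriented : ∀ {V : Set} {a o : V → V → Bool} → (∀ x y → a x y ≡ o x y xor o y x) → (∀ x → o x x ≡ false) →
  ∀ xs → E a xs ≡ ⨁ xs (λ x → ⨁ xs (o x))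
E-oriented h ir [] = refl
E-oriented {a = a} {o} h ir (x ∷ xs) = begin
  ⨁ xs (a x) xor E a xs
    ≡⟨ cong₂ _xor_ (trans (⨁-cong xs (λ {y} _ → h x y)) (⨁-xor xs)) (E-oriented h ir xs) ⟩
  (⨁ xs (o x) xor ⨁ xs (λ y → o y x)) xor ⨁ xs (λ y → ⨁ xs (o y))
    ≡⟨ xor-assoc (⨁ xs (o x)) _ _ ⟩
  ⨁ xs (o x) xor (⨁ xs (λ y → o y x) xor ⨁ xs (λ y → ⨁ xs (o y)))
    ≡⟨ cong₂ _xor_ (cong (_xor ⨁ xs (o x)) (sym (ir x))) (sym (⨁-xor xs)) ⟩
  (o x x xor ⨁ xs (o x)) xor ⨁ xs (λ y → o y x xor ⨁ xs (o y)) ∎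

-- The predecessor is primitive because matching on its argument yields just the pairs by which
-- `Cycle` lists its edges: `inject₁ k` before `suc k`, and the last vertex before `zero`.
cpred : ∀ {n} → Fin (suc n) → Fin (suc n)
cpred {n} zero = fromℕ n
cpred (suc i) = inject₁ i

cpred-injective : ∀ {n} {i j : Fin (suc n)} → cpred i ≡ cpred j → i ≡ j
cpred-injective {i = zero} {zero} _ = refl
cpred-injective {i = zero} {suc j} eq = ⊥-elim (fromℕ≢inject₁ eq)
cpred-injective {i = suc i} {zero} eq = ⊥-elim (fromℕ≢inject₁ (sym eq))
cpred-injective {i = suc i} {suc j} eq = cong suc (inject₁-injective eq)

csucc : ∀ {n} → Fin (suc n) → Fin (suc n)
csucc i with view i
... | ‵fromℕ = zero
... | ‵inject₁ j = suc j

cpred-csucc : ∀ {n} (i : Fin (suc n)) → cpred (csucc i) ≡ i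
cpred-csucc i with view i
... | ‵fromℕ = refl
... | ‵inject₁ j = refl

csucc-cpred : ∀ {n} (i : Fin (suc n)) → csucc (cpred i) ≡ i
csucc-cpred i = cpred-injective (cpred-csucc (cpred i))

cpred≢id : ∀ {n} (i : Fin (suc (suc n))) → cpred i ≢ i
cpred≢id zero ()
cpred≢id (suc i) eq = 1+n≢n (trans (sym (cong toℕ eq)) (toℕ-inject₁ i))

-- A cycle of length at least 3 has no two opposite arcs between the same vertices; this becomes
-- `target²≢id`.
cpred²≢id : ∀ {n} (i : Fin (suc (suc (suc n)))) → cpred (cpred i) ≢ i
cpred²≢id zero ()
cpred²≢id (suc zero) ()
cpred²≢id (suc (suc i)) eq = <-irrefl (trans (trans (sym (toℕ-inject₁ i)) (sym (toℕ-inject₁ (inject₁ i)))) (cong toℕ eq)) (m<n⇒m<1+n (n<1+n (toℕ i)))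

module Ambient (r K : ℕ) where

  M : ℕ
  M = 3 + r

  -- `hair c w d` lies at depth `d` in slot `w` at the cycle vertex `c`, depth 0 being next to the
  -- cycle. A hairball uses the labels cut out by one length per slot, and length 0 leaves the slot
  -- empty.
  data V : Set where
    cyc : Fin M → V
    hair : Fin M → Fin K → ℕ → V

  open Play {V} public

  cyc-injective : ∀ {i j} → cyc i ≡ cyc j → i ≡ j
  cyc-injective refl = refl

  _≟V_ : DecidableEquality V
  cyc i ≟V cyc j = map′ (cong cyc) cyc-injective (i ≟ᶠ j)
  cyc i ≟V hair _ _ _ = no λ ()
  hair _ _ _ ≟V cyc j = no λ ()
  hair c w d ≟V hair c′ w′ d′ = map′ (λ { (refl , refl , refl) → refl }) (λ { refl → refl , refl , refl })
    (c ≟ᶠ c′ ×-dec w ≟ᶠ w′ ×-dec d ≟ℕ d′)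

  -- Every vertex has exactly one outgoing arc: along the cycle, or down its hair towards the cycle.
  target : V → V
  target (cyc i) = cyc (csucc i)
  target (hair c w zero) = cyc c
  target (hair c w (suc d)) = hair c w d

  arc : V → V → Bool
  arc u v = does (v ≟V target u)

  adjV : Adj
  adjV u v = arc u v ∨ arc v u

  target≢id : ∀ u → target u ≢ u
  target≢id (cyc i) eq = cpred≢id i (trans (cong cpred (sym (cyc-injective eq))) (cpred-csucc i))
  target≢id (hair c w zero) ()
  target≢id (hair c w (suc d)) ()

  target²≢id : ∀ u → target (target u) ≢ u
  target²≢id (cyc i) eq = cpred²≢id i (begin
    cpred (cpred i) ≡⟨ cong (cpred ∘ cpred) (sym (cyc-injective eq)) ⟩
    cpred (cpred (csucc (csucc i))) ≡⟨ cong cpred (cpred-csucc (csucc i)) ⟩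
    cpred (csucc i) ≡⟨ cpred-csucc i ⟩
    i ∎)
  target²≢id (hair c w zero) ()
  target²≢id (hair c w (suc zero)) ()
  target²≢id (hair c w (suc (suc d))) ()

  adjV-sym : ∀ u v → adjV u v ≡ adjV v u
  adjV-sym u v = ∨-comm (arc u v) (arc v u)

  adjV-target : ∀ u → adjV u (target u) ≡ true
  adjV-target u rewrite dec-true (target u ≟V target u) refl = refl

  adjV⇒ : ∀ u v → adjV u v ≡ true → v ≡ target u ⊎ u ≡ target v
  adjV⇒ u v h with v ≟V target u | u ≟V target v
  ... | yes p | _ = inj₁ p
  ... | no _ | yes q = inj₂ q

  adjV-irrefl : ∀ u → adjV u u ≡ false
  adjV-irrefl u rewrite dec-false (u ≟V target u) (λ eq → target≢id u (sym eq)) = refl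

  -- As no two arcs are opposite, the disjunction is a sum modulo 2, and neighbours can be counted
  -- arc by arc.
  adjV-xor : ∀ u v → adjV u v ≡ arc u v xor arc v u
  adjV-xor u v with v ≟V target u | u ≟V target v
  ... | yes refl | yes q = ⊥-elim (target²≢id u (sym q))
  ... | yes _ | no _ = refl
  ... | no _ | _ = refl

  Lengths : Set
  Lengths = Fin M → Fin K → ℕ

  InCore : Lengths → V → Set
  InCore ℓ (cyc _) = ⊤
  InCore ℓ (hair c w d) = d < ℓ c w

  inCore? : ∀ ℓ v → Dec (InCore ℓ v)
  inCore? ℓ (cyc _) = yes tt
  inCore? ℓ (hair c w d) = d <?ℕ ℓ c w

  InCore-target : ∀ {ℓ} u → InCore ℓ u → InCore ℓ (target u)
  InCore-target (cyc _) _ = tt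
  InCore-target (hair c w zero) _ = tt
  InCore-target (hair c w (suc d)) p = ≤-trans (n<1+n d) (≤-pred (m<n⇒m<1+n p))

  upd : Lengths → Fin M → Fin K → ℕ → Lengths
  upd ℓ c w d c′ w′ = if does (c′ ≟ᶠ c) ∧ does (w′ ≟ᶠ w) then d else ℓ c′ w′

  upd-at : ∀ ℓ c w d → upd ℓ c w d c w ≡ d
  upd-at ℓ c w d rewrite dec-true (c ≟ᶠ c) refl | dec-true (w ≟ᶠ w) refl = refl

  upd-other : ∀ ℓ c w d {c′ w′} → ¬ (c′ ≡ c × w′ ≡ w) → upd ℓ c w d c′ w′ ≡ ℓ c′ w′
  upd-other ℓ c w d {c′} {w′} h with c′ ≟ᶠ c | w′ ≟ᶠ w
  ... | yes p | yes q = ⊥-elim (h (p , q))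
  ... | yes _ | no _ = refl
  ... | no _ | _ = refl

  tally : (ℕ → Bool) → Lengths → Fin M → Bool
  tally g ℓ c = ⨁ (allFin K) (λ w → g (ℓ c w))

  tally-upd : ∀ g ℓ c w d → tally g (upd ℓ c w d) c ≡ tally g ℓ c xor (g (ℓ c w) xor g d)
  tally-upd g ℓ c w d = trans
    (⨁-update (allFin⁺ K) (∈-allFin w) (λ x x≢w → cong g (upd-other ℓ c w d (λ { (_ , q) → x≢w q }))))
    (cong (λ z → tally g ℓ c xor (g (ℓ c w) xor g z)) (upd-at ℓ c w d))

  tally-upd-other : ∀ g ℓ c w d {c′} → c′ ≢ c → tally g (upd ℓ c w d) c′ ≡ tally g ℓ c′
  tally-upd-other g ℓ c w d h = ⨁-cong (allFin K) (λ _ → cong g (upd-other ℓ c w d (λ { (p , _) → h p })))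

  -- S ℓ c n : parity of the number of hairs of length n + 1 at c; D ℓ c : parity of the degree of c.
  S : Lengths → Fin M → ℕ → Bool
  S ℓ c n = tally (_≡ᵇ suc n) ℓ c

  D : Lengths → Fin M → Bool
  D = tally (0 <ᵇ_)

  -- The parity of the number of vertices, as `length-core` shows; the `not` stands for the odd
  -- cycle.
  N : Lengths → Bool
  N ℓ = not (⨁ (allFin M) (tally odd ℓ))

  N-upd : ∀ ℓ c w d → N (upd ℓ c w d) ≡ N ℓ xor (odd (ℓ c w) xor odd d)
  N-upd ℓ c w d = trans (cong not (trans
    (⨁-update {f = tally odd (upd ℓ c w d)} {g = tally odd ℓ} (allFin⁺ M) (∈-allFin c) (λ x → tally-upd-other odd ℓ c w d))
    (cong (⨁ (allFin M) (tally odd ℓ) xor_) (trans (cong (tally odd ℓ c xor_) (tally-upd odd ℓ c w d))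
       (cancelˡ (tally odd ℓ c) _)))))
    (not-distribˡ-xor (⨁ (allFin M) (tally odd ℓ)) _)
    where
    cancelˡ : ∀ x y → x xor (x xor y) ≡ y
    cancelˡ false y = refl
    cancelˡ true y = not-involutive y

  record IsCore (ℓ : Lengths) (cs : List V) : Set where
    field
      unique : Unique cs
      sound : ∀ {v} → v ∈ cs → InCore ℓ v
      complete : ∀ {v} → InCore ℓ v → v ∈ cs
  open IsCore public

  -- Each vertex is the tail of exactly one arc, so edges and vertices are equal in number.
  E-core-length : ∀ {ℓ cs} → IsCore ℓ cs → E adjV cs ≡ odd (length cs)
  E-core-length {ℓ} {cs} C = begin
    E adjV cs ≡⟨ E-oriented adjV-xor (λ x → dec-false (x ≟V target x) (λ eq → target≢id x (sym eq))) cs ⟩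
    ⨁ cs (λ x → ⨁ cs (arc x)) ≡⟨ ⨁-cong cs (λ {x} x∈ → ⨁-δ∈ _≟V_ (unique C) (complete C (InCore-target x (sound C x∈)))) ⟩
    ⨁ cs (λ _ → true) ≡⟨ ⨁-true cs ⟩
    odd (length cs) ∎

  -- The parent always counts, so the parity tells whether there is a child: only leaves have odd
  -- degree.
  degree-hair : ∀ {ℓ cs c w d} → IsCore ℓ cs → InCore ℓ (hair c w d) →
    ⨁ cs (adjV (hair c w d)) ≡ not (does (suc d <?ℕ ℓ c w))
  degree-hair {ℓ} {cs} {c} {w} {d} C v∈ = begin
    ⨁ cs (adjV (hair c w d)) ≡⟨ ⨁-cong cs (λ {y} _ → trans (adjV-xor (hair c w d) y) (cong (arc (hair c w d) y xor_) (child y))) ⟩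
    ⨁ cs (λ y → arc (hair c w d) y xor does (y ≟V hair c w (suc d))) ≡⟨ ⨁-xor cs ⟩
    ⨁ cs (arc (hair c w d)) xor ⨁ cs (λ y → does (y ≟V hair c w (suc d)))
      ≡⟨ cong₂ _xor_ (⨁-δ∈ _≟V_ (unique C) (complete C (InCore-target (hair c w d) v∈))) present ⟩
    not (does (suc d <?ℕ ℓ c w)) ∎
    where
    child : ∀ y → arc y (hair c w d) ≡ does (y ≟V hair c w (suc d))
    child y = does-⇔ (mk⇔ (from y) (λ { refl → refl })) (hair c w d ≟V target y) (y ≟V hair c w (suc d))
      where
      from : ∀ y → hair c w d ≡ target y → y ≡ hair c w (suc d)
      from (cyc _) ()
      from (hair _ _ zero) ()
      from (hair _ _ (suc _)) refl = refl
    present : ⨁ cs (λ y → does (y ≟V hair c w (suc d))) ≡ does (suc d <?ℕ ℓ c w)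
    present with suc d <?ℕ ℓ c w
    ... | yes p = trans (⨁-δ∈ _≟V_ (unique C) (complete C {hair c w (suc d)} p)) (sym (T⇒≡true (<⇒<ᵇ p)))
    ... | no ¬p = trans (⨁-δ∉ _≟V_ (λ m → ¬p (sound C m))) (sym (≢true⇒≡false (λ t → ¬p (<ᵇ⇒< _ _ (≡true⇒T t)))))

  -- The two neighbours along the cycle cancel, and each nonempty slot contributes its vertex of
  -- depth 0.
  degree-cyc : ∀ {ℓ cs} c → IsCore ℓ cs → ⨁ cs (adjV (cyc c)) ≡ D ℓ c
  degree-cyc {ℓ} {cs} c C = begin
    ⨁ cs (adjV (cyc c)) ≡⟨ ⨁-cong cs (λ {y} _ → trans (adjV-xor (cyc c) y) (cong (arc (cyc c) y xor_) (into y))) ⟩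
    ⨁ cs (λ y → arc (cyc c) y xor (does (y ≟V cyc (cpred c)) xor ⨁ (allFin K) (λ w → does (y ≟V hair c w 0))))
      ≡⟨ ⨁-xor cs ⟩
    ⨁ cs (arc (cyc c)) xor ⨁ cs (λ y → does (y ≟V cyc (cpred c)) xor ⨁ (allFin K) (λ w → does (y ≟V hair c w 0)))
      ≡⟨ cong₂ _xor_ (⨁-δ∈ _≟V_ (unique C) (complete C tt)) (⨁-xor cs) ⟩
    not (⨁ cs (λ y → does (y ≟V cyc (cpred c))) xor ⨁ cs (λ y → ⨁ (allFin K) (λ w → does (y ≟V hair c w 0))))
      ≡⟨ cong not (cong₂ _xor_ (⨁-δ∈ _≟V_ (unique C) (complete C tt)) (⨁-comm (λ y w → does (y ≟V hair c w 0)) cs (allFin K))) ⟩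
    not (not (⨁ (allFin K) (λ w → ⨁ cs (λ y → does (y ≟V hair c w 0)))))
      ≡⟨ not-involutive _ ⟩
    ⨁ (allFin K) (λ w → ⨁ cs (λ y → does (y ≟V hair c w 0)))
      ≡⟨ ⨁-cong (allFin K) (λ {w} _ → present w) ⟩
    D ℓ c ∎
    where
    into : ∀ y → arc y (cyc c) ≡ does (y ≟V cyc (cpred c)) xor ⨁ (allFin K) (λ w → does (y ≟V hair c w 0))
    into (cyc j) = trans
      (does-⇔ (mk⇔ (λ { refl → cong cyc (sym (cpred-csucc j)) }) (λ { refl → cong cyc (sym (csucc-cpred c)) })) (cyc c ≟V cyc (csucc j)) (cyc j ≟V cyc (cpred c)))
      (trans (sym (xor-identityʳ _)) (cong (does (cyc j ≟V cyc (cpred c)) xor_) (sym (⨁-false (allFin K) (λ _ → refl)))))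
    into (hair c′ w′ zero) with c ≟ᶠ c′
    ... | yes refl = sym (trans (⨁-cong (allFin K) (λ {w} _ → does-⇔ (mk⇔ (λ { refl → refl }) (λ { refl → refl })) (hair c w′ 0 ≟V hair c w 0) (w ≟ᶠ w′)))
                       (⨁-δ∈ _≟ᶠ_ (allFin⁺ K) (∈-allFin w′)))
    ... | no c≢c′ = sym (⨁-false (allFin K) (λ {w} _ → dec-false (hair c′ w′ 0 ≟V hair c w 0) (λ { refl → c≢c′ refl })))
    into (hair c′ w′ (suc d)) = sym (⨁-false (allFin K) (λ {w} _ → dec-false (hair c′ w′ (suc d) ≟V hair c w 0) (λ ())))
    present : ∀ w → ⨁ cs (λ y → does (y ≟V hair c w 0)) ≡ (0 <ᵇ ℓ c w)
    present w with 0 <?ℕ ℓ c w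
    ... | yes p = trans (⨁-δ∈ _≟V_ (unique C) (complete C {hair c w 0} p)) (sym (T⇒≡true (<⇒<ᵇ p)))
    ... | no ¬p = trans (⨁-δ∉ _≟V_ (λ m → ¬p (sound C m))) (sym (≢true⇒≡false (λ t → ¬p (<ᵇ⇒< 0 (ℓ c w) (≡true⇒T t)))))

  core-upd : ∀ {ℓ c w d v} → d ≤ ℓ c w → InCore (upd ℓ c w d) v → InCore ℓ v
  core-upd {v = cyc _} le p = tt
  core-upd {ℓ} {c = c} {w} {d} {hair c′ w′ d′} le p with c′ ≟ᶠ c | w′ ≟ᶠ w
  ... | yes refl | yes refl = ≤-trans p le
  ... | yes _ | no _ = p
  ... | no _ | _ = p

  InTail : Lengths → Fin M → Fin K → ℕ → V → Set
  InTail ℓ c w d v = ∃ λ d′ → v ≡ hair c w d′ × d ≤ d′ × d′ < ℓ c w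

  core-split : ∀ ℓ c w d {v} → InCore ℓ v → InCore (upd ℓ c w d) v ⊎ InTail ℓ c w d v
  core-split ℓ c w d {cyc _} p = inj₁ tt
  core-split ℓ c w d {hair c′ w′ d′} p with c′ ≟ᶠ c | w′ ≟ᶠ w
  ... | yes _ | no _ = inj₁ p
  ... | no _ | _ = inj₁ p
  ... | yes refl | yes refl with d′ <?ℕ d
  ...   | yes lt = inj₁ lt
  ...   | no ¬lt = inj₂ (d′ , refl , ≮⇒≥ ¬lt , p)

  module _ (M-odd : odd M ≡ true) where

    -- Removing the tip of a hair flips both sides; once no hair is left, only the odd cycle
    -- remains.
    length-core : ∀ {ℓ cs} → IsCore ℓ cs → odd (length cs) ≡ N ℓ
    length-core {cs = cs} C = go (length cs) ≤-refl C
      where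
      go : ∀ n {ℓ cs} → length cs ≤ n → IsCore ℓ cs → odd (length cs) ≡ N ℓ
      go n {ℓ} {cs} le C with anyFin? (λ c → anyFin? (λ w → 0 <?ℕ ℓ c w))
      ... | no none = begin
        odd (length cs) ≡⟨ cong odd (↭-length (unique-↭ (unique C) (map⁺ cyc-injective (allFin⁺ M)) to from)) ⟩
        odd (length (map cyc (allFin M))) ≡⟨ cong odd (trans (length-map cyc (allFin M)) (length-tabulate {n = M} (λ z → z))) ⟩
        odd M ≡⟨ M-odd ⟩
        true ≡⟨ cong not (sym (⨁-false (allFin M) (λ {c} _ → ⨁-false (allFin K) (λ {w} _ → cong odd (zero-length c w))))) ⟩
        N ℓ ∎
        where
        zero-length : ∀ c w → ℓ c w ≡ 0
        zero-length c w with ℓ c w in eq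
        ... | zero = refl
        ... | suc _ = ⊥-elim (none (c , w , subst (0 <_) (sym eq) (s≤s z≤n)))
        to : ∀ {v} → v ∈ cs → v ∈ map cyc (allFin M)
        to {cyc i} _ = ∈-map⁺ cyc (∈-allFin i)
        to {hair c w d} v∈ = ⊥-elim (none (c , w , ≤-trans (s≤s z≤n) (sound C v∈)))
        from : ∀ {v} → v ∈ map cyc (allFin M) → v ∈ cs
        from v∈ with ∈-map⁻ cyc v∈
        ... | i , _ , refl = complete C tt
      ... | yes (c , w , pos) with ℓ c w in eq
      ...   | suc d with ∈⇒↭∷ (complete C {hair c w d} (subst (d <_) (sym eq) (n<1+n d)))
      ...     | zs , p with subst (_≤ n) (↭-length p) le | Unique-resp-↭ p (unique C)
      go (suc n) {ℓ} {cs} le C | yes (c , w , pos) | suc d | zs , p | s≤s le′ | v∉ ∷ U = begin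
        odd (length cs) ≡⟨ cong odd (↭-length p) ⟩
        not (odd (length zs)) ≡⟨ cong not (go n le′ C′) ⟩
        not (N (upd ℓ c w d)) ≡⟨ cong not (trans (N-upd ℓ c w d) (cong (λ z → N ℓ xor (odd z xor odd d)) eq)) ⟩
        not (N ℓ xor (not (odd d) xor odd d)) ≡⟨ flip (N ℓ) (odd d) ⟩
        N ℓ ∎
        where
        flip : ∀ x y → not (x xor (not y xor y)) ≡ x
        flip false false = refl
        flip false true = refl
        flip true false = refl
        flip true true = refl
        C′ : IsCore (upd ℓ c w d) zs
        C′ = record
          { unique = U
          ; sound = λ {v} v∈ → [ (λ x → x) , (λ { (d′ , refl , d≤ , d<) → ⊥-elim (All.lookup v∉ v∈ (cong (hair c w) (≤-antisym d≤ (≤-pred (subst (d′ <_) eq d<))))) }) ]′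
              (core-split ℓ c w d (sound C (∈-resp-↭ (↭-sym p) (there v∈))))
          ; complete = λ {v} q → complete′ v q (∈-resp-↭ p (complete C (core-upd (subst (d ≤_) (sym eq) (n≤1+n d)) q))) }
          where
          complete′ : ∀ v → InCore (upd ℓ c w d) v → v ∈ hair c w d ∷ zs → v ∈ zs
          complete′ v q (there m) = m
          complete′ v q (here refl) = ⊥-elim (<-irrefl (sym (upd-at ℓ c w d)) q)

    E-core : ∀ {ℓ cs} → IsCore ℓ cs → E adjV cs ≡ N ℓ
    E-core C = trans (E-core-length C) (length-core C)

    -- Colours alternating with the index clash only on the arc from the last vertex to 0, the cycle
    -- being odd. Flipping all colours beyond `i` moves the clash to the arc leaving `i`.
    cutColour : Fin M → Fin M → Bool
    cutColour i j = odd (toℕ j) xor (toℕ i <ᵇ toℕ j)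

    <ᵇ-suc : ∀ i t → i ≢ t → (i <ᵇ t) ≡ (i <ᵇ suc t)
    <ᵇ-suc zero zero h = ⊥-elim (h refl)
    <ᵇ-suc zero (suc t) h = refl
    <ᵇ-suc (suc i) zero h = refl
    <ᵇ-suc (suc i) (suc t) h = <ᵇ-suc i t (λ { refl → h refl })

    cutColour-step : ∀ i j → cpred j ≢ i → cutColour i (cpred j) xor cutColour i j ≡ true
    cutColour-step i zero h rewrite toℕ-fromℕ r =
      trans (xor-identityʳ _) (cong₂ _xor_ (trans (sym (not-involutive _)) (cong not M-odd)) (T⇒≡true (<⇒<ᵇ i<)))
      where
      i< : toℕ i < 2 + r
      i< = ≤∧≢⇒< (≤-pred (toℕ<n i)) (λ eq → h (toℕ-injective (trans (toℕ-fromℕ (2 + r)) (sym eq))))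
    cutColour-step i (suc j) h rewrite toℕ-inject₁ j
      | <ᵇ-suc (toℕ i) (toℕ j) (λ eq → h (toℕ-injective (trans (toℕ-inject₁ j) (sym eq)))) = flip (odd (toℕ j)) (toℕ i <ᵇ suc (toℕ j))
      where
      flip : ∀ x y → (x xor y) xor (not x xor y) ≡ true
      flip false false = refl
      flip false true = refl
      flip true false = refl
      flip true true = refl

    cutCol : Fin M → V → Bool
    cutCol i (cyc j) = cutColour i j
    cutCol i (hair c w d) = cutColour i c xor not (odd d)

    -- Cutting the odd cycle at the arc leaving i makes the core bipartite.
    cutCol-target : ∀ i u → u ≢ cyc i → cutCol i u xor cutCol i (target u) ≡ true
    cutCol-target i (cyc j) h = subst (λ z → cutColour i z xor cutColour i (csucc j) ≡ true) (cpred-csucc j)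
      (cutColour-step i (csucc j) (λ eq → h (cong cyc (trans (sym (cpred-csucc j)) eq))))
    cutCol-target i (hair c w zero) h with cutColour i c
    ... | false = refl
    ... | true = refl
    cutCol-target i (hair c w (suc d)) h with cutColour i c | odd d
    ... | false | false = refl
    ... | false | true = refl
    ... | true | false = refl
    ... | true | true = refl

-- Parities of hair lengths

≡ᵇ-refl : ∀ i → (i ≡ᵇ i) ≡ true
≡ᵇ-refl i = T⇒≡true (≡⇒≡ᵇ i i refl)

≡ᵇ-comm : ∀ i j → (i ≡ᵇ j) ≡ (j ≡ᵇ i)
≡ᵇ-comm zero zero = refl
≡ᵇ-comm zero (suc j) = refl
≡ᵇ-comm (suc i) zero = refl
≡ᵇ-comm (suc i) (suc j) = ≡ᵇ-comm i j

≢⇒≡ᵇ : ∀ {i j} → i ≢ j → (i ≡ᵇ j) ≡ false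
≢⇒≡ᵇ {i} {j} h = ≢true⇒≡false (λ t → h (≡ᵇ⇒≡ i j (≡true⇒T t)))

bounded : ∀ {n} (f : Fin n → ℕ) → ∃ λ B → ∀ i → f i ≤ B
bounded {zero} f = 0 , λ ()
bounded {suc n} f with bounded (λ i → f (suc i))
... | B , h = f zero ⊔ B , λ { zero → m≤m⊔n (f zero) B ; (suc i) → ≤-trans (h i) (m≤n⊔m (f zero) B) }

least : ∀ {P : ℕ → Set} → (∀ n → Dec (P n)) → ∀ n → P n → ∃ λ m → P m × (∀ j → j < m → ¬ P j)
least {P} P? n pn = go n 0 (λ _ ()) (subst P (sym (+-identityʳ n)) pn)
  where
  go : ∀ f i → (∀ j → j < i → ¬ P j) → P (f + i) → ∃ λ m → P m × (∀ j → j < m → ¬ P j)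
  go zero i below p = i , p , below
  go (suc f) i below p with P? i
  ... | yes q = i , q , below
  ... | no ¬q = go f (suc i) below′ (subst P (sym (+-suc f i)) p)
    where
    below′ : ∀ j → j < suc i → ¬ P j
    below′ j j< with m<1+n⇒m<n∨m≡n j<
    ... | inj₁ lt = below j lt
    ... | inj₂ refl = ¬q

⨁-upTo-δ : ∀ k B → ⨁ (upTo B) (λ n → n ≡ᵇ k) ≡ (k <ᵇ B)
⨁-upTo-δ k B with k <?ℕ B
... | yes lt = trans (⨁-δ∈ _≟ℕ_ (upTo⁺ B) (∈-upTo⁺ lt)) (sym (T⇒≡true (<⇒<ᵇ lt)))
... | no ¬lt = trans (⨁-false (upTo B) (λ {n} n∈ → ≢⇒≡ᵇ {n} {k} (λ { refl → ¬lt (∈-upTo⁻ n∈) }))) (sym (≢true⇒≡false (λ t → ¬lt (<ᵇ⇒< k B (≡true⇒T t)))))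

module Shapes (r K : ℕ) where
  open Ambient r K

  Cyclic : Lengths → Set
  Cyclic ℓ = ∀ c n → S ℓ c n ≡ false

  -- Since `S` is indexed by length minus 1, the two terms stand for the lengths `k + 1` and `k`.
  -- For `k` equal to 0 the second never holds, which omits the hair of length 0 by itself.
  twoHairs : Fin M → ℕ → Fin M → ℕ → Bool
  twoHairs A k c n = does (c ≟ᶠ A) ∧ ((n ≡ᵇ k) xor (suc n ≡ᵇ k))

  Two : Lengths → Set
  Two ℓ = ∃ λ A → ∃ λ k → ∀ c n → S ℓ c n ≡ twoHairs A k c n

  S-witness : ∀ ℓ c n → S ℓ c n ≡ true → ∃ λ w → ℓ c w ≡ suc n
  S-witness ℓ c n h with ⨁-witness (allFin K) h
  ... | w , _ , eq = w , ≡ᵇ⇒≡ (ℓ c w) (suc n) (≡true⇒T eq)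

  maxLength : ∀ (ℓ : Lengths) → ∃ λ B → ∀ c w → ℓ c w ≤ B
  maxLength ℓ with bounded (λ c → proj₁ (bounded (ℓ c)))
  ... | B , h = B , λ c w → ≤-trans (proj₂ (bounded (ℓ c)) w) (h c)

  S-beyond : ∀ {ℓ : Lengths} {B} → (∀ c w → ℓ c w ≤ B) → ∀ c n → B ≤ n → S ℓ c n ≡ false
  S-beyond {ℓ} le c n B≤n = ⨁-false (allFin K) (λ {w} _ → ≢⇒≡ᵇ {ℓ c w} {suc n} (λ eq → <-irrefl refl (≤-trans (s≤s B≤n) (subst (_≤ _) eq (le c w)))))

  cyclic-or-hair : ∀ ℓ → Cyclic ℓ ⊎ ∃ λ n → ∃ λ c → S ℓ c n ≡ true
  cyclic-or-hair ℓ with maxLength ℓ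
  ... | B , le with anyUpTo? (λ n → anyFin? (λ c → S ℓ c n ≟ᵇ true)) B
  ...   | yes (n , _ , c , eq) = inj₂ (n , c , eq)
  ...   | no none = inj₁ cyclic
    where
    cyclic : Cyclic ℓ
    cyclic c n with n <?ℕ B
    ... | yes n<B = ≢true⇒≡false (λ t → none (n , n<B , c , t))
    ... | no ¬n<B = S-beyond {ℓ} le c n (≮⇒≥ ¬n<B)

  cyclic? : ∀ ℓ → Dec (Cyclic ℓ)
  cyclic? ℓ with cyclic-or-hair ℓ
  ... | inj₁ h = yes h
  ... | inj₂ (n , c , eq) = no (λ h → true≢false eq (h c n))

  twoHairs-A : ∀ A k n → twoHairs A k A n ≡ (n ≡ᵇ k) xor (suc n ≡ᵇ k)
  twoHairs-A A k n = cong (_∧ ((n ≡ᵇ k) xor (suc n ≡ᵇ k))) (dec-true (A ≟ᶠ A) refl)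

  twoHairs-other : ∀ {A c} k n → c ≢ A → twoHairs A k c n ≡ false
  twoHairs-other {A} {c} k n h = cong (_∧ ((n ≡ᵇ k) xor (suc n ≡ᵇ k))) (dec-false (c ≟ᶠ A) h)

  suc≢ᵇ : ∀ k → (suc k ≡ᵇ k) ≡ false
  suc≢ᵇ zero = refl
  suc≢ᵇ (suc k) = suc≢ᵇ k

  twoHairs-top : ∀ A k → twoHairs A k A k ≡ true
  twoHairs-top A k = trans (twoHairs-A A k k) (cong₂ _xor_ (≡ᵇ-refl k) (suc≢ᵇ k))

  twoHairs-snd : ∀ A k → twoHairs A (suc k) A k ≡ true
  twoHairs-snd A k = trans (twoHairs-A A (suc k) k) (cong₂ _xor_ (trans (≡ᵇ-comm k (suc k)) (suc≢ᵇ k)) (≡ᵇ-refl k))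

  -- `S` vanishes from the maximal length on while the pattern holds at `k`, so finitely many `k`
  -- have to be tried.
  two? : ∀ ℓ → Dec (Two ℓ)
  two? ℓ with maxLength ℓ
  ... | B , le with anyFin? (λ A → anyUpTo? (λ k → allUpTo? (λ n → allFin? (λ c → S ℓ c n ≟ᵇ twoHairs A k c n)) B) B)
  ...   | yes (A , k , k<B , h) = yes (A , k , two)
    where
    two : ∀ c n → S ℓ c n ≡ twoHairs A k c n
    two c n with n <?ℕ B
    ... | yes n<B = h n<B c
    ... | no ¬n<B = trans (S-beyond {ℓ} le c n (≮⇒≥ ¬n<B)) (sym (trans
            (cong (does (c ≟ᶠ A) ∧_) (cong₂ _xor_
              (≢⇒≡ᵇ {n} {k} (λ { refl → ¬n<B k<B }))
              (≢⇒≡ᵇ {suc n} {k} (λ { refl → ¬n<B (≤-trans (n≤1+n (suc n)) k<B) }))))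
            (∧-zeroʳ (does (c ≟ᶠ A)))))
  ...   | no none = no λ { (A , k , h) → none (A , k , k<B A k h , λ {n} _ c → h c n) }
    where
    k<B : ∀ A k → (∀ c n → S ℓ c n ≡ twoHairs A k c n) → k < B
    k<B A k h with k <?ℕ B
    ... | yes lt = lt
    ... | no ¬lt = ⊥-elim (true≢false (trans (h A k) (twoHairs-top A k)) (S-beyond {ℓ} le A k (≮⇒≥ ¬lt)))

  D-sum : ∀ {ℓ : Lengths} {B} → (∀ c w → ℓ c w ≤ B) → ∀ c → D ℓ c ≡ ⨁ (upTo B) (S ℓ c)
  D-sum {ℓ} {B} le c = trans
    (⨁-cong (allFin K) (λ {w} _ → count (ℓ c w) (le c w)))
    (⨁-comm (λ w n → ℓ c w ≡ᵇ suc n) (allFin K) (upTo B))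
    where
    count : ∀ x → x ≤ B → (0 <ᵇ x) ≡ ⨁ (upTo B) (λ n → x ≡ᵇ suc n)
    count zero _ = sym (⨁-false (upTo B) (λ _ → refl))
    count (suc x) lt = sym (trans (⨁-cong (upTo B) (λ {n} _ → ≡ᵇ-comm x n))
      (trans (⨁-upTo-δ x B) (T⇒≡true (<⇒<ᵇ lt))))

  no-hairs⇒even-degree : ∀ ℓ c → (∀ n → S ℓ c n ≡ false) → D ℓ c ≡ false
  no-hairs⇒even-degree ℓ c h = trans (D-sum {ℓ} (proj₂ (maxLength ℓ)) c) (⨁-false (upTo (proj₁ (maxLength ℓ))) (λ {n} _ → h n))

  two-degree-other : ∀ {ℓ A k} → (∀ c n → S ℓ c n ≡ twoHairs A k c n) → ∀ {c} → c ≢ A → D ℓ c ≡ false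
  two-degree-other {ℓ} {k = k} h {c} c≢A = no-hairs⇒even-degree ℓ c (λ n → trans (h c n) (twoHairs-other k n c≢A))

  two-degree : ∀ {ℓ A k} → (∀ c n → S ℓ c n ≡ twoHairs A k c n) → D ℓ A ≡ not (0 <ᵇ k)
  two-degree {ℓ} {A} {k} h = begin
    D ℓ A ≡⟨ D-sum {ℓ} le A ⟩
    ⨁ (upTo B) (S ℓ A) ≡⟨ ⨁-cong (upTo B) (λ {n} _ → trans (h A n) (twoHairs-A A k n)) ⟩
    ⨁ (upTo B) (λ n → (n ≡ᵇ k) xor (suc n ≡ᵇ k)) ≡⟨ ⨁-xor (upTo B) ⟩
    ⨁ (upTo B) (λ n → n ≡ᵇ k) xor ⨁ (upTo B) (λ n → suc n ≡ᵇ k)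
      ≡⟨ cong₂ _xor_ (trans (⨁-upTo-δ k B) (T⇒≡true (<⇒<ᵇ k<B))) (shifted k k<B) ⟩
    not (0 <ᵇ k) ∎
    where
    B = proj₁ (maxLength ℓ)
    le = proj₂ (maxLength ℓ)
    k<B : k < B
    k<B with S-witness ℓ A k (trans (h A k) (twoHairs-top A k))
    ... | w , eq = subst (_≤ B) eq (le A w)
    shifted : ∀ k → k < B → ⨁ (upTo B) (λ n → suc n ≡ᵇ k) ≡ (0 <ᵇ k)
    shifted zero _ = ⨁-false (upTo B) (λ _ → refl)
    shifted (suc k) lt = trans (⨁-upTo-δ k B) (T⇒≡true (<⇒<ᵇ (<⇒≤ lt)))

  S-upd : ∀ ℓ c w d e n → ℓ c w ≡ e → S (upd ℓ c w d) c n ≡ S ℓ c n xor ((e ≡ᵇ suc n) xor (d ≡ᵇ suc n))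
  S-upd ℓ c w d _ n refl = tally-upd (_≡ᵇ suc n) ℓ c w d

  S-upd-other : ∀ ℓ c w d n {c′} → c′ ≢ c → S (upd ℓ c w d) c′ n ≡ S ℓ c′ n
  S-upd-other ℓ c w d n = tally-upd-other (_≡ᵇ suc n) ℓ c w d

  -- The origin of `twoHairs`: deleting a leaf adds exactly this pattern to `S`. Hence the two-hair
  -- hairballs are those from which some leaf deletion makes `S` vanish.
  leaf-pattern : ∀ d n → (suc d ≡ᵇ suc n) xor (d ≡ᵇ suc n) ≡ (n ≡ᵇ d) xor (suc n ≡ᵇ d)
  leaf-pattern d n = cong₂ _xor_ (≡ᵇ-comm d n) (≡ᵇ-comm d (suc n))

  cyclic-leaf⇒two : ∀ {ℓ c w d} → Cyclic ℓ → ℓ c w ≡ suc d → Two (upd ℓ c w d)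
  cyclic-leaf⇒two {ℓ} {c} {w} {d} h eq = c , d , λ c′ n → two′ c′ n (c′ ≟ᶠ c)
    where
    two′ : ∀ c′ n → Dec (c′ ≡ c) → S (upd ℓ c w d) c′ n ≡ twoHairs c d c′ n
    two′ c′ n (no c′≢c) = trans (S-upd-other ℓ c w d n c′≢c) (trans (h c′ n) (sym (twoHairs-other d n c′≢c)))
    two′ c′ n (yes refl) = trans (S-upd ℓ c w d (suc d) n eq) (trans (cong (_xor ((suc d ≡ᵇ suc n) xor (d ≡ᵇ suc n))) (h c n))
      (trans (leaf-pattern d n) (sym (twoHairs-A c d n))))

  leaf-cyclic⇒two : ∀ {ℓ c w d} → Cyclic (upd ℓ c w d) → ℓ c w ≡ suc d → Two ℓ
  leaf-cyclic⇒two {ℓ} {c} {w} {d} h eq = c , d , λ c′ n → two′ c′ n (c′ ≟ᶠ c)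
    where
    xor-false : ∀ {x y} → x xor y ≡ false → x ≡ y
    xor-false {false} refl = refl
    xor-false {true} {true} _ = refl
    two′ : ∀ c′ n → Dec (c′ ≡ c) → S ℓ c′ n ≡ twoHairs c d c′ n
    two′ c′ n (no c′≢c) = trans (sym (S-upd-other ℓ c w d n c′≢c)) (trans (h c′ n) (sym (twoHairs-other d n c′≢c)))
    two′ c′ n (yes refl) = trans (xor-false (trans (sym (S-upd ℓ c w d (suc d) n eq)) (h c n)))
      (trans (leaf-pattern d n) (sym (twoHairs-A c d n)))

  two⇒leaf-cyclic : ∀ {ℓ A k} → (∀ c n → S ℓ c n ≡ twoHairs A k c n) → ∃ λ w → ℓ A w ≡ suc k × Cyclic (upd ℓ A w k)
  two⇒leaf-cyclic {ℓ} {A} {k} h with S-witness ℓ A k (trans (h A k) (twoHairs-top A k))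
  ... | w , eq = w , eq , λ c n → cyclic′ c n (c ≟ᶠ A)
    where
    cyclic′ : ∀ c n → Dec (c ≡ A) → S (upd ℓ A w k) c n ≡ false
    cyclic′ c n (no c≢A) = trans (S-upd-other ℓ A w k n c≢A) (trans (h c n) (twoHairs-other k n c≢A))
    cyclic′ c n (yes refl) = trans (S-upd ℓ A w k (suc k) n eq)
            (trans (cong₂ _xor_ (trans (h A n) (twoHairs-A A k n)) (leaf-pattern k n)) (xor-same ((n ≡ᵇ k) xor (suc n ≡ᵇ k))))

  -- The shorter hair is shortened; length `k + 2` still occurs an odd number of times.
  two⇒leaf-non-cyclic : ∀ {ℓ A k} → (∀ c n → S ℓ c n ≡ twoHairs A (suc k) c n) →
    ∃ λ w → ℓ A w ≡ suc k × ¬ Cyclic (upd ℓ A w k)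
  two⇒leaf-non-cyclic {ℓ} {A} {k} h with S-witness ℓ A k (trans (h A k) (twoHairs-snd A k))
  ... | w , eq = w , eq , λ cyclic → true≢false (trans (S-upd ℓ A w k (suc k) (suc k) eq)
          (cong₂ _xor_ (trans (h A (suc k)) (twoHairs-top A (suc k)))
             (cong₂ _xor_ (trans (≡ᵇ-comm k (suc k)) (suc≢ᵇ k)) (≢⇒≡ᵇ {k} {suc (suc k)} (λ ()))))) (cyclic A (suc k))

  -- Shorten a hair of minimal length among those occurring an odd number of times.
  leaf-not-two : ∀ {ℓ} → ¬ Cyclic ℓ → (∀ c → D ℓ c ≡ false) →
    ∃ λ c → ∃ λ w → ∃ λ d → ℓ c w ≡ suc d × ¬ Two (upd ℓ c w d)
  leaf-not-two {ℓ} ¬cyclic even with cyclic-or-hair ℓ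
  ... | inj₁ cyclic = ⊥-elim (¬cyclic cyclic)
  ... | inj₂ (n₀ , c₀ , eq₀) with least (λ n → anyFin? (λ c → S ℓ c n ≟ᵇ true)) n₀ (c₀ , eq₀)
  ... | d , (c , Scd) , minimal with S-witness ℓ c d Scd
  ... | w , eq = c , w , d , eq , λ { (A , k , h) → refute (d , refl) A k h }
    where
    ℓ′ : Lengths
    ℓ′ = upd ℓ c w d
    D′ : D ℓ′ c ≡ not (0 <ᵇ d)
    D′ = trans (tally-upd (0 <ᵇ_) ℓ c w d) (cong₂ _xor_ (even c) (cong (λ z → (0 <ᵇ z) xor (0 <ᵇ d)) eq))
    S′-top : S ℓ′ c d ≡ false
    S′-top = trans (S-upd ℓ c w d (suc d) d eq)
      (cong₂ _xor_ Scd (cong₂ _xor_ (≡ᵇ-refl d) (trans (≡ᵇ-comm d (suc d)) (suc≢ᵇ d))))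
    -- `d` is fixed by the enclosing clause, so the case distinction is made on a copy equal to it.
    refute : (∃ λ d′ → d′ ≡ d) → ∀ A k → ¬ (∀ c′ n → S ℓ′ c′ n ≡ twoHairs A k c′ n)
    -- A whole hair disappears and the degree of `c` becomes odd. The pattern permits this only for
    -- `A` equal to `c` and `k` equal to 0, but length 1 now occurs evenly often there.
    refute (zero , refl) A k h with A ≟ᶠ c
    ... | no A≢c = true≢false D′ (two-degree-other {ℓ′} h (λ c≡A → A≢c (sym c≡A)))
    refute (zero , refl) A zero h | yes refl = true≢false (trans (h A 0) (twoHairs-top A 0)) S′-top
    refute (zero , refl) A (suc k) h | yes refl = true≢false D′ (two-degree {ℓ′} h)
    -- By minimality length `d` now occurs an odd number of times at `c`, and length `d + 1` an even
    -- number, while the degree stays even.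
    refute (suc d′ , refl) A k h with A ≟ᶠ c
    ... | no A≢c = true≢false S′-snd (trans (h c d′) (twoHairs-other k d′ (λ c≡A → A≢c (sym c≡A))))
      where
      S′-snd : S ℓ′ c d′ ≡ true
      S′-snd = trans (S-upd ℓ c w d (suc d) d′ eq) (cong₂ _xor_ (≢true⇒≡false (λ t → minimal d′ (n<1+n d′) (c , t)))
        (cong₂ _xor_ (suc≢ᵇ d′) (≡ᵇ-refl d′)))
    refute (suc d′ , refl) A zero h | yes refl = true≢false (two-degree {ℓ′} h) D′
    refute (suc d′ , refl) A (suc k) h | yes refl with d ≟ℕ suc k
    ... | yes refl = true≢false (trans (h A d) (twoHairs-top A d)) S′-top
    ... | no d≢ with d ≟ℕ k
    ...   | yes refl = true≢false (trans (h A d) (twoHairs-snd A d)) S′-top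
    ...   | no d≢k with d′ ≟ℕ suc k
    -- Here the new length `d` is the longer one of the pattern. The shorter one, `d - 1`, would
    -- have occurred an odd number of times before the move, against minimality.
    ...     | yes refl = minimal k (n≤1+n (suc k)) (A , trans (sym old) (trans (h A k) (twoHairs-snd A k)))
      where
      old : S ℓ′ A k ≡ S ℓ A k
      old = trans (S-upd ℓ A w d (suc d) k eq) (trans (cong (S ℓ A k xor_)
        (cong₂ _xor_ (≢⇒≡ᵇ {suc (suc k)} {k} (λ ())) (suc≢ᵇ k))) (xor-identityʳ _))
    ...     | no d′≢ = true≢false S′-snd (trans (h A d′) (trans (twoHairs-A A (suc k) d′)
                (cong₂ _xor_ (≢⇒≡ᵇ {d′} {suc k} d′≢) (≢⇒≡ᵇ {d′} {k} (λ { refl → d≢ refl })))))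
      where
      S′-snd : S ℓ′ c d′ ≡ true
      S′-snd = trans (S-upd ℓ c w d (suc d) d′ eq) (cong₂ _xor_ (≢true⇒≡false (λ t → minimal d′ (n<1+n d′) (c , t)))
        (cong₂ _xor_ (suc≢ᵇ d′) (≡ᵇ-refl d′)))

  module _ (M-odd : odd M ≡ true) where

    -- If all hairs had length at most 1, the odd number of them at each of the `M` vertices would
    -- make the total number of vertices even. After the cut `cpred c` still has odd degree, so `S`
    -- does not vanish.
    cut-long-hair : ∀ {ℓ} → N ℓ ≡ true → (∀ c → D ℓ c ≡ true) →
      ∃ λ c → ∃ λ w → ∃ λ d → ℓ c w ≡ suc (suc d) × ¬ Cyclic (upd ℓ c w d)
    cut-long-hair {ℓ} Nodd allodd with anyFin? (λ c → anyFin? (λ w → 1 <?ℕ ℓ c w))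
    ... | yes (c , w , long) with ℓ c w in eq
    ...   | suc (suc d) = c , w , d , eq , λ cyclic →
              true≢false (trans (tally-upd-other (0 <ᵇ_) ℓ c w d (cpred≢id c)) (allodd (cpred c)))
                (no-hairs⇒even-degree (upd ℓ c w d) (cpred c) (cyclic (cpred c)))
    ...   | suc zero = ⊥-elim (<-irrefl refl long)
    cut-long-hair {ℓ} Nodd allodd | no short = ⊥-elim (true≢false Nodd (cong not (begin
      ⨁ (allFin M) (tally odd ℓ) ≡⟨ ⨁-cong (allFin M) (λ {c} _ → trans (⨁-cong (allFin K) (λ {w} _ → small (ℓ c w) (λ lt → short (c , w , lt)))) (allodd c)) ⟩
      ⨁ (allFin M) (λ _ → true) ≡⟨ ⨁-true (allFin M) ⟩
      odd (length (allFin M)) ≡⟨ cong odd (length-tabulate {n = M} (λ z → z)) ⟩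
      odd M ≡⟨ M-odd ⟩
      true ∎)))
      where
      small : ∀ x → ¬ (1 < x) → odd x ≡ (0 <ᵇ x)
      small zero _ = refl
      small (suc zero) _ = refl
      small (suc (suc x)) h = ⊥-elim (h (s≤s (s≤s z≤n)))

-- Nim-values

odd-+ : ∀ i j → odd (i + j) ≡ odd i xor odd j
odd-+ zero j = refl
odd-+ (suc i) j = trans (cong not (odd-+ i j)) (not-distribˡ-xor (odd i) (odd j))

odd-length-++ : ∀ {A : Set} (xs ys : List A) → odd (length (xs ++ ys)) ≡ odd (length xs) xor odd (length ys)
odd-length-++ xs ys = trans (cong odd (length-++ xs)) (odd-+ (length xs) (length ys))

xor-swap : ∀ {x y z} → x ≡ y xor z → z ≡ x xor y
xor-swap {y = false} {z} refl = sym (xor-identityʳ z)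
xor-swap {y = true} {false} refl = refl
xor-swap {y = true} {true} refl = refl

split-by : ∀ {A : Set} {P : A → Set} → (∀ x → Dec (P x)) → (xs : List A) →
  ∃ λ ps → ∃ λ qs → xs ↭ ps ++ qs × (∀ {x} → x ∈ ps → P x) × (∀ {x} → x ∈ qs → ¬ P x)
split-by P? [] = [] , [] , ↭-refl , (λ ()) , (λ ())
split-by P? (x ∷ xs) with split-by P? xs | P? x
... | ps , qs , π , p , q | yes px = x ∷ ps , qs , ↭-prep x π , (λ { (here refl) → px ; (there m) → p m }) , q
... | ps , qs , π , p , q | no ¬px = ps , x ∷ qs , ↭-trans (↭-prep x π) (↭-sym (shift x ps qs)) , p , (λ { (here refl) → ¬px ; (there m) → q m })

Unique-++ˡ : ∀ {A : Set} (xs : List A) {ys} → Unique (xs ++ ys) → Unique xs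
Unique-++ˡ [] u = []
Unique-++ˡ (x ∷ xs) (x∉ ∷ u) = All.tabulate (λ m → All.lookup x∉ (∈-++⁺ˡ m)) ∷ Unique-++ˡ xs u

Unique-++-disjoint : ∀ {A : Set} (xs : List A) {ys v} → Unique (xs ++ ys) → v ∈ xs → v ∉ ys
Unique-++-disjoint (x ∷ xs) (x∉ ∷ u) (here refl) m = All.lookup x∉ (∈-++⁺ʳ xs m) refl
Unique-++-disjoint (x ∷ xs) (x∉ ∷ u) (there p) m = Unique-++-disjoint xs u p m

Unique-++ʳ : ∀ {A : Set} (xs : List A) {ys} → Unique (xs ++ ys) → Unique ys
Unique-++ʳ [] u = u
Unique-++ʳ (x ∷ xs) (_ ∷ u) = Unique-++ʳ xs u

Unique-tail : ∀ {A : Set} {x : A} {xs} → Unique (x ∷ xs) → Unique xs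
Unique-tail (_ ∷ u) = u

module Game (r K : ℕ) (M-odd : odd (3 + r) ≡ true) where
  open Ambient r K
  open Shapes r K
  open import Data.List.Membership.DecPropositional _≟V_ using (_∈?_)

  Bipartite : Adj → (V → Bool) → List V → Set
  Bipartite a col xs = ∀ {u v} → u ∈ xs → v ∈ xs → a u v ≡ true → col u xor col v ≡ true

  NoCross : Adj → List V → List V → Set
  NoCross a xs ys = ∀ {u v} → u ∈ xs → v ∈ ys → a u v ≡ false

  record Base (xs : List V) (a : Adj) (cs bs : List V) : Set where
    field
      perm : xs ↭ cs ++ bs
      uniq : Unique (cs ++ bs)
      a-sym : ∀ u v → a u v ≡ a v u
      a-irr : ∀ u → a u u ≡ false
      cross : NoCross a cs bs
      col : V → Bool
      bip : Bipartite a col bs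
  open Base

  mixColour : List V → (V → Bool) → (V → Bool) → V → Bool
  mixColour ps f g v = if does (v ∈? ps) then f v else g v

  mix-bipartite : ∀ {a f g ps qs} → (∀ u v → a u v ≡ a v u) → (∀ {v} → v ∈ ps → v ∉ qs) → NoCross a ps qs →
    Bipartite a f ps → Bipartite a g qs → Bipartite a (mixColour ps f g) (ps ++ qs)
  mix-bipartite {a} {f} {g} {ps} {qs} a-sym disj nc bf bg {u} {v} u∈ v∈ auv with ∈-++⁻ ps u∈ | ∈-++⁻ ps v∈
  ... | inj₁ p | inj₁ q rewrite dec-true (u ∈? ps) p | dec-true (v ∈? ps) q = bf p q auv
  ... | inj₁ p | inj₂ q = ⊥-elim (true≢false auv (nc p q))
  ... | inj₂ p | inj₁ q = ⊥-elim (true≢false (trans (a-sym v u) auv) (nc q p))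
  ... | inj₂ p | inj₂ q rewrite dec-false (u ∈? ps) (λ m → disj m p) | dec-false (v ∈? ps) (λ m → disj m q) = bg p q auv

  base-vertex-core : ∀ {xs a cs bs v cs₁ ys} → Base xs a cs bs → cs ↭ v ∷ cs₁ → xs ↭ v ∷ ys → Base ys a cs₁ bs
  base-vertex-core {bs = bs} B p q = record
    { perm = drop-∷ (↭-trans (↭-sym q) (↭-trans (perm B) (++⁺ʳ bs p)))
    ; uniq = Unique-tail (Unique-resp-↭ (++⁺ʳ bs p) (uniq B))
    ; a-sym = a-sym B ; a-irr = a-irr B
    ; cross = λ u∈ v∈ → cross B (∈-resp-↭ (↭-sym p) (there u∈)) v∈
    ; col = col B ; bip = bip B }

  base-vertex-rest : ∀ {xs a cs bs v bs₁ ys} → Base xs a cs bs → bs ↭ v ∷ bs₁ → xs ↭ v ∷ ys → Base ys a cs bs₁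
  base-vertex-rest {cs = cs} {bs₁ = bs₁} B p q = record
    { perm = drop-∷ (↭-trans (↭-sym q) (↭-trans (perm B) π))
    ; uniq = Unique-tail (Unique-resp-↭ π (uniq B))
    ; a-sym = a-sym B ; a-irr = a-irr B
    ; cross = λ u∈ v∈ → cross B u∈ (∈-resp-↭ (↭-sym p) (there v∈))
    ; col = col B ; bip = λ u∈ v∈ → bip B (∈-resp-↭ (↭-sym p) (there u∈)) (∈-resp-↭ (↭-sym p) (there v∈)) }
    where
    π = ↭-trans (++⁺ˡ cs p) (shift _ cs bs₁)

  remV : Adj → V → V → Adj
  remV a u v p q = if (does (p ≟V u) ∧ does (q ≟V v)) ∨ (does (p ≟V v) ∧ does (q ≟V u)) then false else a p q

  remV-IsRem : ∀ a u v → IsRem a u v (remV a u v)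
  remV-IsRem a u v = record { rem-uv = at₁ ; rem-vu = at₂ ; rem-other = other }
    where
    at₁ : remV a u v u v ≡ false
    at₁ rewrite dec-true (u ≟V u) refl | dec-true (v ≟V v) refl = refl
    at₂ : remV a u v v u ≡ false
    at₂ rewrite dec-true (u ≟V u) refl | dec-true (v ≟V v) refl with does (v ≟V u) ∧ does (u ≟V v)
    ... | true = refl
    ... | false = refl
    other : ∀ p q → ¬ (p ≡ u × q ≡ v) → ¬ (p ≡ v × q ≡ u) → remV a u v p q ≡ a p q
    other p q n₁ n₂ with p ≟V u | q ≟V v | p ≟V v | q ≟V u
    ... | yes x | yes y | _ | _ = ⊥-elim (n₁ (x , y))
    ... | yes x | no y | yes z | yes w = ⊥-elim (n₂ (z , w))
    ... | no x | _ | yes z | yes w = ⊥-elim (n₂ (z , w))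
    ... | yes x | no y | no z | _ = refl
    ... | yes x | no y | yes z | no w = refl
    ... | no x | _ | no z | _ = refl
    ... | no x | _ | yes z | no w = refl

  remV-≤ : ∀ a u v p q → remV a u v p q ≡ true → a p q ≡ true
  remV-≤ a u v p q h with (does (p ≟V u) ∧ does (q ≟V v)) ∨ (does (p ≟V v) ∧ does (q ≟V u))
  ... | false = h

  remV-false : ∀ a u v p q → a p q ≡ false → remV a u v p q ≡ false
  remV-false a u v p q h = ≢true⇒≡false (λ t → true≢false (remV-≤ a u v p q t) h)

  remV-sym : ∀ {a u v} → (∀ p q → a p q ≡ a q p) → ∀ p q → remV a u v p q ≡ remV a u v q p
  remV-sym {a} {u} {v} s p q rewrite ∧-comm (does (p ≟V u)) (does (q ≟V v)) | ∧-comm (does (p ≟V v)) (does (q ≟V u))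
    | ∨-comm (does (q ≟V v) ∧ does (p ≟V u)) (does (q ≟V u) ∧ does (p ≟V v)) | s p q = refl

  base-edge : ∀ {xs a cs bs} u v → Base xs a cs bs → Base xs (remV a u v) cs bs
  base-edge {a = a} u v B = record
    { perm = perm B ; uniq = uniq B
    ; a-sym = remV-sym (a-sym B) ; a-irr = λ p → remV-false a u v p p (a-irr B p)
    ; cross = λ {p} {q} p∈ q∈ → remV-false a u v p q (cross B p∈ q∈)
    ; col = col B ; bip = λ {p} {q} p∈ q∈ t → bip B p∈ q∈ (remV-≤ a u v p q t) }

  base-merge : ∀ {xs a cs bs f} → Base xs a cs bs → Bipartite a f cs → Base xs a [] (cs ++ bs)
  base-merge {cs = cs} {f = f} B bf = record
    { perm = perm B ; uniq = uniq B ; a-sym = a-sym B ; a-irr = a-irr B ; cross = λ ()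
    ; col = mixColour cs f (col B)
    ; bip = mix-bipartite {f = f} {g = col B} (a-sym B) (Unique-++-disjoint cs (uniq B)) (cross B) bf (bip B) }

  base-cut : ∀ {xs a cs bs f cs′ tl} → Base xs a cs bs → cs ↭ cs′ ++ tl → NoCross a cs′ tl → Bipartite a f tl →
    Base xs a cs′ (tl ++ bs)
  base-cut {cs = cs} {bs} {f} {cs′} {tl} B p nc bf = record
    { perm = ↭-trans (perm B) π ; uniq = u′
    ; a-sym = a-sym B ; a-irr = a-irr B
    ; cross = λ u∈ v∈ → [ nc u∈ , cross B (∈-resp-↭ (↭-sym p) (∈-++⁺ˡ u∈)) ]′ (∈-++⁻ tl v∈)
    ; col = mixColour tl f (col B)
    ; bip = mix-bipartite {f = f} {g = col B} (a-sym B) (Unique-++-disjoint tl (Unique-++ʳ cs′ u′))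
        (λ u∈ v∈ → cross B (∈-resp-↭ (↭-sym p) (∈-++⁺ʳ cs′ u∈)) v∈) bf (bip B) }
    where
    π : cs ++ bs ↭ cs′ ++ (tl ++ bs)
    π = ↭-trans (++⁺ʳ bs p) (↭-reflexive (++-assoc cs′ tl bs))
    u′ : Unique (cs′ ++ (tl ++ bs))
    u′ = Unique-resp-↭ π (uniq B)

  n0 n3 n4 : Nim
  n0 = nim false false false
  n3 = nim false true true
  n4 = nim true false false

  -- The values to be proved, with `N ℓ` true for an odd number of vertices. `Cyclic` says that
  -- equal hairs cancel in pairs; the value is then that of the bare odd cycle.
  data Φ (ℓ : Lengths) : Nim → Set where
    cyclicΦ : N ℓ ≡ true → Cyclic ℓ → Φ ℓ n0
    oddΦ : N ℓ ≡ true → ¬ Cyclic ℓ → Φ ℓ n3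
    twoΦ : N ℓ ≡ false → Two ℓ → Φ ℓ n4
    evenΦ : N ℓ ≡ false → ¬ Two ℓ → Φ ℓ n0

  Φ-total : ∀ ℓ → ∃ (Φ ℓ)
  Φ-total ℓ with N ℓ in eq
  ... | true with cyclic? ℓ
  ...   | yes p = n0 , cyclicΦ eq p
  ...   | no p = n3 , oddΦ eq p
  Φ-total ℓ | false with two? ℓ
  ...   | yes p = n4 , twoΦ eq p
  ...   | no p = n0 , evenΦ eq p

  -- `none` is the state after the cycle has been broken. Agreement with `adjV` is required on the
  -- core only, because deleted edges elsewhere alter `a`.
  data Core (a : Adj) : List V → Nim → Set where
    none : Core a [] n0
    hairball : ∀ {ℓ cs φ} → IsCore ℓ cs → (∀ {u v} → u ∈ cs → v ∈ cs → a u v ≡ adjV u v) → Φ ℓ φ → Core a cs φ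

  -- The nim-value if `bs` is bipartite. For other lists it merely records the two parities, which
  -- remain additive; `cut-hair` relies on this.
  restValue : Adj → List V → Nim
  restValue a bs = nim false (E a bs) (odd (length bs))

  record Pos (xs : List V) (a : Adj) (z : Nim) : Set where
    constructor mkPos
    field
      {cs bs} : List V
      {φ} : Nim
      base : Base xs a cs bs
      core : Core a cs φ
      value : z ≡ φ ⊕ restValue a bs

  restValue-++ : ∀ {a ps bs} → NoCross a ps bs →
    restValue a (ps ++ bs) ≡ restValue a ps ⊕ restValue a bs
  restValue-++ {a} {ps} {bs} nc = cong₂ (nim false) (E-++ ps bs nc) (odd-length-++ ps bs)

  -- Serves both ways of breaking the cycle: either `cyc i` has gone or the arc leaving it has. The
  -- remains of the core are bipartite and join the rest.
  destroy : ∀ {xs a cs bs i} → Base xs a cs bs → (∀ {u v} → u ∈ cs → v ∈ cs → a u v ≡ true → adjV u v ≡ true) →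
    (cyc i ∈ cs → a (cyc i) (target (cyc i)) ≡ false) → Pos xs a (restValue a cs ⊕ restValue a bs)
  destroy {a = a} {cs} {bs} {i} B le cut = mkPos B′ none (sym (restValue-++ (cross B)))
    where
    bf : Bipartite a (cutCol M-odd i) cs
    bf {u} {v} u∈ v∈ auv with adjV⇒ u v (le u∈ v∈ auv)
    ... | inj₁ refl = cutCol-target M-odd i u (λ { refl → true≢false auv (cut u∈) })
    ... | inj₂ refl = trans (xor-comm (cutCol M-odd i u) (cutCol M-odd i v))
            (cutCol-target M-odd i v (λ { refl → true≢false auv (trans (a-sym B _ _) (cut v∈)) }))
    B′ = base-merge {f = cutCol M-odd i} B bf

  depthColour : V → Bool
  depthColour (cyc _) = false
  depthColour (hair _ _ d) = odd d

  tail-bipartite : ∀ {ℓ c w d u v} → InTail ℓ c w d u → InTail ℓ c w d v → adjV u v ≡ true → depthColour u xor depthColour v ≡ true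
  tail-bipartite {u = u} {v} (d₁ , refl , _) (d₂ , refl , _) auv with adjV⇒ u v auv
  tail-bipartite (suc d₁ , refl , _) (d₂ , refl , _) auv | inj₁ refl with odd d₁
  ... | false = refl
  ... | true = refl
  tail-bipartite (d₁ , refl , _) (suc d₂ , refl , _) auv | inj₂ refl with odd d₂
  ... | false = refl
  ... | true = refl

  -- One edge alone links the shortened core to the tail, so deleting that edge or its outer end
  -- separates them.
  tail-cross : ∀ {ℓ c w d u v} → InCore (upd ℓ c w d) u → InTail ℓ c w d v → adjV u v ≡ true →
    v ≡ hair c w d × u ≡ target v
  tail-cross {ℓ} {c} {w} {d} {u} {v} u∈ (d′ , refl , d≤d′ , _) auv with adjV⇒ u v auv
  tail-cross {ℓ} {c} {w} {d} {hair .c .w (suc .d′)} u∈ (d′ , refl , d≤d′ , _) auv | inj₁ refl =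
    ⊥-elim (<-irrefl refl (≤-trans (subst (suc d′ <_) (upd-at ℓ c w d) u∈) (≤-trans d≤d′ (n≤1+n d′))))
  tail-cross {ℓ} {c} {w} {d} u∈ (zero , refl , z≤n , _) auv | inj₂ refl = refl , refl
  tail-cross {ℓ} {c} {w} {d} u∈ (suc d′ , refl , d≤d′ , _) auv | inj₂ refl =
    cong (hair c w) (≤-antisym (subst (d′ <_) (upd-at ℓ c w d) u∈) d≤d′) , refl

  module _ {ℓ : Lengths} {c : Fin M} {w : Fin K} {d : ℕ} where

    ℓ↓ : Lengths
    ℓ↓ = upd ℓ c w d

    -- Covers the deletion of `hair c w d` and that of the edge below it. The parities of the
    -- severed tail come by subtraction: the remaining core accounts for `N ℓ↓` in both, so the
    -- length of the tail never has to be computed.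
    cut-hair : ∀ {xs a cs bs φ} → Base xs a cs bs → (∀ {u v} → u ∈ cs → v ∈ cs → a u v ≡ true → adjV u v ≡ true) →
      (∀ {u v} → u ∈ cs → v ∈ cs → InCore ℓ↓ u → InCore ℓ↓ v → a u v ≡ adjV u v) →
      (∀ {v} → v ∈ cs → InCore ℓ v) → (∀ {v} → InCore ℓ↓ v → v ∈ cs) →
      (hair c w d ∈ cs → a (target (hair c w d)) (hair c w d) ≡ false) → Φ ℓ↓ φ →
      Pos xs a ((φ ⊕ (nim false (N ℓ↓) (N ℓ↓) ⊕ restValue a cs)) ⊕ restValue a bs)
    cut-hair {xs} {a} {cs} {bs} {φ} B le same sound′ complete′ cut Φφ with split-by (inCore? ℓ↓) cs
    ... | cs′ , tl , π , p , q = mkPos B′ (hairball core′ (λ u∈ v∈ → same (cs′⊆ u∈) (cs′⊆ v∈) (p u∈) (p v∈)) Φφ) (begin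
        (φ ⊕ (nim false (N ℓ↓) (N ℓ↓) ⊕ restValue a cs)) ⊕ restValue a bs
          ≡⟨ cong (λ z → (φ ⊕ z) ⊕ restValue a bs) (sym tl-value) ⟩
        (φ ⊕ restValue a tl) ⊕ restValue a bs ≡⟨ ⊕-assoc φ _ _ ⟩
        φ ⊕ (restValue a tl ⊕ restValue a bs) ≡⟨ cong (φ ⊕_) (sym (restValue-++ (λ u∈ v∈ → cross B (tl⊆ u∈) v∈))) ⟩
        φ ⊕ restValue a (tl ++ bs) ∎)
      where
      cs′⊆ : ∀ {v} → v ∈ cs′ → v ∈ cs
      cs′⊆ m = ∈-resp-↭ (↭-sym π) (∈-++⁺ˡ m)
      tl⊆ : ∀ {v} → v ∈ tl → v ∈ cs
      tl⊆ m = ∈-resp-↭ (↭-sym π) (∈-++⁺ʳ cs′ m)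
      inTail : ∀ {v} → v ∈ tl → InTail ℓ c w d v
      inTail m = [ (λ x → ⊥-elim (q m x)) , (λ x → x) ]′ (core-split ℓ c w d (sound′ (tl⊆ m)))
      nc : NoCross a cs′ tl
      nc {u} {v} u∈ v∈ = ≢true⇒≡false no-edge
        where
        no-edge : a u v ≢ true
        no-edge t with tail-cross {ℓ} (p u∈) (inTail v∈) (le (cs′⊆ u∈) (tl⊆ v∈) t)
        ... | refl , refl = true≢false t (cut (tl⊆ v∈))
      B′ : Base xs a cs′ (tl ++ bs)
      B′ = base-cut {f = depthColour} B π nc (λ {u} {v} u∈ v∈ t → tail-bipartite {ℓ} (inTail u∈) (inTail v∈) (le (tl⊆ u∈) (tl⊆ v∈) t))
      core′ : IsCore ℓ↓ cs′
      core′ = record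
        { unique = Unique-++ˡ cs′ (uniq B′)
        ; sound = p
        ; complete = λ {v} m → [ (λ x → x) , (λ x → ⊥-elim (q x m)) ]′ (∈-++⁻ cs′ (∈-resp-↭ π (complete′ m))) }
      tl-value : restValue a tl ≡ nim false (N ℓ↓) (N ℓ↓) ⊕ restValue a cs
      tl-value = cong₂ (nim false)
        (trans (xor-swap (trans (E-↭ (a-sym B) π) (trans (E-++ cs′ tl nc) (cong (_xor E a tl) E-cs′)))) (xor-comm (E a cs) (N ℓ↓)))
        (trans (xor-swap (trans (cong odd (↭-length π)) (trans (odd-length-++ cs′ tl) (cong (_xor odd (length tl)) (length-core M-odd core′))))) (xor-comm (odd (length cs)) (N ℓ↓)))
        where
        E-cs′ : E a cs′ ≡ N ℓ↓
        E-cs′ = trans (E-cong cs′ (λ u∈ v∈ → same (cs′⊆ u∈) (cs′⊆ v∈) (p u∈) (p v∈))) (E-core M-odd core′)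

  vertex-removed-value : ∀ {ℓ a cs cs₁ v} → IsCore ℓ cs → (∀ {u v} → u ∈ cs → v ∈ cs → a u v ≡ adjV u v) → cs ↭ v ∷ cs₁ →
    restValue a cs₁ ≡ nim false (N ℓ xor ⨁ cs (adjV v)) (not (N ℓ))
  vertex-removed-value {ℓ} {a} {cs} {cs₁} {v} C same π = cong₂ (nim false)
    (begin
      E a cs₁ ≡⟨ E-cong cs₁ (λ u∈ v∈ → same (∈-resp-↭ (↭-sym π) (there u∈)) (∈-resp-↭ (↭-sym π) (there v∈))) ⟩
      E adjV cs₁ ≡⟨ xor-swap (trans (sym (E-core M-odd C)) (E-↭ adjV-sym π)) ⟩
      N ℓ xor ⨁ cs₁ (adjV v) ≡⟨ cong (N ℓ xor_) (sym (⨁-degree-remove adjV-sym adjV-irrefl π)) ⟩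
      N ℓ xor ⨁ cs (adjV v) ∎)
    (trans (sym (not-involutive _)) (cong not (trans (sym (cong odd (↭-length π))) (length-core M-odd C))))

  edge-removed-value : ∀ {ℓ xs a cs bs u v} → Base xs a cs bs → IsCore ℓ cs → (∀ {u v} → u ∈ cs → v ∈ cs → a u v ≡ adjV u v) →
    u ∈ cs → v ∈ cs → a u v ≡ true → restValue (remV a u v) cs ≡ nim false (not (N ℓ)) (N ℓ)
  edge-removed-value {a = a} {cs} {u = u} {v} B C same u∈ v∈ auv = cong₂ (nim false)
    (trans (E-rem (a-sym B) (remV-sym (a-sym B)) (a-irr B) (unique C) u∈ v∈ auv (remV-IsRem a u v))
      (cong not (trans (E-cong cs same) (E-core M-odd C))))
    (length-core M-odd C)

  edge-removed-rest : ∀ {xs a cs bs u v} → Base xs a cs bs → u ∈ cs → v ∈ cs → restValue (remV a u v) bs ≡ restValue a bs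
  edge-removed-rest {a = a} {cs} {bs} {u} {v} B u∈ v∈ = cong (λ z → nim false z (odd (length bs)))
    (E-cong bs (λ {p} {q} p∈ q∈ → rem-other (remV-IsRem a u v) p q
      (λ { (refl , _) → Unique-++-disjoint cs (uniq B) u∈ p∈ }) (λ { (refl , _) → Unique-++-disjoint cs (uniq B) v∈ p∈ })))

  module _ {ℓ : Lengths} {xs : List V} {a : Adj} {cs bs : List V} (B : Base xs a cs bs) (C : IsCore ℓ cs)
    (same : ∀ {u v} → u ∈ cs → v ∈ cs → a u v ≡ adjV u v) where

    delete-cyc : ∀ {i ys} → xs ↭ cyc i ∷ ys → Pos ys a (nim false (N ℓ xor D ℓ i) (not (N ℓ)) ⊕ restValue a bs)
    delete-cyc {i} {ys} p with ∈⇒↭∷ (complete C {cyc i} tt)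
    ... | cs₁ , π = subst (λ z → Pos ys a (z ⊕ restValue a bs))
      (trans (vertex-removed-value C same π) (cong (λ z → nim false (N ℓ xor z) (not (N ℓ))) (degree-cyc i C)))
      (destroy {i = i} (base-vertex-core B π p)
        (λ u∈ v∈ t → trans (sym (same (old u∈) (old v∈))) t)
        (λ m → ⊥-elim (Unique[x∷xs]⇒x∉xs (Unique-resp-↭ π (unique C)) m)))
      where
      old : ∀ {u} → u ∈ cs₁ → u ∈ cs
      old m = ∈-resp-↭ (↭-sym π) (there m)

    delete-hair : ∀ {c w d ys φ} → d < ℓ c w → Φ (upd ℓ c w d) φ → xs ↭ hair c w d ∷ ys →
      Pos ys a ((φ ⊕ (nim false (N (upd ℓ c w d)) (N (upd ℓ c w d)) ⊕ nim false (N ℓ xor not (does (suc d <?ℕ ℓ c w))) (not (N ℓ)))) ⊕ restValue a bs)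
    delete-hair {c} {w} {d} {ys} {φ} lt Φφ p with ∈⇒↭∷ (complete C {hair c w d} lt)
    ... | cs₁ , π = subst (λ z → Pos ys a ((φ ⊕ (nim false (N (upd ℓ c w d)) (N (upd ℓ c w d)) ⊕ z)) ⊕ restValue a bs))
      (trans (vertex-removed-value C same π) (cong (λ z → nim false (N ℓ xor z) (not (N ℓ))) (degree-hair C lt)))
      (cut-hair {ℓ} (base-vertex-core B π p)
        (λ u∈ v∈ t → trans (sym (same (old u∈) (old v∈))) t)
        (λ u∈ v∈ _ _ → same (old u∈) (old v∈))
        (λ m → sound C (old m))
        (λ {v} m → keep v m (∈-resp-↭ π (complete C (core-upd {ℓ} (<⇒≤ lt) m))))
        (λ m → ⊥-elim (Unique[x∷xs]⇒x∉xs (Unique-resp-↭ π (unique C)) m)) Φφ)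
      where
      old : ∀ {u} → u ∈ cs₁ → u ∈ cs
      old m = ∈-resp-↭ (↭-sym π) (there m)
      keep : ∀ v → InCore (upd ℓ c w d) v → v ∈ hair c w d ∷ cs₁ → v ∈ cs₁
      keep v m (there x) = x
      keep v m (here refl) = ⊥-elim (<-irrefl (sym (upd-at ℓ c w d)) m)

    delete-cyc-edge : ∀ i → Pos xs (remV a (cyc i) (target (cyc i))) (nim false (not (N ℓ)) (N ℓ) ⊕ restValue a bs)
    delete-cyc-edge i = subst (Pos xs a′) (cong₂ _⊕_
        (edge-removed-value B C same u∈ v∈ (trans (same u∈ v∈) (adjV-target (cyc i))))
        (edge-removed-rest B u∈ v∈))
      (destroy {i = i} (base-edge (cyc i) (target (cyc i)) B)
        (λ {p} {q} p∈ q∈ t → trans (sym (same p∈ q∈)) (remV-≤ a _ _ p q t))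
        (λ _ → rem-uv (remV-IsRem a (cyc i) (target (cyc i)))))
      where
      a′ = remV a (cyc i) (target (cyc i))
      u∈ : cyc i ∈ cs
      u∈ = complete C tt
      v∈ : target (cyc i) ∈ cs
      v∈ = complete C tt

    delete-hair-edge : ∀ {c w d φ} → d < ℓ c w → Φ (upd ℓ c w d) φ →
      Pos xs (remV a (hair c w d) (target (hair c w d)))
        ((φ ⊕ (nim false (N (upd ℓ c w d)) (N (upd ℓ c w d)) ⊕ nim false (not (N ℓ)) (N ℓ))) ⊕ restValue a bs)
    delete-hair-edge {c} {w} {d} {φ} lt Φφ = subst (Pos xs a′) (cong₂ (λ y z → (φ ⊕ (nim false (N (upd ℓ c w d)) (N (upd ℓ c w d)) ⊕ y)) ⊕ z)
        (edge-removed-value B C same u∈ v∈ (trans (same u∈ v∈) (adjV-target u)))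
        (edge-removed-rest B u∈ v∈))
      (cut-hair {ℓ} (base-edge u (target u) B)
        (λ {p} {q} p∈ q∈ t → trans (sym (same p∈ q∈)) (remV-≤ a _ _ p q t))
        (λ {p} {q} p∈ q∈ pc qc → trans (rem-other (remV-IsRem a u (target u)) p q
            (λ { (refl , _) → u∉ pc }) (λ { (_ , refl) → u∉ qc })) (same p∈ q∈))
        (sound C)
        (λ {v} m → complete C (core-upd {ℓ} (<⇒≤ lt) m))
        (λ _ → rem-vu (remV-IsRem a u (target u))) Φφ)
      where
      u : V
      u = hair c w d
      a′ = remV a u (target u)
      u∈ : u ∈ cs
      u∈ = complete C lt
      v∈ : target u ∈ cs
      v∈ = complete C (InCore-target u lt)
      u∉ : ¬ InCore (upd ℓ c w d) u
      u∉ m = <-irrefl (sym (upd-at ℓ c w d)) m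

  -- Only for `Cyclic` does the degree matter: it is even, and the option is worth 2. Otherwise the
  -- lowest or the highest bit already differs.
  cyc-option≢ : ∀ {ℓ φ} i → Φ ℓ φ → nim false (N ℓ xor D ℓ i) (not (N ℓ)) ≢ φ
  cyc-option≢ {ℓ} i (cyclicΦ eq h) rewrite eq | no-hairs⇒even-degree ℓ i (h i) = λ ()
  cyc-option≢ i (oddΦ eq _) rewrite eq = λ ()
  cyc-option≢ i (twoΦ eq _) rewrite eq = λ ()
  cyc-option≢ i (evenΦ eq _) rewrite eq = λ ()

  cyc-edge-option≢ : ∀ {ℓ φ} → Φ ℓ φ → nim false (not (N ℓ)) (N ℓ) ≢ φ
  cyc-edge-option≢ (cyclicΦ eq _) rewrite eq = λ ()
  cyc-edge-option≢ (oddΦ eq _) rewrite eq = λ ()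
  cyc-edge-option≢ (twoΦ eq _) rewrite eq = λ ()
  cyc-edge-option≢ (evenΦ eq _) rewrite eq = λ ()

  -- The two low bits agree in `φ`, in `φ′` and in `nim false (N ℓ′) (N ℓ′)`, but not in the last
  -- summand.
  hair-edge-option≢ : ∀ {ℓ ℓ′ φ φ′} → Φ ℓ φ → Φ ℓ′ φ′ → φ′ ⊕ (nim false (N ℓ′) (N ℓ′) ⊕ nim false (not (N ℓ)) (N ℓ)) ≢ φ
  hair-edge-option≢ (cyclicΦ x _) (cyclicΦ y _) rewrite x | y = λ ()
  hair-edge-option≢ (cyclicΦ x _) (oddΦ y _) rewrite x | y = λ ()
  hair-edge-option≢ (cyclicΦ x _) (twoΦ y _) rewrite x | y = λ ()
  hair-edge-option≢ (cyclicΦ x _) (evenΦ y _) rewrite x | y = λ ()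
  hair-edge-option≢ (oddΦ x _) (cyclicΦ y _) rewrite x | y = λ ()
  hair-edge-option≢ (oddΦ x _) (oddΦ y _) rewrite x | y = λ ()
  hair-edge-option≢ (oddΦ x _) (twoΦ y _) rewrite x | y = λ ()
  hair-edge-option≢ (oddΦ x _) (evenΦ y _) rewrite x | y = λ ()
  hair-edge-option≢ (twoΦ x _) (cyclicΦ y _) rewrite x | y = λ ()
  hair-edge-option≢ (twoΦ x _) (oddΦ y _) rewrite x | y = λ ()
  hair-edge-option≢ (twoΦ x _) (twoΦ y _) rewrite x | y = λ ()
  hair-edge-option≢ (twoΦ x _) (evenΦ y _) rewrite x | y = λ ()
  hair-edge-option≢ (evenΦ x _) (cyclicΦ y _) rewrite x | y = λ ()
  hair-edge-option≢ (evenΦ x _) (oddΦ y _) rewrite x | y = λ ()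
  hair-edge-option≢ (evenΦ x _) (twoΦ y _) rewrite x | y = λ ()
  hair-edge-option≢ (evenΦ x _) (evenΦ y _) rewrite x | y = λ ()

  -- The same comparison of low bits: one vertex and two edges are removed.
  inner-option≢ : ∀ {ℓ ℓ′ φ φ′} → Φ ℓ φ → Φ ℓ′ φ′ → φ′ ⊕ (nim false (N ℓ′) (N ℓ′) ⊕ nim false (N ℓ xor false) (not (N ℓ))) ≢ φ
  inner-option≢ (cyclicΦ x _) (cyclicΦ y _) rewrite x | y = λ ()
  inner-option≢ (cyclicΦ x _) (oddΦ y _) rewrite x | y = λ ()
  inner-option≢ (cyclicΦ x _) (twoΦ y _) rewrite x | y = λ ()
  inner-option≢ (cyclicΦ x _) (evenΦ y _) rewrite x | y = λ ()
  inner-option≢ (oddΦ x _) (cyclicΦ y _) rewrite x | y = λ ()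
  inner-option≢ (oddΦ x _) (oddΦ y _) rewrite x | y = λ ()
  inner-option≢ (oddΦ x _) (twoΦ y _) rewrite x | y = λ ()
  inner-option≢ (oddΦ x _) (evenΦ y _) rewrite x | y = λ ()
  inner-option≢ (twoΦ x _) (cyclicΦ y _) rewrite x | y = λ ()
  inner-option≢ (twoΦ x _) (oddΦ y _) rewrite x | y = λ ()
  inner-option≢ (twoΦ x _) (twoΦ y _) rewrite x | y = λ ()
  inner-option≢ (twoΦ x _) (evenΦ y _) rewrite x | y = λ ()
  inner-option≢ (evenΦ x _) (cyclicΦ y _) rewrite x | y = λ ()
  inner-option≢ (evenΦ x _) (oddΦ y _) rewrite x | y = λ ()
  inner-option≢ (evenΦ x _) (twoΦ y _) rewrite x | y = λ ()
  inner-option≢ (evenΦ x _) (evenΦ y _) rewrite x | y = λ ()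

  ⊕-identityʳ : ∀ x → x ⊕ n0 ≡ x
  ⊕-identityʳ (nim x y z) rewrite xor-identityʳ x | xor-identityʳ y | xor-identityʳ z = refl

  N-leaf : ∀ {ℓ c w d} → ℓ c w ≡ suc d → N (upd ℓ c w d) ≡ not (N ℓ)
  N-leaf {ℓ} {c} {w} {d} eq = trans (N-upd ℓ c w d) (trans (cong (λ z → N ℓ xor (odd z xor odd d)) eq) (flip (N ℓ) (odd d)))
    where
    flip : ∀ x y → x xor (not y xor y) ≡ not x
    flip false false = refl
    flip false true = refl
    flip true false = refl
    flip true true = refl

  -- Nothing is severed when a leaf goes, so the parities of the tail cancel.
  leaf-value : ∀ {ℓ c w d φ} → ℓ c w ≡ suc d →
    φ ⊕ (nim false (N (upd ℓ c w d)) (N (upd ℓ c w d)) ⊕ nim false (N ℓ xor true) (not (N ℓ))) ≡ φ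
  leaf-value {ℓ} {c} {w} {d} {φ} eq = trans (cong (φ ⊕_) cancel) (⊕-identityʳ φ)
    where
    cancel : nim false (N (upd ℓ c w d)) (N (upd ℓ c w d)) ⊕ nim false (N ℓ xor true) (not (N ℓ)) ≡ n0
    cancel rewrite N-leaf {ℓ} {c} {w} {d} eq with N ℓ
    ... | false = refl
    ... | true = refl

  -- `N` is flipped, so equal values could only be the 0 of `cyclicΦ` and the 0 of `evenΦ`; a leaf
  -- deletion between these would make the even one `Two`.
  leaf-option≢ : ∀ {ℓ c w d φ φ′} → ℓ c w ≡ suc d → Φ ℓ φ → Φ (upd ℓ c w d) φ′ → φ′ ≢ φ
  leaf-option≢ {ℓ} {c} {w} {d} eq (cyclicΦ x h) (evenΦ y ¬two) _ = ¬two (cyclic-leaf⇒two {ℓ} {c} {w} {d} h eq)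
  leaf-option≢ {ℓ} {c} {w} {d} eq (evenΦ x ¬two) (cyclicΦ y h) _ = ¬two (leaf-cyclic⇒two {ℓ} {c} {w} {d} h eq)
  leaf-option≢ {ℓ} {c} {w} {d} eq (cyclicΦ x _) (cyclicΦ y _) _ = true≢false y (trans (N-leaf {ℓ} {c} {w} {d} eq) (cong not x))
  leaf-option≢ {ℓ} {c} {w} {d} eq (oddΦ x _) (oddΦ y _) _ = true≢false y (trans (N-leaf {ℓ} {c} {w} {d} eq) (cong not x))
  leaf-option≢ {ℓ} {c} {w} {d} eq (twoΦ x _) (twoΦ y _) _ = true≢false (trans (N-leaf {ℓ} {c} {w} {d} eq) (cong not x)) y
  leaf-option≢ {ℓ} {c} {w} {d} eq (evenΦ x _) (evenΦ y _) _ = true≢false (trans (N-leaf {ℓ} {c} {w} {d} eq) (cong not x)) y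

  hair-option≢ : ∀ {ℓ c w d φ φ′} → d < ℓ c w → Φ ℓ φ → Φ (upd ℓ c w d) φ′ →
    φ′ ⊕ (nim false (N (upd ℓ c w d)) (N (upd ℓ c w d)) ⊕ nim false (N ℓ xor not (does (suc d <?ℕ ℓ c w))) (not (N ℓ))) ≢ φ
  hair-option≢ {ℓ} {c} {w} {d} {φ} {φ′} lt p p′ with suc d <?ℕ ℓ c w
  ... | yes inner = subst (λ z → φ′ ⊕ (nim false (N (upd ℓ c w d)) (N (upd ℓ c w d)) ⊕ nim false (N ℓ xor not z) (not (N ℓ))) ≢ φ)
          (sym (dec-true (suc d <?ℕ ℓ c w) inner)) (inner-option≢ p p′)
  ... | no ¬inner = subst (λ z → φ′ ⊕ (nim false (N (upd ℓ c w d)) (N (upd ℓ c w d)) ⊕ nim false (N ℓ xor not z) (not (N ℓ))) ≢ φ)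
          (sym (dec-false (suc d <?ℕ ℓ c w) ¬inner))
          (λ eq → leaf-option≢ {ℓ} leaf p p′ (trans (sym (leaf-value {ℓ} {c} {w} {d} {φ′} leaf)) eq))
    where
    leaf : ℓ c w ≡ suc d
    leaf = ≤-antisym (≮⇒≥ ¬inner) lt

  -- The index is the nim-sum of the new core and the piece split off, the old rest being left out.
  data CoreMove (ℓ : Lengths) : Nim → Set where
    cyc-vertex : ∀ i → CoreMove ℓ (nim false (N ℓ xor D ℓ i) (not (N ℓ)))
    cyc-edge : CoreMove ℓ (nim false (not (N ℓ)) (N ℓ))
    hair-vertex : ∀ {c w d φ} → d < ℓ c w → Φ (upd ℓ c w d) φ →
      CoreMove ℓ (φ ⊕ (nim false (N (upd ℓ c w d)) (N (upd ℓ c w d)) ⊕ nim false (N ℓ xor not (does (suc d <?ℕ ℓ c w))) (not (N ℓ))))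

  leaf-move : ∀ {ℓ c w d φ} → ℓ c w ≡ suc d → Φ (upd ℓ c w d) φ → CoreMove ℓ φ
  leaf-move {ℓ} {c} {w} {d} {φ} eq p = subst (CoreMove ℓ)
    (trans (cong (λ z → φ ⊕ (nim false (N (upd ℓ c w d)) (N (upd ℓ c w d)) ⊕ nim false (N ℓ xor not z) (not (N ℓ))))
        (dec-false (suc d <?ℕ ℓ c w) (λ lt → <-irrefl (sym eq) lt)))
      (leaf-value {ℓ} {c} {w} {d} {φ} eq))
    (hair-vertex (subst (d <_) (sym eq) (n<1+n d)) p)

  -- What remains is a hairball of value 3 and an isolated vertex of value 1, with nim-sum 2.
  penultimate-move : ∀ {ℓ c w d} → N ℓ ≡ true → ℓ c w ≡ suc (suc d) → ¬ Cyclic (upd ℓ c w d) → CoreMove ℓ (nim false true false)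
  penultimate-move {ℓ} {c} {w} {d} x eq ¬cyc = subst (CoreMove ℓ) value
      (hair-vertex (subst (d <_) (sym eq) (n≤1+n (suc d))) (oddΦ y ¬cyc))
    where
    y : N (upd ℓ c w d) ≡ true
    y = trans (N-upd ℓ c w d) (cong₂ _xor_ x (trans (cong (λ z → odd z xor odd d) eq)
      (trans (cong (_xor odd d) (not-involutive (odd d))) (xor-same (odd d)))))
    value : n3 ⊕ (nim false (N (upd ℓ c w d)) (N (upd ℓ c w d)) ⊕ nim false (N ℓ xor not (does (suc d <?ℕ ℓ c w))) (not (N ℓ))) ≡ nim false true false
    value = trans (cong₂ (λ p q → n3 ⊕ (nim false p p ⊕ nim false (N ℓ xor not q) (not (N ℓ)))) y
        (dec-true (suc d <?ℕ ℓ c w) (subst (suc d <_) (sym eq) (n<1+n (suc d)))))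
      (cong (λ p → n3 ⊕ (nim false true true ⊕ nim false (p xor false) (not p))) x)

  core-below : ∀ {ℓ φ} → Φ ℓ φ → ∀ z → ⟦ z ⟧ < ⟦ φ ⟧ → CoreMove ℓ z
  -- Deleting a cycle vertex of odd degree leaves a forest with both parities even. If all degrees
  -- on the cycle are even, some leaf deletion leads to an even hairball that is not `Two`.
  core-below {ℓ} (oddΦ x ¬cyc) (nim false false false) _ with anyFin? (λ i → D ℓ i ≟ᵇ true)
  ... | yes (i , Di) = subst (CoreMove ℓ) (cong₂ (λ p q → nim false (p xor q) (not p)) x Di) (cyc-vertex i)
  ... | no none-odd with leaf-not-two {ℓ} ¬cyc (λ c → ≢true⇒≡false (λ t → none-odd (c , t)))
  ...   | c , w , d , eq , ¬two = leaf-move {ℓ} eq (evenΦ (trans (N-leaf {ℓ} {c} {w} {d} eq) (cong not x)) ¬two)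
  core-below {ℓ} (oddΦ x ¬cyc) (nim false false true) _ = subst (CoreMove ℓ) (cong (λ p → nim false (not p) p) x) cyc-edge
  -- Deleting a cycle vertex of even degree leaves an odd number of edges on an even number of
  -- vertices. If all degrees on the cycle are odd, some hair is long enough for `penultimate-move`.
  core-below {ℓ} (oddΦ x ¬cyc) (nim false true false) _ with anyFin? (λ i → D ℓ i ≟ᵇ false)
  ... | yes (i , Di) = subst (CoreMove ℓ) (cong₂ (λ p q → nim false (p xor q) (not p)) x Di) (cyc-vertex i)
  ... | no none-even with cut-long-hair M-odd {ℓ} x (λ c → trans (sym (not-involutive _)) (cong not (≢true⇒≡false (λ t → none-even (c , trans (sym (not-involutive _)) (cong not t))))))
  ...   | c , w , d , eq , ¬cyc′ = penultimate-move {ℓ} x eq ¬cyc′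
  core-below (oddΦ x ¬cyc) (nim false true true) (s≤s (s≤s (s≤s ())))
  core-below (oddΦ x ¬cyc) (nim true false false) (s≤s (s≤s (s≤s ())))
  core-below (oddΦ x ¬cyc) (nim true false true) (s≤s (s≤s (s≤s ())))
  core-below (oddΦ x ¬cyc) (nim true true false) (s≤s (s≤s (s≤s ())))
  core-below (oddΦ x ¬cyc) (nim true true true) (s≤s (s≤s (s≤s ())))
  core-below {ℓ} (twoΦ x (A , k , h)) (nim false false false) _ with two⇒leaf-cyclic {ℓ} h
  ... | w , eq , cyclic = leaf-move {ℓ} eq (cyclicΦ (trans (N-leaf {ℓ} {A} {w} {k} eq) (cong not x)) cyclic)
  -- Cycle vertices other than `A` have even degree; `cpred A` is one of them.
  core-below {ℓ} (twoΦ x (A , k , h)) (nim false false true) _ =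
    subst (CoreMove ℓ) (cong₂ (λ p q → nim false (p xor q) (not p)) x (two-degree-other {ℓ} h (cpred≢id A))) (cyc-vertex (cpred A))
  core-below {ℓ} (twoΦ x _) (nim false true false) _ = subst (CoreMove ℓ) (cong (λ p → nim false (not p) p) x) cyc-edge
  -- For `k` equal to 0 the degree of `A` is odd, and deleting `A` makes both parities odd.
  -- Otherwise the degree is even, and shortening the shorter hair gives value 3 instead.
  core-below {ℓ} (twoΦ x (A , zero , h)) (nim false true true) _ =
    subst (CoreMove ℓ) (cong₂ (λ p q → nim false (p xor q) (not p)) x (two-degree {ℓ} h)) (cyc-vertex A)
  core-below {ℓ} (twoΦ x (A , suc k , h)) (nim false true true) _ with two⇒leaf-non-cyclic {ℓ} h
  ... | w , eq , ¬cyclic = leaf-move {ℓ} eq (oddΦ (trans (N-leaf {ℓ} {A} {w} {k} eq) (cong not x)) ¬cyclic)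
  core-below (twoΦ x _) (nim true false false) (s≤s (s≤s (s≤s (s≤s ()))))
  core-below (twoΦ x _) (nim true false true) (s≤s (s≤s (s≤s (s≤s ()))))
  core-below (twoΦ x _) (nim true true false) (s≤s (s≤s (s≤s (s≤s ()))))
  core-below (twoΦ x _) (nim true true true) (s≤s (s≤s (s≤s (s≤s ()))))

  Inv : List V → Adj → ℕ → Set
  Inv xs a k = ∃ λ z → Pos xs a z × ⟦ z ⟧ ≡ k

  ⊕-≢ : ∀ {x y} b → x ≢ y → x ⊕ b ≢ y ⊕ b
  ⊕-≢ {x} {y} b h eq = h (trans (sym (⊕-cancelʳ x b)) (trans (cong (_⊕ b) eq) (⊕-cancelʳ y b)))

  ⟦⟧-≢ : ∀ {x y} → x ≢ y → ⟦ x ⟧ ≢ ⟦ y ⟧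
  ⟦⟧-≢ {x} {y} h eq = h (⟦⟧-injective x y eq)

  module _ {xs : List V} {a : Adj} {cs bs : List V} (B : Base xs a cs bs) where

    ∈-core-or-rest : ∀ {v} → v ∈ xs → v ∈ cs ⊎ v ∈ bs
    ∈-core-or-rest m = ∈-++⁻ cs (∈-resp-↭ (perm B) m)

    core⊆ : ∀ {v} → v ∈ cs → v ∈ xs
    core⊆ m = ∈-resp-↭ (↭-sym (perm B)) (∈-++⁺ˡ m)

    rest⊆ : ∀ {v} → v ∈ bs → v ∈ xs
    rest⊆ m = ∈-resp-↭ (↭-sym (perm B)) (∈-++⁺ʳ cs m)

    delete-rest : ∀ {φ v ys} → Core a cs φ → v ∈ bs → xs ↭ v ∷ ys →
      Pos ys a (φ ⊕ nim false (E a bs xor ⨁ bs (a v)) (not (odd (length bs))))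
    delete-rest {φ} {v} core v∈ p with ∈⇒↭∷ v∈
    ... | bs₁ , π = mkPos (base-vertex-rest B π p) core (cong (φ ⊕_) (cong₂ (nim false)
        (trans (cong (E a bs xor_) (⨁-degree-remove (a-sym B) (a-irr B) π))
          (sym (xor-swap {x = E a bs} {y = ⨁ bs₁ (a v)} (E-↭ (a-sym B) π))))
        (trans (cong (λ z → not (odd z)) (↭-length π)) (not-involutive _))))

    core-remV : ∀ {φ u v} → Core a cs φ → u ∈ bs → v ∈ bs → Core (remV a u v) cs φ
    core-remV none u∈ v∈ = none
    core-remV {u = u} {v} (hairball C same p) u∈ v∈ = hairball C (λ {x} {y} x∈ y∈ → trans
      (rem-other (remV-IsRem a u v) x y (λ { (refl , _) → Unique-++-disjoint cs (uniq B) x∈ u∈ }) (λ { (refl , _) → Unique-++-disjoint cs (uniq B) x∈ v∈ }))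
      (same x∈ y∈)) p

    delete-rest-edge : ∀ {φ u v} → Core a cs φ → u ∈ bs → v ∈ bs → a u v ≡ true →
      Pos xs (remV a u v) (φ ⊕ nim false (not (E a bs)) (odd (length bs)))
    delete-rest-edge {φ} {u} {v} core u∈ v∈ auv = mkPos (base-edge u v B) (core-remV core u∈ v∈)
      (cong (λ z → φ ⊕ nim false z (odd (length bs))) (sym
        (E-rem (a-sym B) (remV-sym (a-sym B)) (a-irr B) (Unique-++ʳ cs (uniq B)) u∈ v∈ auv (remV-IsRem a u v))))

    Reach₁ : ℕ → Set
    Reach₁ j = (∃ λ v → ∃ λ ys → xs ↭ v ∷ ys × Inv ys a j)
        ⊎ (∃ λ u → ∃ λ v → ∃ λ a′ → u ∈ xs × v ∈ xs × a u v ≡ true × IsRem a u v a′ × Inv xs a′ j)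

    core-reach : ∀ {φ z} → Core a cs φ → ⟦ z ⟧ < ⟦ φ ⟧ → Reach₁ ⟦ z ⊕ restValue a bs ⟧
    core-reach none ()
    core-reach {z = z} (hairball {ℓ} C same p) lt = go (core-below p z lt)
      where
      remove : ∀ v → v ∈ cs → ∃ λ ys → xs ↭ v ∷ ys
      remove v m = ∈⇒↭∷ (core⊆ m)
      go : ∀ {z} → CoreMove ℓ z → Reach₁ ⟦ z ⊕ restValue a bs ⟧
      go (cyc-vertex i) with remove (cyc i) (complete C tt)
      ... | ys , π = inj₁ (cyc i , ys , π , _ , delete-cyc B C same π , refl)
      go (hair-vertex {c} {w} {d} d< q) with remove (hair c w d) (complete C d<)
      ... | ys , π = inj₁ (hair c w d , ys , π , _ , delete-hair B C same d< q π , refl)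
      go cyc-edge = inj₂ (cyc zero , target (cyc zero) , remV a (cyc zero) (target (cyc zero)) ,
        core⊆ (complete C tt) , core⊆ (complete C tt) ,
        trans (same (complete C tt) (complete C tt)) (adjV-target (cyc zero)) , remV-IsRem a _ _ ,
        _ , delete-cyc-edge B C same zero , refl)

    -- Deleting an even-degree vertex flips the parity of vertices, deleting an edge that of edges,
    -- and deleting an odd-degree vertex both. These three moves give all smaller values.
    rest-reach : ∀ {φ z} → Core a cs φ → ⟦ z ⟧ < ⟦ restValue a bs ⟧ → Reach₁ ⟦ φ ⊕ z ⟧
    rest-reach {φ} {z} core lt = go (E a bs) refl (odd (length bs)) refl z lt
      where
      go : ∀ ε → E a bs ≡ ε → ∀ ν → odd (length bs) ≡ ν → ∀ z → ⟦ z ⟧ < ⟦ nim false ε ν ⟧ → Reach₁ ⟦ φ ⊕ z ⟧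
      vertex : ∀ {ε ν} → E a bs ≡ ε → odd (length bs) ≡ ν → ∀ δ → (∃ λ v → v ∈ bs × ⨁ bs (a v) ≡ δ) → Reach₁ ⟦ φ ⊕ nim false (ε xor δ) (not ν) ⟧
      vertex refl refl _ (v , v∈ , refl) with ∈⇒↭∷ (rest⊆ v∈)
      ... | ys , π = inj₁ (v , ys , π , _ , delete-rest core v∈ π , refl)
      edge : ∀ {ν} → E a bs ≡ true → odd (length bs) ≡ ν → Reach₁ ⟦ φ ⊕ nim false false ν ⟧
      edge ε≡ refl with E-edge (a-sym B) (a-irr B) bs ε≡
      ... | u , v , u∈ , v∈ , auv = inj₂ (u , v , remV a u v , rest⊆ u∈ , rest⊆ v∈ , auv , remV-IsRem a u v ,
              _ , delete-rest-edge core u∈ v∈ auv , cong (λ t → ⟦ φ ⊕ nim false (not t) (odd (length bs)) ⟧) ε≡)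
      even : odd (length bs) ≡ true → ∃ λ v → v ∈ bs × ⨁ bs (a v) ≡ false
      even = even-degree-vertex (a-sym B) (a-irr B) bs
      odd′ : E a bs ≡ true → ∃ λ v → v ∈ bs × ⨁ bs (a v) ≡ true
      odd′ = odd-degree-vertex (a-sym B) (a-irr B) (col B) bs (bip B)
      go false e true o (nim false false false) _ = vertex e o false (even o)
      go true e false o (nim false false false) _ = edge e o
      go true e false o (nim false false true) _ = vertex e o true (odd′ e)
      go true e true o (nim false false false) _ = vertex e o true (odd′ e)
      go true e true o (nim false false true) _ = edge e o
      go true e true o (nim false true false) _ = vertex e o false (even o)
      go false e true o (nim false false true) (s≤s ())
      go false e true o (nim false true false) (s≤s ())
      go false e true o (nim false true true) (s≤s ())
      go false e true o (nim true false false) (s≤s ())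
      go false e true o (nim true false true) (s≤s ())
      go false e true o (nim true true false) (s≤s ())
      go false e true o (nim true true true) (s≤s ())
      go true e false o (nim false true false) (s≤s (s≤s ()))
      go true e false o (nim false true true) (s≤s (s≤s ()))
      go true e false o (nim true false false) (s≤s (s≤s ()))
      go true e false o (nim true false true) (s≤s (s≤s ()))
      go true e false o (nim true true false) (s≤s (s≤s ()))
      go true e false o (nim true true true) (s≤s (s≤s ()))
      go true e true o (nim false true true) (s≤s (s≤s (s≤s ())))
      go true e true o (nim true false false) (s≤s (s≤s (s≤s ())))
      go true e true o (nim true false true) (s≤s (s≤s (s≤s ())))
      go true e true o (nim true true false) (s≤s (s≤s (s≤s ())))
      go true e true o (nim true true true) (s≤s (s≤s (s≤s ())))

  -- The rule for nim-sums: by `<⊕` it is enough to lower one of the two summands.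
  Inv-below : ∀ {xs a k} → Inv xs a k → ∀ j → j < k →
    (∃ λ v → ∃ λ ys → xs ↭ v ∷ ys × Inv ys a j)
    ⊎ (∃ λ u → ∃ λ v → ∃ λ a′ → u ∈ xs × v ∈ xs × a u v ≡ true × IsRem a u v a′ × Inv xs a′ j)
  Inv-below {a = a} (_ , mkPos {bs = bs} {φ} B core refl , refl) j j<k with fromℕ-below (φ ⊕ restValue a bs) j j<k
  ... | z , refl with <⊕ φ (restValue a bs) z j<k
  ...   | inj₁ lt = subst (λ t → Reach₁ B ⟦ t ⟧) (⊕-cancelʳ z (restValue a bs)) (core-reach B {z = z ⊕ restValue a bs} core lt)
  ...   | inj₂ lt = subst (λ t → Reach₁ B ⟦ t ⟧) (trans (⊕-comm φ (z ⊕ φ)) (⊕-cancelʳ z φ)) (rest-reach B {z = z ⊕ φ} core lt)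

  nim-≢ˡ : ∀ φ {x y} → x ≢ y → φ ⊕ x ≢ φ ⊕ y
  nim-≢ˡ φ {x} {y} h eq = ⊕-≢ {x} {y} φ h (trans (⊕-comm x φ) (trans eq (⊕-comm φ y)))

  b≢not : ∀ {b} → not b ≢ b
  b≢not {false} ()
  b≢not {true} ()

  Inv-after-vertex : ∀ {xs a k v ys} → Inv xs a k → xs ↭ v ∷ ys → ∃ λ k′ → k′ ≢ k × Inv ys a k′
  Inv-after-vertex {a = a} {v = v} (_ , mkPos {bs = bs} {φ} B core refl , refl) π
    with ∈-core-or-rest B (∈-resp-↭ (↭-sym π) (here refl))
  ... | inj₂ v∈ = _ , ⟦⟧-≢ (nim-≢ˡ φ (λ eq → b≢not (cong Nim.b₀ eq))) , _ , delete-rest B core v∈ π , refl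
  Inv-after-vertex {v = cyc i} (_ , mkPos {bs = bs} B (hairball {ℓ} C same p) refl , refl) π | inj₁ v∈ =
    _ , ⟦⟧-≢ (⊕-≢ _ (cyc-option≢ {ℓ} i p)) , _ , delete-cyc B C same π , refl
  Inv-after-vertex {v = hair c w d} (_ , mkPos {bs = bs} B (hairball {ℓ} C same p) refl , refl) π | inj₁ v∈
    with Φ-total (upd ℓ c w d)
  ... | φ′ , p′ = _ , ⟦⟧-≢ (⊕-≢ _ (hair-option≢ {ℓ} (sound C v∈) p p′)) , _ , delete-hair B C same (sound C v∈) p′ π , refl

  -- Every edge of a core is the arc leaving one of its ends, so treating arcs is enough.
  core-edge : ∀ {xs a cs bs φ} u → Base xs a cs bs → Core a cs φ → u ∈ cs →
    ∃ λ z → ⟦ z ⟧ ≢ ⟦ φ ⊕ restValue a bs ⟧ × Pos xs (remV a u (target u)) z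
  core-edge (cyc i) B (hairball {ℓ} C same p) u∈ = _ , ⟦⟧-≢ (⊕-≢ _ (cyc-edge-option≢ {ℓ} p)) , delete-cyc-edge B C same i
  core-edge (hair c w d) B (hairball {ℓ} C same p) u∈ with Φ-total (upd ℓ c w d)
  ... | φ′ , p′ = _ , ⟦⟧-≢ (⊕-≢ _ (hair-edge-option≢ {ℓ} p p′)) , delete-hair-edge B C same (sound C u∈) p′

  Inv-after-edge : ∀ {xs a k u v} → Inv xs a k → u ∈ xs → v ∈ xs → a u v ≡ true →
    ∃ λ k′ → ∃ λ a′ → IsRem a u v a′ × k′ ≢ k × Inv xs a′ k′
  Inv-after-edge {a = a} {u = u} {v} (_ , mkPos {bs = bs} {φ} B core refl , refl) u∈ v∈ auv
    with ∈-core-or-rest B u∈ | ∈-core-or-rest B v∈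
  ... | inj₁ p | inj₂ q = ⊥-elim (true≢false auv (cross B p q))
  ... | inj₂ p | inj₁ q = ⊥-elim (true≢false (trans (a-sym B v u) auv) (cross B q p))
  ... | inj₂ p | inj₂ q = _ , _ , remV-IsRem a u v , ⟦⟧-≢ (nim-≢ˡ φ (λ eq → b≢not (cong Nim.b₁ eq))) , _ , delete-rest-edge B core p q auv , refl
  Inv-after-edge {a = a} {u = u} {v} (_ , mkPos B core@(hairball C same _) refl , refl) u∈ v∈ auv | inj₁ p | inj₁ q
    with adjV⇒ u v (trans (sym (same p q)) auv)
  ... | inj₁ refl with core-edge u B core p
  ...   | z , z≢ , P = _ , _ , remV-IsRem a u (target u) , z≢ , z , P , refl
  Inv-after-edge {a = a} {u = u} {v} (_ , mkPos B core@(hairball C same _) refl , refl) u∈ v∈ auv | inj₁ p | inj₁ q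
      | inj₂ refl with core-edge v B core q
  ...   | z , z≢ , P = _ , _ , IsRem-swap (remV-IsRem a v (target v)) , z≢ , z , P , refl

  Inv-closed : Closed Inv
  Inv-closed = record
    { symm = λ { (_ , P , _) → a-sym (Pos.base P) }
    ; irrefl = λ { (_ , P , _) → a-irr (Pos.base P) }
    ; after-vertex = Inv-after-vertex
    ; after-edge = Inv-after-edge
    ; below = Inv-below }

-- Every hairball is a labelled core

module Walks (G : Graph) (simple : IsSimple G) where
  open import Data.List.Membership.DecPropositional (_≟ᶠ_ {n = n G}) using (_∈?_)

  edge-sym : ∀ {x y} → Edge G x y → Edge G y x
  edge-sym {x} {y} h = trans (sym (proj₁ simple x y)) h

  data Walk (P : Fin (n G) → Set) : Fin (n G) → Fin (n G) → Set where
    stay : ∀ {x} → P x → Walk P x x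
    go : ∀ {x y z} → P x → Edge G x y → Walk P y z → Walk P x z

  _⟫_ : ∀ {P x y z} → Walk P x y → Walk P y z → Walk P x z
  stay _ ⟫ q = q
  go px e p ⟫ q = go px e (p ⟫ q)

  walk-start : ∀ {P x y} → Walk P x y → P x
  walk-start (stay p) = p
  walk-start (go p _ _) = p

  reverse-walk : ∀ {P x y} → Walk P x y → Walk P y x
  reverse-walk (stay p) = stay p
  reverse-walk (go p e w) = reverse-walk w ⟫ go (walk-start w) (edge-sym e) (stay p)

  -- Path x vs z : the vertices x ∷ vs form a simple path ending in z.
  data Path : Fin (n G) → List (Fin (n G)) → Fin (n G) → Set where
    one : ∀ {x} → Path x [] x
    more : ∀ {x y z vs} → Edge G x y → x ∉ y ∷ vs → Path y vs z → Path x (y ∷ vs) z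

  path-from : ∀ {x y z vs} → Path y vs z → x ∈ y ∷ vs →
    ∃ λ us → Path x us z × (∀ {v} → v ∈ x ∷ us → v ∈ y ∷ vs)
  path-from p (here refl) = _ , p , (λ m → m)
  path-from (more e ∉ p) (there m) with path-from p m
  ... | us , q , sub = us , q , (λ m → there (sub m))

  -- Loop erasure: if the new first vertex already lies on the path, the path is restarted there.
  simple-path : ∀ {P x z} → Walk P x z → ∃ λ vs → Path x vs z × (∀ {v} → v ∈ x ∷ vs → P v)
  simple-path (stay p) = [] , one , (λ { (here refl) → p })
  simple-path {x = x} (go {y = y} p e w) with simple-path w
  ... | vs , q , all with x ∈? (y ∷ vs)
  ...   | yes m with path-from q m
  ...     | us , q′ , sub = us , q′ , (λ m → all (sub m))
  simple-path {x = x} (go {y = y} p e w) | vs , q , all | no ∉ =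
    y ∷ vs , more e ∉ q , (λ { (here refl) → p ; (there m) → all m })

  path-lookup-injective : ∀ {x vs z} → Path x vs z → ∀ a b → lookup (x ∷ vs) a ≡ lookup (x ∷ vs) b → a ≡ b
  path-lookup-injective p zero zero _ = refl
  path-lookup-injective (more {y = y} {vs = vs} e ∉ p) zero (suc b) eq = ⊥-elim (∉ (subst (_∈ y ∷ vs) (sym eq) (∈-lookup b)))
  path-lookup-injective (more {y = y} {vs = vs} e ∉ p) (suc a) zero eq = ⊥-elim (∉ (subst (_∈ y ∷ vs) eq (∈-lookup a)))
  path-lookup-injective (more e ∉ p) (suc a) (suc b) eq = cong suc (path-lookup-injective p a b eq)

  path-edge : ∀ {x vs z} → Path x vs z → ∀ (k : Fin (length vs)) → Edge G (lookup (x ∷ vs) (inject₁ k)) (lookup (x ∷ vs) (suc k))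
  path-edge (more e ∉ p) zero = e
  path-edge (more e ∉ p) (suc k) = path-edge p k

  path-last : ∀ {x vs z} → Path x vs z → lookup (x ∷ vs) (fromℕ (length vs)) ≡ z
  path-last one = refl
  path-last (more e ∉ p) = path-last p

module UniqueCycle (G : Graph) (C : Cycle G) (hairball : IsHairballWithCycle G C) where

  simple : IsSimple G
  simple = proj₁ (proj₁ hairball)

  open Walks G simple public

  cycEdge-onʳ : ∀ {x y} → CycEdge C x y → OnCycle C y
  cycEdge-onʳ (inj₁ (k , inj₁ (_ , q))) = suc k , sym q
  cycEdge-onʳ (inj₁ (k , inj₂ (_ , q))) = inject₁ k , sym q
  cycEdge-onʳ (inj₂ (inj₁ (_ , q))) = zero , sym q
  cycEdge-onʳ (inj₂ (inj₂ (_ , q))) = fromℕ (2 + r C) , sym q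

  one-neighbour : ∀ {w u u′} → ¬ OnCycle C w → u ≢ u′ → Edge G w u → Edge G w u′ → ¬ Walk (_≢ w) u u′
  one-neighbour {w} {u} {u′} off u≢u′ wu wu′ walk with simple-path walk
  ... | [] , one , _ = u≢u′ refl
  ... | y ∷ vs , p , all = off (cycEdge-onʳ (proj₂ (proj₂ (proj₂ (proj₁ hairball)) D u′ w)
          (inj₂ (inj₁ (sym (path-last p′) , refl)))))
    where
    p′ : Path w (u ∷ y ∷ vs) u′
    p′ = more wu (λ m → all m refl) p
    D : Cycle G
    D = record
      { r = length vs
      ; vtx = lookup (w ∷ u ∷ y ∷ vs)
      ; inj = path-lookup-injective p′
      ; edges = path-edge p′
      ; close = subst (λ z → Edge G z w) (sym (path-last p′)) (edge-sym wu′) }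

  cycEdge⇒cpred : ∀ {i j} → CycEdge C (vtx C i) (vtx C j) → i ≡ cpred j ⊎ j ≡ cpred i
  cycEdge⇒cpred (inj₁ (k , inj₁ (p , q))) with inj C _ _ p | inj C _ _ q
  ... | refl | refl = inj₁ refl
  cycEdge⇒cpred (inj₁ (k , inj₂ (p , q))) with inj C _ _ p | inj C _ _ q
  ... | refl | refl = inj₂ refl
  cycEdge⇒cpred (inj₂ (inj₁ (p , q))) with inj C _ _ p | inj C _ _ q
  ... | refl | refl = inj₁ refl
  cycEdge⇒cpred (inj₂ (inj₂ (p , q))) with inj C _ _ p | inj C _ _ q
  ... | refl | refl = inj₂ refl

  cpred-CycEdge : ∀ j → CycEdge C (vtx C (cpred j)) (vtx C j)
  cpred-CycEdge zero = inj₂ (inj₁ (refl , refl))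
  cpred-CycEdge (suc j) = inj₁ (j , inj₁ (refl , refl))

  cpred-edge : ∀ j → Edge G (vtx C (cpred j)) (vtx C j)
  cpred-edge zero = close C
  cpred-edge (suc j) = edges C j

  -- The edge closes the stretch from `i` to `j` to a cycle. By uniqueness it is an edge of `C`,
  -- hence joins cyclic neighbours; the pair of first and last vertex is included.
  chord< : ∀ {i j} → toℕ i < toℕ j → Edge G (vtx C i) (vtx C j) → i ≡ cpred j ⊎ j ≡ cpred i
  chord< {i} {j} i<j e with toℕ j ≟ℕ suc (toℕ i)
  chord< {i} {suc j} i<j e | yes eq = inj₁ (toℕ-injective (trans (suc-injective (sym eq)) (sym (toℕ-inject₁ j))))
  ... | no ne = [ inj₂ , inj₁ ]′ (cycEdge⇒cpred (proj₂ (proj₂ (proj₂ (proj₁ hairball)) D (vtx C j) (vtx C i))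
      (inj₂ (inj₁ (cong (vtx C) (sym at-last) , cong (vtx C) (sym at-first))))))
    where
    -- The stretch has `j - i + 1` vertices, a number that `Cycle` writes as `3 + t`.
    t : ℕ
    t = toℕ j ∸ (2 + toℕ i)
    t-eq : 2 + toℕ i + t ≡ toℕ j
    t-eq = m+[n∸m]≡n (≤∧≢⇒< i<j (λ eq → ne (sym eq)))
    bound : ∀ (k : Fin (3 + t)) → toℕ i + toℕ k < 3 + r C
    bound k = ≤-trans (s≤s (+-monoʳ-≤ (toℕ i) (≤-pred (toℕ<n k)))) (≤-trans (s≤s (subst (_≤ toℕ j)
      (trans (sym (cong suc (+-suc (toℕ i) t))) (sym (+-suc (toℕ i) (suc t)))) (subst (_≤ toℕ j) (sym t-eq) ≤-refl))) (toℕ<n j))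
    at : Fin (3 + t) → Fin (3 + r C)
    at k = fromℕ< (bound k)
    toℕ-at : ∀ k → toℕ (at k) ≡ toℕ i + toℕ k
    toℕ-at k = toℕ-fromℕ< (bound k)
    at-first : at zero ≡ i
    at-first = toℕ-injective (trans (toℕ-at zero) (+-identityʳ (toℕ i)))
    at-last : at (fromℕ (2 + t)) ≡ j
    at-last = toℕ-injective (trans (toℕ-at (fromℕ (2 + t))) (trans (cong (toℕ i +_) (toℕ-fromℕ (2 + t)))
      (trans (+-suc (toℕ i) (suc t)) (trans (cong suc (+-suc (toℕ i) t)) t-eq))))
    at-injective : ∀ a b → at a ≡ at b → a ≡ b
    at-injective a b eq = toℕ-injective (+-cancelˡ-≡ (toℕ i) _ _ (trans (sym (toℕ-at a)) (trans (cong toℕ eq) (toℕ-at b))))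
    at-pred : ∀ (k : Fin (2 + t)) → at (inject₁ k) ≡ cpred (at (suc k))
    at-pred k with at (suc k) | toℕ-at (suc k)
    ... | zero | eq = ⊥-elim (0≢ (trans eq (+-suc (toℕ i) (toℕ k))))
      where 0≢ : ∀ {m} → 0 ≢ suc m
            0≢ ()
    ... | suc s | eq = toℕ-injective (trans (toℕ-at (inject₁ k)) (trans (cong (toℕ i +_) (toℕ-inject₁ k))
            (trans (suc-injective (sym (trans eq (+-suc (toℕ i) (toℕ k))))) (sym (toℕ-inject₁ s)))))
    D : Cycle G
    D = record
      { r = t
      ; vtx = λ k → vtx C (at k)
      ; inj = λ a b eq → at-injective a b (inj C _ _ eq)
      ; edges = λ k → subst (λ z → Edge G (vtx C z) (vtx C (at (suc k)))) (sym (at-pred k)) (cpred-edge (at (suc k)))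
      ; close = Eq.subst₂ (λ y z → Edge G (vtx C y) (vtx C z)) (sym at-last) (sym at-first) (edge-sym e) }

  no-chord : ∀ i j → Edge G (vtx C i) (vtx C j) → i ≡ cpred j ⊎ j ≡ cpred i
  no-chord i j e with <-cmp (toℕ i) (toℕ j)
  ... | tri< lt _ _ = chord< lt e
  ... | tri> _ _ gt = [ inj₂ , inj₁ ]′ (chord< gt (edge-sym e))
  ... | tri≈ _ eq _ with toℕ-injective eq
  ...   | refl = ⊥-elim (true≢false e (proj₂ simple (vtx C i)))

  three-neighbours : ∀ {x p q t} → degree G x ≤ 2 → Edge G x p → Edge G x q → Edge G x t → p ≢ q → p ≢ t → q ≢ t → ⊥
  three-neighbours {x} {p} {q} {t} deg xp xq xt p≢q p≢t q≢t = <-irrefl refl (≤-trans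
    (Unique-⊆⇒length≤ {ys = p ∷ q ∷ t ∷ []} ((p≢q ∷ p≢t ∷ []) ∷ (q≢t ∷ []) ∷ [] ∷ []) sub) deg)
    where
    sub : ∀ {v} → v ∈ p ∷ q ∷ t ∷ [] → v ∈ filterᵇ (adj G x) (allFin (n G))
    sub (here refl) = ∈-filterᵇ⁺ (adj G x) (∈-allFin _) xp
    sub (there (here refl)) = ∈-filterᵇ⁺ (adj G x) (∈-allFin _) xq
    sub (there (there (here refl))) = ∈-filterᵇ⁺ (adj G x) (∈-allFin _) xt

  open Ambient (r C) (n G)

  -- A partial labelling, to be enlarged vertex by vertex; `f` is meaningful on the core only.
  -- `f-first` names each slot after the first vertex of its hair, so a new hair finds a free slot
  -- without a search.
  record Labelling : Set where
    field
      ℓ : Lengths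
      e : Fin (n G) → Maybe V
      f : V → Fin (n G)
      f-cyc : ∀ i → f (cyc i) ≡ vtx C i
      e-f : ∀ {v} → InCore ℓ v → e (f v) ≡ just v
      f-e : ∀ {x v} → e x ≡ just v → f v ≡ x × InCore ℓ v
      f-adj : ∀ {u v} → InCore ℓ u → InCore ℓ v → adj G (f u) (f v) ≡ adjV u v
      f-first : ∀ {c w} → 0 < ℓ c w → f (hair c w 0) ≡ w

  start : Labelling
  start = record
    { ℓ = λ _ _ → 0 ; e = e₀ ; f = f₀ ; f-cyc = λ _ → refl
    ; e-f = e-f₀ ; f-e = f-e₀ ; f-adj = f-adj₀ ; f-first = λ () }
    where
    f₀ : V → Fin (n G)
    f₀ (cyc i) = vtx C i
    f₀ (hair c w d) = w
    e₀ : Fin (n G) → Maybe V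
    e₀ x with anyFin? (λ i → vtx C i ≟ᶠ x)
    ... | yes (i , _) = just (cyc i)
    ... | no _ = nothing
    e-f₀ : ∀ {v} → InCore (λ _ _ → 0) v → e₀ (f₀ v) ≡ just v
    e-f₀ {cyc i} _ with anyFin? (λ j → vtx C j ≟ᶠ vtx C i)
    ... | yes (j , eq) = cong (λ z → just (cyc z)) (inj C j i eq)
    ... | no ¬p = ⊥-elim (¬p (i , refl))
    e-f₀ {hair c w d} ()
    f-e₀ : ∀ {x v} → e₀ x ≡ just v → f₀ v ≡ x × InCore (λ _ _ → 0) v
    f-e₀ {x} h with anyFin? (λ i → vtx C i ≟ᶠ x)
    f-e₀ {x} refl | yes (i , eq) = eq , tt
    f-adj₀ : ∀ {u v} → InCore (λ _ _ → 0) u → InCore (λ _ _ → 0) v → adj G (f₀ u) (f₀ v) ≡ adjV u v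
    f-adj₀ {cyc i} {cyc j} _ _ = ⇔→≡ (mk⇔ (λ h → [ (λ { refl → edge₁ j }) , (λ { refl → edge₂ i }) ]′ (no-chord i j h))
        (λ h → [ (λ eq → edge₃ (trans (cong cpred (cyc-injective eq)) (cpred-csucc i)))
               , (λ eq → edge₄ (trans (cong cpred (cyc-injective eq)) (cpred-csucc j))) ]′ (adjV⇒ (cyc i) (cyc j) h)))
      where
      edge₁ : ∀ j → adjV (cyc (cpred j)) (cyc j) ≡ true
      edge₁ j = subst (λ z → adjV (cyc (cpred j)) (cyc z) ≡ true) (csucc-cpred j) (adjV-target (cyc (cpred j)))
      edge₂ : ∀ i → adjV (cyc i) (cyc (cpred i)) ≡ true
      edge₂ i = trans (adjV-sym (cyc i) (cyc (cpred i))) (edge₁ i)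
      edge₃ : cpred j ≡ i → Edge G (vtx C i) (vtx C j)
      edge₃ refl = cpred-edge j
      edge₄ : cpred i ≡ j → Edge G (vtx C i) (vtx C j)
      edge₄ refl = edge-sym (cpred-edge i)
    f-adj₀ {hair _ _ _} ()
    f-adj₀ {cyc _} {hair _ _ _} _ ()

  module _ (L : Labelling) where
    open Labelling L

    f-injective : ∀ {u v} → InCore ℓ u → InCore ℓ v → f u ≡ f v → u ≡ v
    f-injective {u} {v} p q eq with trans (sym (e-f p)) (trans (cong e eq) (e-f q))
    ... | refl = refl

    on-cycle-label : ∀ {x v} → e x ≡ just v → OnCycle C x → ∃ λ i → v ≡ cyc i
    on-cycle-label h (i , refl) with trans (sym h) (trans (cong e (sym (f-cyc i))) (e-f tt))
    ... | refl = i , refl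

    unlabelled-off-cycle : ∀ {x} → e x ≡ nothing → ¬ OnCycle C x
    unlabelled-off-cycle h (i , refl) with trans (sym h) (trans (cong e (sym (f-cyc i))) (e-f tt))
    ... | ()

    module _ {w : Fin (n G)} (w∉ : e w ≡ nothing) where

      f≢w : ∀ {v} → InCore ℓ v → f v ≢ w
      f≢w p refl with trans (sym w∉) (e-f p)
      ... | ()

      to-target : ∀ u → InCore ℓ u → Walk (_≢ w) (f u) (f (target u))
      to-target u p = go (f≢w p) (trans (f-adj p (InCore-target u p)) (adjV-target u)) (stay (f≢w (InCore-target u p)))

      to-base : ∀ v → InCore ℓ v → Walk (_≢ w) (f v) (f (cyc zero))
      to-base (hair c w′ zero) p = to-target (hair c w′ zero) p ⟫ to-base (cyc c) tt
      to-base (hair c w′ (suc d)) p = to-target (hair c w′ (suc d)) p ⟫ to-base (hair c w′ d) (InCore-target {ℓ} (hair c w′ (suc d)) p)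
      to-base (cyc i) _ = descend (toℕ i) i refl
        where
        descend : ∀ k i → toℕ i ≡ k → Walk (_≢ w) (f (cyc i)) (f (cyc zero))
        descend k zero _ = stay (f≢w tt)
        descend (suc k) (suc i) eq = reverse-walk (subst (λ z → Walk (_≢ w) (f (cyc (inject₁ i))) (f (cyc z))) (csucc-cpred (suc i)) (to-target (cyc (inject₁ i)) tt))
          ⟫ descend k (inject₁ i) (trans (toℕ-inject₁ i) (suc-injective eq))

      -- The labelled part is connected without `w`, so two attachments would close a cycle through
      -- `w`, which lies off `C`.
      unique-attachment : ∀ {u v} → InCore ℓ u → InCore ℓ v → Edge G w (f u) → Edge G w (f v) → u ≡ v
      unique-attachment {u} {v} p q wu wv with u ≟V v
      ... | yes eq = eq
      ... | no u≢v = ⊥-elim (one-neighbour (unlabelled-off-cycle w∉) (λ eq → u≢v (f-injective p q eq)) wu wv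
              (to-base u p ⟫ reverse-walk (to-base v q)))

      module _ {c : Fin M} {h : Fin (n G)} (attached : InCore ℓ (target (hair c h (ℓ c h))))
        (edge : Edge G w (f (target (hair c h (ℓ c h))))) (first : ℓ c h ≡ 0 → h ≡ w) where

        new : V
        new = hair c h (ℓ c h)

        ℓ⁺ : Lengths
        ℓ⁺ = upd ℓ c h (suc (ℓ c h))

        new∉ : ¬ InCore ℓ new
        new∉ = <-irrefl refl

        core⁺ : ∀ {v} → InCore ℓ⁺ v → v ≡ new ⊎ InCore ℓ v
        core⁺ {cyc _} _ = inj₂ tt
        core⁺ {hair c′ h′ d} p with c′ ≟ᶠ c | h′ ≟ᶠ h
        ... | yes _ | no _ = inj₂ p
        ... | no _ | _ = inj₂ p
        ... | yes refl | yes refl with d ≟ℕ ℓ c h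
        ...   | yes refl = inj₁ refl
        ...   | no d≢ = inj₂ (≤∧≢⇒< (≤-pred p) d≢)

        new∈⁺ : InCore ℓ⁺ new
        new∈⁺ = subst (ℓ c h <_) (sym (upd-at ℓ c h (suc (ℓ c h)))) (n<1+n (ℓ c h))

        old∈⁺ : ∀ {v} → InCore ℓ v → InCore ℓ⁺ v
        old∈⁺ {cyc _} _ = tt
        old∈⁺ {hair c′ h′ d} p with c′ ≟ᶠ c | h′ ≟ᶠ h
        ... | yes _ | no _ = p
        ... | no _ | _ = p
        ... | yes refl | yes refl = m<n⇒m<1+n p

        f⁺ : V → Fin (n G)
        f⁺ v = if does (v ≟V new) then w else f v

        f⁺-new : f⁺ new ≡ w
        f⁺-new rewrite dec-true (new ≟V new) refl = refl

        f⁺-≢ : ∀ {v} → v ≢ new → f⁺ v ≡ f v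
        f⁺-≢ {v} ne rewrite dec-false (v ≟V new) ne = refl

        f⁺-old : ∀ {v} → InCore ℓ v → f⁺ v ≡ f v
        f⁺-old p = f⁺-≢ (λ { refl → new∉ p })

        e⁺ : Fin (n G) → Maybe V
        e⁺ x = if does (x ≟ᶠ w) then just new else e x

        e⁺-new : e⁺ w ≡ just new
        e⁺-new rewrite dec-true (w ≟ᶠ w) refl = refl

        e⁺-old : ∀ {x} → x ≢ w → e⁺ x ≡ e x
        e⁺-old {x} ne rewrite dec-false (x ≟ᶠ w) ne = refl

        adj-new : ∀ {v} → InCore ℓ v → adj G w (f v) ≡ adjV new v
        adj-new {v} p with v ≟V target new
        ... | yes refl = edge
        ... | no v≢ = trans (≢true⇒≡false (λ t → v≢ (unique-attachment p attached t edge)))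
                (sym (dec-false (new ≟V target v) (not-child v p)))
          where
          not-child : ∀ v → InCore ℓ v → new ≢ target v
          not-child (cyc _) p ()
          not-child (hair _ _ zero) p ()
          not-child (hair c′ h′ (suc d)) p eq with eq
          ... | refl = <-irrefl refl (≤-trans (n≤1+n (suc d)) p)

        extend : Labelling
        extend = record
          { ℓ = ℓ⁺ ; e = e⁺ ; f = f⁺
          ; f-cyc = λ i → trans (f⁺-≢ (λ ())) (f-cyc i)
          ; e-f = e-f⁺ ; f-e = f-e⁺ ; f-adj = f-adj⁺ ; f-first = f-first⁺ }
          where
          e-f⁺ : ∀ {v} → InCore ℓ⁺ v → e⁺ (f⁺ v) ≡ just v
          e-f⁺ {v} p with core⁺ {v} p
          ... | inj₁ refl = trans (cong e⁺ f⁺-new) e⁺-new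
          ... | inj₂ q = trans (cong e⁺ (f⁺-old q)) (trans (e⁺-old (f≢w q)) (e-f q))
          f-e⁺ : ∀ {x v} → e⁺ x ≡ just v → f⁺ v ≡ x × InCore ℓ⁺ v
          f-e⁺ {x} {v} eq with x ≟ᶠ w
          f-e⁺ {x} refl | yes refl = f⁺-new , new∈⁺
          f-e⁺ {x} {v} eq | no x≢w with f-e eq
          ... | fv , p = trans (f⁺-old p) fv , old∈⁺ {v} p
          f-adj⁺ : ∀ {u v} → InCore ℓ⁺ u → InCore ℓ⁺ v → adj G (f⁺ u) (f⁺ v) ≡ adjV u v
          f-adj⁺ {u} {v} p q with core⁺ {u} p | core⁺ {v} q
          ... | inj₁ refl | inj₁ refl rewrite f⁺-new = trans (proj₂ simple w) (sym (adjV-irrefl new))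
          ... | inj₁ refl | inj₂ q′ rewrite f⁺-new | f⁺-old q′ = adj-new q′
          ... | inj₂ p′ | inj₁ refl rewrite f⁺-new | f⁺-old p′ = trans (proj₁ simple (f u) w) (trans (adj-new p′) (adjV-sym new u))
          ... | inj₂ p′ | inj₂ q′ rewrite f⁺-old p′ | f⁺-old q′ = f-adj p′ q′
          f-first⁺ : ∀ {c′ h′} → 0 < ℓ⁺ c′ h′ → f⁺ (hair c′ h′ 0) ≡ h′
          f-first⁺ {c′} {h′} p with core⁺ {hair c′ h′ 0} p
          ... | inj₂ q = trans (f⁺-old {hair c′ h′ 0} q) (f-first q)
          ... | inj₁ eq = at-new eq
            where
            h-eq : ∀ {c′ h′ d c h d′} → hair c′ h′ d ≡ hair c h d′ → h′ ≡ h
            h-eq refl = refl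
            d-eq : ∀ {c′ h′ d c h d′} → hair c′ h′ d ≡ hair c h d′ → d ≡ d′
            d-eq refl = refl
            at-new : ∀ {c′ h′} → hair c′ h′ 0 ≡ new → f⁺ (hair c′ h′ 0) ≡ h′
            at-new eq = trans (trans (cong f⁺ eq) f⁺-new) (sym (trans (h-eq eq) (first (sym (d-eq eq)))))

        shrink : ∀ {us} → (∀ x → e x ≡ nothing → x ∈ us) →
          ∃ λ us′ → length us ≡ suc (length us′) × (∀ x → e⁺ x ≡ nothing → x ∈ us′)
        shrink {us} cov with ∈⇒↭∷ (cov w w∉)
        ... | us′ , π = us′ , ↭-length π , cov′
          where
          cov′ : ∀ x → e⁺ x ≡ nothing → x ∈ us′
          cov′ x eq with x ≟ᶠ w
          cov′ x () | yes _
          cov′ x eq | no x≢w with ∈-resp-↭ π (cov x eq)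
          ... | here refl = ⊥-elim (x≢w refl)
          ... | there m = m

    boundary : ∀ {x y} → Reach G x y → (∃ λ v → e x ≡ just v) → e y ≡ nothing →
      ∃ λ x′ → ∃ λ y′ → Edge G x′ y′ × (∃ λ v → e x′ ≡ just v) × e y′ ≡ nothing
    boundary here (v , ex) ey with trans (sym ex) ey
    ... | ()
    boundary (step {i} {j} ij p) ex ey with e j in ej
    ... | nothing = i , j , ij , ex , ej
    ... | just v = boundary p (v , ej) ey

    -- Parent and child already exhaust the degree bound for vertices off the cycle, so `w` can only
    -- follow the tip.
    end-of-hair : ∀ {w c h d} → InCore ℓ (hair c h d) → e w ≡ nothing → Edge G (f (hair c h d)) w → ℓ c h ≡ suc d
    end-of-hair {w} {c} {h} {d} p w∉ edge with suc d <?ℕ ℓ c h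
    ... | no ¬lt = ≤-antisym (≮⇒≥ ¬lt) p
    ... | yes lt = ⊥-elim (three-neighbours (proj₂ hairball (f (hair c h d)) off)
            (trans (f-adj p pt) (adjV-target (hair c h d)))
            (trans (f-adj p lt) (trans (adjV-sym (hair c h d) (hair c h (suc d))) (adjV-target (hair c h (suc d))))) edge
            (λ eq → target²≢id (hair c h (suc d)) (f-injective pt lt eq)) (f≢w w∉ pt) (f≢w w∉ {hair c h (suc d)} lt))
      where
      pt : InCore ℓ (target (hair c h d))
      pt = InCore-target (hair c h d) p
      off : ¬ OnCycle C (f (hair c h d))
      off on with on-cycle-label (e-f p) on
      ... | _ , ()

  Complete : Labelling → Set
  Complete L = ∀ x → ∃ λ v → Labelling.e L x ≡ just v

  connected : Connected G
  connected = proj₁ (proj₂ (proj₁ hairball))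

  Covers : Labelling → List (Fin (n G)) → Set
  Covers L us = ∀ x → Labelling.e L x ≡ nothing → x ∈ us

  -- The shrinking list of candidates for unlabelled vertices makes `grow` terminate.
  Enlarged : Labelling → Set
  Enlarged L = ∃ λ L⁺ → ∀ {us} → Covers L us → ∃ λ us′ → length us ≡ suc (length us′) × Covers L⁺ us′

  enlarge : ∀ L {v w} → InCore (Labelling.ℓ L) v → Labelling.e L w ≡ nothing → Edge G (Labelling.f L v) w → Enlarged L
  enlarge L {cyc c} {w} p w∉ vw =
    extend L w∉ {c} {w} attached edge (λ _ → refl) , shrink L w∉ {c} {w} attached edge (λ _ → refl)
    where
    open Labelling L
    -- A hair in slot `w` would begin with the vertex `w`, which is unlabelled.
    unused : ℓ c w ≡ 0
    unused with ℓ c w in eq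
    ... | zero = refl
    ... | suc d = ⊥-elim (f≢w L w∉ {hair c w 0} pos (f-first pos))
      where
      pos : 0 < ℓ c w
      pos = subst (0 <_) (sym eq) (s≤s z≤n)
    target-eq : target (hair c w (ℓ c w)) ≡ cyc c
    target-eq rewrite unused = refl
    attached : InCore ℓ (target (hair c w (ℓ c w)))
    attached = subst (InCore ℓ) (sym target-eq) tt
    edge : Edge G w (f (target (hair c w (ℓ c w))))
    edge = subst (λ z → Edge G w (f z)) (sym target-eq) (edge-sym vw)
  enlarge L {hair c h d} {w} p w∉ vw = extend L w∉ {c} {h} attached edge first , shrink L w∉ {c} {h} attached edge first
    where
    open Labelling L
    end : ℓ c h ≡ suc d
    end = end-of-hair L p w∉ vw
    target-eq : target (hair c h (ℓ c h)) ≡ hair c h d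
    target-eq rewrite end = refl
    attached : InCore ℓ (target (hair c h (ℓ c h)))
    attached = subst (InCore ℓ) (sym target-eq) p
    edge : Edge G w (f (target (hair c h (ℓ c h))))
    edge = subst (λ z → Edge G w (f z)) (sym target-eq) (edge-sym vw)
    first : ℓ c h ≡ 0 → h ≡ w
    first eq with trans (sym eq) end
    ... | ()

  complete-or-enlarged : ∀ L → Complete L ⊎ Enlarged L
  complete-or-enlarged L with anyFin? (λ x → nothing? (e x))
    where
    open Labelling L
    nothing? : ∀ (m : Maybe V) → Dec (m ≡ nothing)
    nothing? nothing = yes refl
    nothing? (just _) = no λ ()
  ... | no none = inj₁ found
    where
    found : Complete L
    found x with Labelling.e L x in eq
    ... | just v = v , refl
    ... | nothing = ⊥-elim (none (x , eq))
  ... | yes (y , ey) with boundary L (connected (Labelling.f L (cyc zero)) y) (cyc zero , Labelling.e-f L tt) ey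
  ... | x , w , xw , (v , ex) , w∉ with Labelling.f-e L ex
  ... | refl , p = inj₂ (enlarge L p w∉ xw)

  grow : ∀ k L us → length us ≤ k → Covers L us → Σ Labelling Complete
  grow k L us le cov with complete-or-enlarged L
  ... | inj₁ done = L , done
  ... | inj₂ (L⁺ , shrunk) with shrunk cov
  ... | us′ , eq , cov′ with subst (_≤ k) eq le
  grow (suc k) L us le cov | inj₂ (L⁺ , _) | us′ , _ , cov′ | s≤s le′ = grow k L⁺ us′ le′ cov′

  labelling : Σ Labelling Complete
  labelling = grow (length (allFin (n G))) start (allFin (n G)) ≤-refl (λ x _ → ∈-allFin x)

-- Symmetries of labelled cores and the two-path shape

odd-2* : ∀ k → odd (2 * k) ≡ false
odd-2* k = trans (cong (λ z → odd (k + z)) (+-identityʳ k)) (trans (odd-+ k k) (xor-same (odd k)))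

Even⇒odd : ∀ {m} → Even m → odd m ≡ false
Even⇒odd (k , refl) = odd-2* k

Odd⇒odd : ∀ {m} → Odd m → odd m ≡ true
Odd⇒odd (k , refl) = cong not (odd-2* k)

module Embeddings (r K : ℕ) where
  open Ambient r K
  open Shapes r K

  record Emb (ℓ : Lengths) (G : Graph) : Set where
    field
      e : Fin (n G) → V
      e-inj : ∀ {x y} → e x ≡ e y → x ≡ y
      e-core : ∀ x → InCore ℓ (e x)
      e-onto : ∀ {v} → InCore ℓ v → ∃ λ x → e x ≡ v
      e-adj : ∀ x y → adj G x y ≡ adjV (e x) (e y)

  module _ {ℓ : Lengths} {G : Graph} (emb : Emb ℓ G) where
    open Emb emb

    e⁻¹ : ∀ {v} → InCore ℓ v → Fin (n G)
    e⁻¹ p = proj₁ (e-onto p)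

    e-e⁻¹ : ∀ {v} (p : InCore ℓ v) → e (e⁻¹ p) ≡ v
    e-e⁻¹ p = proj₂ (e-onto p)

    emb-core : IsCore ℓ (tabulate e)
    emb-core = record
      { unique = tabulate⁺ e-inj
      ; sound = λ {v} m → member m
      ; complete = λ p → subst (_∈ tabulate e) (e-e⁻¹ p) (∈-tabulate⁺ (e⁻¹ p)) }
      where
      member : ∀ {v} → v ∈ tabulate e → InCore ℓ v
      member m with ∈-tabulate⁻ m
      ... | x , refl = e-core x

    module _ (M-odd : odd M ≡ true) where
      open Game r K M-odd

      emb-parity : odd (n G) ≡ N ℓ
      emb-parity = trans (cong odd (sym (length-tabulate e))) (length-core M-odd emb-core)

      emb-value : ∀ {φ} → Φ ℓ φ → nimValue G ≡ ⟦ φ ⟧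
      emb-value {φ} p = nimValue-Inv Inv-closed (_ , mkPos base (hairball emb-core (λ _ _ → refl) p) refl , cong ⟦_⟧ (⊕-identityʳ φ))
        (record { e = e ; e-inj = e-inj ; e-list = ↭-refl ; e-adj = e-adj })
        where
        base : Base (tabulate e) adjV (tabulate e) []
        base = record
          { perm = ↭-reflexive (sym (++-identityʳ (tabulate e)))
          ; uniq = subst Unique (sym (++-identityʳ (tabulate e))) (tabulate⁺ e-inj)
          ; a-sym = adjV-sym ; a-irr = adjV-irrefl ; cross = λ _ () ; col = λ _ → false ; bip = λ () }

  emb-iso : ∀ {ℓ G H} → Iso G H → Emb ℓ H → Emb ℓ G
  emb-iso {ℓ} (i , adj≡) emb = record
    { e = λ x → e (Inverse.to i x)
    ; e-inj = λ eq → trans (sym (Inverse.strictlyInverseʳ i _)) (trans (cong (Inverse.from i) (e-inj eq)) (Inverse.strictlyInverseʳ i _))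
    ; e-core = λ x → e-core (Inverse.to i x)
    ; e-onto = λ p → Inverse.from i (e⁻¹ emb p) , trans (cong e (Inverse.strictlyInverseˡ i _)) (e-e⁻¹ emb p)
    ; e-adj = λ x y → trans (adj≡ x y) (e-adj _ _) }
    where open Emb emb

  -- Lengths determine the graph, so recognising a shape reduces to comparing lengths.
  iso-emb : ∀ {ℓ G H} → Emb ℓ G → Emb ℓ H → Iso G H
  iso-emb {ℓ} {G} {H} emb emb′ = mk↔ₛ′ to from to-from from-to , λ x y →
    trans (Emb.e-adj emb x y) (sym (trans (Emb.e-adj emb′ (to x) (to y)) (cong₂ adjV (e-e⁻¹ emb′ (Emb.e-core emb x)) (e-e⁻¹ emb′ (Emb.e-core emb y)))))
    where
    to : Fin (n G) → Fin (n H)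
    to x = e⁻¹ emb′ (Emb.e-core emb x)
    from : Fin (n H) → Fin (n G)
    from y = e⁻¹ emb (Emb.e-core emb′ y)
    to-from : ∀ y → to (from y) ≡ y
    to-from y = Emb.e-inj emb′ (trans (e-e⁻¹ emb′ (Emb.e-core emb (from y))) (e-e⁻¹ emb (Emb.e-core emb′ y)))
    from-to : ∀ x → from (to x) ≡ x
    from-to x = Emb.e-inj emb (trans (e-e⁻¹ emb (Emb.e-core emb′ (to x))) (e-e⁻¹ emb′ (Emb.e-core emb x)))

  -- Adjacency is built from `target` alone, so an injection commuting with it preserves and
  -- reflects edges.
  adjV-map : ∀ (ρ : V → V) → (∀ {u v} → ρ u ≡ ρ v → u ≡ v) → (∀ u → ρ (target u) ≡ target (ρ u)) → ∀ u v → adjV (ρ u) (ρ v) ≡ adjV u v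
  adjV-map ρ ρ-inj ρ-target u v = cong₂ _∨_ (arc≡ u v) (arc≡ v u)
    where
    arc≡ : ∀ u v → arc (ρ u) (ρ v) ≡ arc u v
    arc≡ u v = does-⇔ (mk⇔ (λ eq → ρ-inj (trans eq (sym (ρ-target u)))) (λ eq → trans (cong ρ eq) (ρ-target u)))
      (ρ v ≟V target (ρ u)) (v ≟V target u)

  rotate : V → V
  rotate (cyc i) = cyc (cpred i)
  rotate (hair c h d) = hair (cpred c) h d

  rotate⁻¹ : V → V
  rotate⁻¹ (cyc i) = cyc (csucc i)
  rotate⁻¹ (hair c h d) = hair (csucc c) h d

  rotate-rotate⁻¹ : ∀ v → rotate (rotate⁻¹ v) ≡ v
  rotate-rotate⁻¹ (cyc i) = cong cyc (cpred-csucc i)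
  rotate-rotate⁻¹ (hair c h d) = cong (λ z → hair z h d) (cpred-csucc c)

  rotate⁻¹-rotate : ∀ v → rotate⁻¹ (rotate v) ≡ v
  rotate⁻¹-rotate (cyc i) = cong cyc (csucc-cpred i)
  rotate⁻¹-rotate (hair c h d) = cong (λ z → hair z h d) (csucc-cpred c)

  rotate-injective : ∀ {u v} → rotate u ≡ rotate v → u ≡ v
  rotate-injective {u} {v} eq = trans (sym (rotate⁻¹-rotate u)) (trans (cong rotate⁻¹ eq) (rotate⁻¹-rotate v))

  rotate-target : ∀ u → rotate (target u) ≡ target (rotate u)
  rotate-target (cyc i) = cong cyc (trans (cpred-csucc i) (sym (csucc-cpred i)))
  rotate-target (hair c h zero) = refl
  rotate-target (hair c h (suc d)) = refl

  rotated : Lengths → Lengths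
  rotated ℓ c = ℓ (csucc c)

  emb-rotate : ∀ {ℓ G} → Emb ℓ G → Emb (rotated ℓ) G
  emb-rotate {ℓ} emb = record
    { e = λ x → rotate (e x)
    ; e-inj = λ eq → e-inj (rotate-injective eq)
    ; e-core = λ x → into (e x) (e-core x)
    ; e-onto = λ {v} p → e⁻¹ emb (back v p) , trans (cong rotate (e-e⁻¹ emb (back v p))) (rotate-rotate⁻¹ v)
    ; e-adj = λ x y → trans (e-adj x y) (sym (adjV-map rotate rotate-injective rotate-target (e x) (e y))) }
    where
    open Emb emb
    into : ∀ v → InCore ℓ v → InCore (rotated ℓ) (rotate v)
    into (cyc _) _ = tt
    into (hair c h d) p = subst (λ z → d < ℓ z h) (sym (csucc-cpred c)) p
    back : ∀ v → InCore (rotated ℓ) v → InCore ℓ (rotate⁻¹ v)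
    back (cyc _) _ = tt
    back (hair c h d) p = p

  DistinctHairs : Lengths → Set
  DistinctHairs ℓ = ∀ c w w′ → 0 < ℓ c w → ℓ c w ≡ ℓ c w′ → w ≡ w′

  -- With distinct lengths exactly one slot is counted, so no cancellation modulo 2 takes place.
  hair⇒S : ∀ {ℓ c w n} → DistinctHairs ℓ → ℓ c w ≡ suc n → S ℓ c n ≡ true
  hair⇒S {ℓ} {c} {w} {n} dist eq = trans (⨁-cong (allFin K) (λ {w′} _ → ⇔→≡ (mk⇔ (to w′) (from w′)))) (⨁-δ∈ _≟ᶠ_ (allFin⁺ K) (∈-allFin w))
    where
    to : ∀ w′ → (ℓ c w′ ≡ᵇ suc n) ≡ true → does (w′ ≟ᶠ w) ≡ true
    to w′ h = dec-true (w′ ≟ᶠ w) (sym (dist c w w′ (subst (0 <_) (sym eq) (s≤s z≤n)) (trans eq (sym (≡ᵇ⇒≡ (ℓ c w′) (suc n) (≡true⇒T h))))))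
    from : ∀ w′ → does (w′ ≟ᶠ w) ≡ true → (ℓ c w′ ≡ᵇ suc n) ≡ true
    from w′ h with does-true {p? = w′ ≟ᶠ w} h
    ... | refl = T⇒≡true (≡⇒≡ᵇ (ℓ c w) (suc n) eq)

  module Swap (c : Fin M) (w w′ : Fin K) where

    swapIdx : Fin K → Fin K
    swapIdx h with h ≟ᶠ w | h ≟ᶠ w′
    ... | yes _ | _ = w′
    ... | no _ | yes _ = w
    ... | no _ | no _ = h

    swapIdx-w : swapIdx w ≡ w′
    swapIdx-w with w ≟ᶠ w
    ... | yes _ = refl
    ... | no ¬p = ⊥-elim (¬p refl)

    swapIdx-w′ : swapIdx w′ ≡ w
    swapIdx-w′ with w′ ≟ᶠ w | w′ ≟ᶠ w′
    ... | yes p | _ = p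
    ... | no _ | yes _ = refl
    ... | no _ | no ¬p = ⊥-elim (¬p refl)

    swapIdx-involutive : ∀ h → swapIdx (swapIdx h) ≡ h
    swapIdx-involutive h with h ≟ᶠ w | h ≟ᶠ w′
    ... | yes refl | _ = swapIdx-w′
    ... | no _ | yes refl = swapIdx-w
    ... | no h≢w | no h≢w′ with h ≟ᶠ w | h ≟ᶠ w′
    ...   | yes p | _ = ⊥-elim (h≢w p)
    ...   | no _ | yes p = ⊥-elim (h≢w′ p)
    ...   | no _ | no _ = refl

    swapAt : Fin M → Fin K → Fin K
    swapAt c′ h = if does (c′ ≟ᶠ c) then swapIdx h else h

    swapAt-involutive : ∀ c′ h → swapAt c′ (swapAt c′ h) ≡ h
    swapAt-involutive c′ h with c′ ≟ᶠ c
    ... | yes _ = swapIdx-involutive h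
    ... | no _ = refl

    swapV : V → V
    swapV (cyc i) = cyc i
    swapV (hair c′ h d) = hair c′ (swapAt c′ h) d

    swapV-involutive : ∀ v → swapV (swapV v) ≡ v
    swapV-involutive (cyc i) = refl
    swapV-involutive (hair c′ h d) = cong (λ z → hair c′ z d) (swapAt-involutive c′ h)

    swapV-injective : ∀ {u v} → swapV u ≡ swapV v → u ≡ v
    swapV-injective {u} {v} eq = trans (sym (swapV-involutive u)) (trans (cong swapV eq) (swapV-involutive v))

    swapV-target : ∀ u → swapV (target u) ≡ target (swapV u)
    swapV-target (cyc i) = refl
    swapV-target (hair c′ h zero) = refl
    swapV-target (hair c′ h (suc d)) = refl

    swapV-core : ∀ {ℓ} → ℓ c w ≡ ℓ c w′ → ∀ v → InCore ℓ v → InCore ℓ (swapV v)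
    swapV-core {ℓ} eq (cyc _) _ = tt
    swapV-core {ℓ} eq (hair c′ h d) p with c′ ≟ᶠ c
    ... | no _ = p
    ... | yes refl with h ≟ᶠ w | h ≟ᶠ w′
    ...   | yes refl | _ = subst (d <_) eq p
    ...   | no _ | yes refl = subst (d <_) (sym eq) p
    ...   | no _ | no _ = p

    -- The swap keeps depths, whereas adjacent vertices on hairs have different depths; thus no edge
    -- is reversed.
    swapV-non-adjacent : ∀ u → adjV u (swapV u) ≢ true
    swapV-non-adjacent (cyc i) h = true≢false h (adjV-irrefl (cyc i))
    swapV-non-adjacent (hair c′ h zero) t with adjV⇒ (hair c′ h zero) (hair c′ (swapAt c′ h) zero) t
    ... | inj₁ ()
    ... | inj₂ ()
    swapV-non-adjacent (hair c′ h (suc d)) t with adjV⇒ (hair c′ h (suc d)) (hair c′ (swapAt c′ h) (suc d)) t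
    ... | inj₁ ()
    ... | inj₂ ()

    swap-hairs : ∀ {ℓ G} → Emb ℓ G → w ≢ w′ → 0 < ℓ c w → ℓ c w ≡ ℓ c w′ → Σ (Involution G) Reducing
    swap-hairs {ℓ} {G} emb w≢w′ pos eq = record { τ = τ′ ; invol = τ-invol ; auto = τ-auto } , (x₀ , moved) , unflipped
      where
      open Emb emb
      p : ∀ x → InCore ℓ (swapV (e x))
      p x = swapV-core eq (e x) (e-core x)
      τ′ : Fin (n G) → Fin (n G)
      τ′ x = e⁻¹ emb (p x)
      e-τ : ∀ x → e (τ′ x) ≡ swapV (e x)
      e-τ x = e-e⁻¹ emb (p x)
      τ-invol : ∀ x → τ′ (τ′ x) ≡ x
      τ-invol x = e-inj (trans (e-τ (τ′ x)) (trans (cong swapV (e-τ x)) (swapV-involutive (e x))))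
      τ-auto : ∀ x y → adj G x y ≡ adj G (τ′ x) (τ′ y)
      τ-auto x y = trans (e-adj x y) (sym (trans (e-adj (τ′ x) (τ′ y)) (trans (cong₂ adjV (e-τ x) (e-τ y))
        (adjV-map swapV swapV-injective swapV-target (e x) (e y)))))
      x₀ : Fin (n G)
      x₀ = e⁻¹ emb {hair c w 0} pos
      e-x₀ : e x₀ ≡ hair c w 0
      e-x₀ = e-e⁻¹ emb {hair c w 0} pos
      moved : τ′ x₀ ≢ x₀
      moved h = w≢w′ (trans (sym (index (trans (sym (cong swapV e-x₀)) (trans (sym (e-τ x₀)) (trans (cong e h) e-x₀))))) swapAt-w)
        where
        index : ∀ {h h′} → hair c h 0 ≡ hair c h′ 0 → h ≡ h′
        index refl = refl
        swapAt-w : swapAt c w ≡ w′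
        swapAt-w rewrite dec-true (c ≟ᶠ c) refl = swapIdx-w
      unflipped : ∀ x y → Edge G x y → ¬ (τ′ x ≡ y × τ′ y ≡ x)
      unflipped x y xy (τx , _) = swapV-non-adjacent (e x)
        (trans (cong (adjV (e x)) (trans (sym (e-τ x)) (cong e τx))) (trans (sym (e-adj x y)) xy))

  simplest⇒distinct : ∀ {ℓ G} → Emb ℓ G → SimplestForm G → DistinctHairs ℓ
  simplest⇒distinct emb simplest c w w′ pos eq with w ≟ᶠ w′
  ... | yes p = p
  ... | no w≢w′ = ⊥-elim (simplest (Swap.swap-hairs c w w′ emb w≢w′ pos eq))

  -- `shape` attaches its paths at vertex 0, and every rotation lowers the index of `A` by one.
  rotate-to-zero : ∀ {ℓ G} t A k → toℕ A ≡ t → Emb ℓ G → DistinctHairs ℓ → (∀ c n → S ℓ c n ≡ twoHairs A k c n) →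
    ∃ λ ℓ′ → Emb ℓ′ G × DistinctHairs ℓ′ × (∀ c n → S ℓ′ c n ≡ twoHairs zero k c n)
  rotate-to-zero {ℓ} t zero k eq emb dist h = ℓ , emb , dist , h
  rotate-to-zero {ℓ} (suc t) (suc A) k eq emb dist h = rotate-to-zero {rotated ℓ} t (inject₁ A) k (trans (toℕ-inject₁ A) (suc-injective eq))
    (emb-rotate emb) (λ c → dist (csucc c)) (λ c n → trans (h (csucc c) n) (cong (_∧ ((n ≡ᵇ k) xor (suc n ≡ᵇ k)))
      (does-⇔ (mk⇔ (λ p → trans (sym (cpred-csucc c)) (cong cpred p)) (λ { refl → csucc-cpred (suc A) })) (csucc c ≟ᶠ suc A) (c ≟ᶠ inject₁ A))))

-- `shape` numbers a path consecutively from `s`; the predecessor of its first vertex is the cycle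
-- vertex 0.
parent : ℕ → ℕ → ℕ
parent s zero = 0
parent s (suc d) = s + d

hairEdges : ℕ → ℕ → List (ℕ × ℕ)
hairEdges s zero = []
hairEdges s (suc k) = (0 , s) ∷ map (λ i → (s + i , s + suc i)) (upTo k)

∈-hairEdges⁺ : ∀ s {k d} → d < k → (parent s d , s + d) ∈ hairEdges s k
∈-hairEdges⁺ s {suc k} {zero} _ = here (cong (0 ,_) (+-identityʳ s))
∈-hairEdges⁺ s {suc k} {suc d} (s≤s lt) = there (∈-map⁺ (λ i → (s + i , s + suc i)) (∈-upTo⁺ lt))

∈-hairEdges⁻ : ∀ s k {p} → p ∈ hairEdges s k → ∃ λ d → d < k × p ≡ (parent s d , s + d)
∈-hairEdges⁻ s (suc k) (here refl) = 0 , s≤s z≤n , cong (0 ,_) (sym (+-identityʳ s))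
∈-hairEdges⁻ s (suc k) (there m) with ∈-map⁻ (λ i → (s + i , s + suc i)) m
... | i , i∈ , refl = suc i , s≤s (∈-upTo⁻ i∈) , refl

cycleEdges : ℕ → List (ℕ × ℕ)
cycleEdges l = (l , 0) ∷ map (λ i → (i , suc i)) (upTo l)

shapeEdges-≡ : ∀ l k → shapeEdges (suc l) k ≡ cycleEdges l ++ hairEdges (suc l) k ++ hairEdges (suc l + k) (suc k)
shapeEdges-≡ l zero = refl
shapeEdges-≡ l (suc k) = refl

∈-cycleEdges⁺ : ∀ {l} (j : Fin (suc l)) → (toℕ (cpred j) , toℕ j) ∈ cycleEdges l
∈-cycleEdges⁺ {l} zero = here (cong (_, 0) (toℕ-fromℕ l))
∈-cycleEdges⁺ {l} (suc j) = there (subst (λ z → (z , suc (toℕ j)) ∈ _) (sym (toℕ-inject₁ j)) (∈-map⁺ (λ i → (i , suc i)) (∈-upTo⁺ (toℕ<n j))))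

∈-cycleEdges⁻ : ∀ l {p} → p ∈ cycleEdges l → ∃ λ (j : Fin (suc l)) → p ≡ (toℕ (cpred j) , toℕ j)
∈-cycleEdges⁻ l (here refl) = zero , cong (_, 0) (sym (toℕ-fromℕ l))
∈-cycleEdges⁻ l (there m) with ∈-map⁻ (λ i → (i , suc i)) m
... | i , i∈ , refl = suc (fromℕ< (∈-upTo⁻ i∈)) , cong₂ _,_
  (sym (trans (toℕ-inject₁ (fromℕ< (∈-upTo⁻ i∈))) (toℕ-fromℕ< (∈-upTo⁻ i∈)))) (cong suc (sym (toℕ-fromℕ< (∈-upTo⁻ i∈))))

graphFromEdges⁺ : ∀ {N es} i j → ((toℕ i , toℕ j) ∈ es ⊎ (toℕ j , toℕ i) ∈ es) → adj (graphFromEdges N es) i j ≡ true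
graphFromEdges⁺ {N} {es} i j m = T⇒≡true (any⁺ _ ([ (λ p → lose p (Equivalence.from T-∨ (inj₁ (both i j)))) , (λ p → lose p (Equivalence.from (T-∨ {(toℕ i ≡ᵇ toℕ j) ∧ (toℕ j ≡ᵇ toℕ i)}) (inj₂ (both i j)))) ]′ m))
  where
  both : ∀ (i j : Fin N) → T ((toℕ i ≡ᵇ toℕ i) ∧ (toℕ j ≡ᵇ toℕ j))
  both i j = Equivalence.from T-∧ (≡⇒≡ᵇ (toℕ i) (toℕ i) refl , ≡⇒≡ᵇ (toℕ j) (toℕ j) refl)

graphFromEdges⁻ : ∀ {N es} i j → adj (graphFromEdges N es) i j ≡ true → (toℕ i , toℕ j) ∈ es ⊎ (toℕ j , toℕ i) ∈ es
graphFromEdges⁻ {N} {es} i j h with find (any⁻ _ es (≡true⇒T h))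
... | (a , b) , p∈ , t with Equivalence.to (T-∨ {(toℕ i ≡ᵇ a) ∧ (toℕ j ≡ᵇ b)}) t
...   | inj₁ t′ with Equivalence.to (T-∧ {toℕ i ≡ᵇ a}) t′
...     | p , q with ≡ᵇ⇒≡ (toℕ i) a p | ≡ᵇ⇒≡ (toℕ j) b q
...       | refl | refl = inj₁ p∈
graphFromEdges⁻ {N} {es} i j h | (a , b) , p∈ , t | inj₂ t′ with Equivalence.to (T-∧ {toℕ i ≡ᵇ b}) t′
...     | p , q with ≡ᵇ⇒≡ (toℕ i) b p | ≡ᵇ⇒≡ (toℕ j) a q
...       | refl | refl = inj₂ p∈

-- For `k` equal to 0 there is no second path and `w₂` is an arbitrary slot, possibly `w₁`; hence
-- the guards `0 < k`.
module ShapeEmbedding {r K : ℕ} {k : ℕ} {ℓ : Ambient.Lengths r K} {w₁ w₂ : Fin K}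
  (ℓw₁ : ℓ zero w₁ ≡ suc k) (ℓw₂ : 0 < k → ℓ zero w₂ ≡ k)
  (only : ∀ c w → 0 < ℓ c w → c ≡ zero × (w ≡ w₁ ⊎ (w ≡ w₂ × 0 < k))) where
  open Ambient r K
  open Embeddings r K

  -- The number that Defs.shape gives to a vertex of the core.
  idx : V → ℕ
  idx (cyc i) = toℕ i
  idx (hair c h d) = if does (h ≟ᶠ w₁) then M + k + d else M + d

  total : ℕ
  total = M + (k + suc k)

  idx-w₁ : ∀ c d → idx (hair c w₁ d) ≡ M + k + d
  idx-w₁ c d rewrite dec-true (w₁ ≟ᶠ w₁) refl = refl

  w₂≢w₁ : 0 < k → w₂ ≢ w₁
  w₂≢w₁ pos refl = <-irrefl (trans (sym (ℓw₂ pos)) ℓw₁) (n<1+n k)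

  idx-w₂ : ∀ c d → 0 < k → idx (hair c w₂ d) ≡ M + d
  idx-w₂ c d pos rewrite dec-false (w₂ ≟ᶠ w₁) (w₂≢w₁ pos) = refl

  data CoreView : V → Set where
    on-cycle : ∀ i → CoreView (cyc i)
    long : ∀ {d} → d < suc k → CoreView (hair zero w₁ d)
    short : ∀ {d} → d < k → 0 < k → CoreView (hair zero w₂ d)

  coreView : ∀ v → InCore ℓ v → CoreView v
  coreView (cyc i) _ = on-cycle i
  coreView (hair c h d) p with only c h (≤-trans (s≤s z≤n) p)
  ... | refl , inj₁ refl = long (subst (d <_) ℓw₁ p)
  ... | refl , inj₂ (refl , pos) = short (subst (d <_) (ℓw₂ pos) p) pos

  viewCore : ∀ {v} → CoreView v → InCore ℓ v
  viewCore (on-cycle i) = tt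
  viewCore {hair _ _ d} (long lt) = subst (d <_) (sym ℓw₁) lt
  viewCore {hair _ _ d} (short lt pos) = subst (d <_) (sym (ℓw₂ pos)) lt

  idx-bound : ∀ {v} → CoreView v → idx v < total
  idx-bound (on-cycle i) = ≤-trans (toℕ<n i) (m≤m+n M (k + suc k))
  idx-bound (long {d} lt) = subst (_< total) (sym (trans (idx-w₁ zero d) (+-assoc M k d))) (+-monoʳ-< M (+-monoʳ-< k lt))
  idx-bound (short {d} lt pos) = subst (_< total) (sym (idx-w₂ zero d pos)) (+-monoʳ-< M (≤-trans lt (m≤m+n k (suc k))))

  idx-injective : ∀ {u v} → CoreView u → CoreView v → idx u ≡ idx v → u ≡ v
  idx-injective (on-cycle i) (on-cycle j) eq = cong cyc (toℕ-injective eq)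
  idx-injective (on-cycle i) (long {d} lt) eq = ⊥-elim (<-irrefl (trans eq (trans (idx-w₁ zero d) (+-assoc M k d))) (≤-trans (toℕ<n i) (m≤m+n M (k + d))))
  idx-injective (on-cycle i) (short {d} lt pos) eq = ⊥-elim (<-irrefl (trans eq (idx-w₂ zero d pos)) (≤-trans (toℕ<n i) (m≤m+n M d)))
  idx-injective (long {d} lt) (on-cycle i) eq = ⊥-elim (<-irrefl (trans (sym eq) (trans (idx-w₁ zero d) (+-assoc M k d))) (≤-trans (toℕ<n i) (m≤m+n M (k + d))))
  idx-injective (short {d} lt pos) (on-cycle i) eq = ⊥-elim (<-irrefl (trans (sym eq) (idx-w₂ zero d pos)) (≤-trans (toℕ<n i) (m≤m+n M d)))
  idx-injective (long {d} _) (long {d′} _) eq =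
    cong (hair zero w₁) (+-cancelˡ-≡ (M + k) d d′ (trans (sym (idx-w₁ zero d)) (trans eq (idx-w₁ zero d′))))
  idx-injective (short {d} _ pos) (short {d′} _ _) eq =
    cong (hair zero w₂) (+-cancelˡ-≡ M d d′ (trans (sym (idx-w₂ zero d pos)) (trans eq (idx-w₂ zero d′ pos))))
  idx-injective (long {d} _) (short {d′} lt pos) eq = ⊥-elim (clash lt
    (trans (sym (trans (idx-w₁ zero d) (+-assoc M k d))) (trans eq (idx-w₂ zero d′ pos))))
    where
    clash : ∀ {d d′} → d′ < k → M + (k + d) ≡ M + d′ → ⊥
    clash {d} {d′} lt eq = <-irrefl (sym (+-cancelˡ-≡ M (k + d) d′ eq)) (≤-trans lt (m≤m+n k d))
  idx-injective (short {d′} lt pos) (long {d} _) eq = ⊥-elim (<-irrefl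
    (+-cancelˡ-≡ M d′ (k + d) (trans (sym (idx-w₂ zero d′ pos)) (trans eq (trans (idx-w₁ zero d) (+-assoc M k d)))))
    (≤-trans lt (m≤m+n k d)))

  place : ∀ t → t < total → ∃ λ v → CoreView v × idx v ≡ t
  place t t< with t <?ℕ M
  ... | yes lt = cyc (fromℕ< lt) , on-cycle _ , toℕ-fromℕ< lt
  ... | no ¬lt with m+[n∸m]≡n (≮⇒≥ ¬lt)
  ...   | eq with (t ∸ M) <?ℕ k
  ...     | yes lt = hair zero w₂ (t ∸ M) , short lt pos , trans (idx-w₂ zero (t ∸ M) pos) eq
    where
    pos : 0 < k
    pos = ≤-trans (s≤s z≤n) lt
  ...     | no ¬lt′ with m+[n∸m]≡n (≮⇒≥ ¬lt′)
  ...       | eq′ = hair zero w₁ (t ∸ M ∸ k) , long rest< , trans (idx-w₁ zero (t ∸ M ∸ k)) (trans (+-assoc M k _) (trans (cong (M +_) eq′) eq))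
    where
    rest< : t ∸ M ∸ k < suc k
    rest< = +-cancelˡ-< k _ _ (+-cancelˡ-< M _ _ (subst (_< total) (trans (sym eq) (cong (M +_) (sym eq′))) t<))

  Joined : V → List (ℕ × ℕ) → Set
  Joined u es = (idx u , idx (target u)) ∈ es ⊎ (idx (target u) , idx u) ∈ es

  allEdges : List (ℕ × ℕ)
  allEdges = cycleEdges (2 + r) ++ hairEdges M k ++ hairEdges (M + k) (suc k)

  target-joined : ∀ {u} → CoreView u → Joined u allEdges
  target-joined (on-cycle i) = inj₁ (∈-++⁺ˡ (subst (λ z → (toℕ z , toℕ (csucc i)) ∈ cycleEdges (2 + r)) (cpred-csucc i) (∈-cycleEdges⁺ (csucc i))))
  target-joined (long {d} lt) = inj₂ (∈-++⁺ʳ (cycleEdges (2 + r)) (∈-++⁺ʳ (hairEdges M k)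
    (subst (_∈ hairEdges (M + k) (suc k)) (cong₂ _,_ (sym (parent-idx d)) (sym (idx-w₁ zero d))) (∈-hairEdges⁺ (M + k) lt))))
    where
    parent-idx : ∀ d → idx (target (hair zero w₁ d)) ≡ parent (M + k) d
    parent-idx zero = refl
    parent-idx (suc d) = idx-w₁ zero d
  target-joined (short {d} lt pos) = inj₂ (∈-++⁺ʳ (cycleEdges (2 + r)) (∈-++⁺ˡ
    (subst (_∈ hairEdges M k) (cong₂ _,_ (sym (parent-idx d)) (sym (idx-w₂ zero d pos))) (∈-hairEdges⁺ M lt))))
    where
    parent-idx : ∀ d → idx (target (hair zero w₂ d)) ≡ parent M d
    parent-idx zero = refl
    parent-idx (suc d) = idx-w₂ zero d pos

  edge-target : ∀ {p} → p ∈ allEdges → ∃ λ u → CoreView u × (p ≡ (idx u , idx (target u)) ⊎ p ≡ (idx (target u) , idx u))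
  edge-target p∈ with ∈-++⁻ (cycleEdges (2 + r)) p∈
  ... | inj₁ m with ∈-cycleEdges⁻ (2 + r) m
  ...   | j , refl = cyc (cpred j) , on-cycle _ , inj₁ (cong (λ z → (toℕ (cpred j) , toℕ z)) (sym (csucc-cpred j)))
  edge-target p∈ | inj₂ m with ∈-++⁻ (hairEdges M k) m
  ... | inj₁ m′ with ∈-hairEdges⁻ M k m′
  ...   | d , lt , refl = hair zero w₂ d , short lt pos , inj₂ (cong₂ _,_ (parent-idx d) (sym (idx-w₂ zero d pos)))
    where
    pos : 0 < k
    pos = ≤-trans (s≤s z≤n) lt
    parent-idx : ∀ d → parent M d ≡ idx (target (hair zero w₂ d))
    parent-idx zero = refl
    parent-idx (suc d) = sym (idx-w₂ zero d pos)
  edge-target p∈ | inj₂ m | inj₂ m′ with ∈-hairEdges⁻ (M + k) (suc k) m′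
  ...   | d , lt , refl = hair zero w₁ d , long lt , inj₂ (cong₂ _,_ (parent-idx d) (sym (idx-w₁ zero d)))
    where
    parent-idx : ∀ d → parent (M + k) d ≡ idx (target (hair zero w₁ d))
    parent-idx zero = refl
    parent-idx (suc d) = sym (idx-w₁ zero d)

  shape-emb : Emb ℓ (shape M k)
  shape-emb = record
    { e = e ; e-inj = λ {x} {y} eq → toℕ-injective (trans (sym (idx-e x)) (trans (cong idx eq) (idx-e y)))
    ; e-core = λ x → viewCore (e-view x)
    ; e-onto = λ {v} p → fromℕ< (idx-bound (coreView v p)) , e-unique (fromℕ< (idx-bound (coreView v p))) (coreView v p) (toℕ-fromℕ< (idx-bound (coreView v p)))
    ; e-adj = λ x y → trans (cong (λ es → adj (graphFromEdges total es) x y) (shapeEdges-≡ (2 + r) k)) (⇔→≡ (mk⇔ (to x y) (from x y))) }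
    where
    e : Fin total → V
    e x = proj₁ (place (toℕ x) (toℕ<n x))
    e-view : ∀ x → CoreView (e x)
    e-view x = proj₁ (proj₂ (place (toℕ x) (toℕ<n x)))
    idx-e : ∀ x → idx (e x) ≡ toℕ x
    idx-e x = proj₂ (proj₂ (place (toℕ x) (toℕ<n x)))
    target-view : ∀ {u} → CoreView u → CoreView (target u)
    target-view {u} p = coreView (target u) (InCore-target u (viewCore p))
    e-unique : ∀ {v} x → CoreView v → toℕ x ≡ idx v → e x ≡ v
    e-unique x p eq = idx-injective (e-view x) p (trans (idx-e x) eq)
    pair-adj : ∀ x y → (toℕ x , toℕ y) ∈ allEdges → adjV (e x) (e y) ≡ true
    pair-adj x y m with edge-target m
    ... | u , p , inj₁ eq = Eq.subst₂ (λ a b → adjV a b ≡ true) (sym (e-unique x p (cong proj₁ eq)))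
            (sym (e-unique y (target-view p) (cong proj₂ eq))) (adjV-target u)
    ... | u , p , inj₂ eq = Eq.subst₂ (λ a b → adjV a b ≡ true) (sym (e-unique x (target-view p) (cong proj₁ eq)))
            (sym (e-unique y p (cong proj₂ eq))) (trans (adjV-sym (target u) u) (adjV-target u))
    to : ∀ x y → adj (graphFromEdges total allEdges) x y ≡ true → adjV (e x) (e y) ≡ true
    to x y h = [ pair-adj x y , (λ m → trans (adjV-sym (e x) (e y)) (pair-adj y x m)) ]′ (graphFromEdges⁻ x y h)
    joined : ∀ x y → e y ≡ target (e x) → (toℕ x , toℕ y) ∈ allEdges ⊎ (toℕ y , toℕ x) ∈ allEdges
    joined x y eq = Eq.subst₂ (λ a b → (a , b) ∈ allEdges ⊎ (b , a) ∈ allEdges) (idx-e x) (trans (cong idx (sym eq)) (idx-e y)) (target-joined (e-view x))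
    from : ∀ x y → adjV (e x) (e y) ≡ true → adj (graphFromEdges total allEdges) x y ≡ true
    from x y h = graphFromEdges⁺ x y ([ joined x y , (λ eq → [ inj₂ , inj₁ ]′ (joined y x eq)) ]′ (adjV⇒ (e x) (e y) h))

-- The cycle length is read off the shape: `m + 2k + 1` is even, so `m` is odd. Two slots per cycle
-- vertex are enough to label it.
two-path-value : ∀ m k → 3 ≤ m → odd (m + (k + suc k)) ≡ false → ∀ {G} → Iso G (shape m k) → nimValue G ≡ 4
two-path-value (suc (suc (suc r))) k (s≤s (s≤s (s≤s z≤n))) even iso = emb-value emb M-odd (twoΦ parity (zero , k , two))
  where
  open Ambient r 2
  open Embeddings r 2
  open Shapes r 2
  M-odd : odd M ≡ true
  M-odd = trans (sym (xor-cancelʳ (odd M) true)) (cong (_xor true) (trans (sym (trans (odd-+ M (k + suc k)) (cong (odd M xor_)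
    (trans (odd-+ k (suc k)) (flip (odd k)))))) even))
    where
    flip : ∀ x → x xor not x ≡ true
    flip false = refl
    flip true = refl
  open Game r 2 M-odd
  ℓ : Lengths
  ℓ zero zero = suc k
  ℓ zero (suc _) = k
  ℓ (suc _) _ = 0
  only : ∀ c w → 0 < ℓ c w → c ≡ zero × (w ≡ zero ⊎ (w ≡ suc zero × 0 < k))
  only zero zero _ = refl , inj₁ refl
  only zero (suc zero) pos = refl , inj₂ (refl , pos)
  emb : Emb ℓ _
  emb = emb-iso iso (ShapeEmbedding.shape-emb {ℓ = ℓ} {zero} {suc zero} refl (λ _ → refl) only)
  parity : N ℓ ≡ false
  parity = trans (sym (emb-parity (ShapeEmbedding.shape-emb {ℓ = ℓ} {zero} {suc zero} refl (λ _ → refl) only) M-odd)) even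
  two : ∀ c n → S ℓ c n ≡ twoHairs zero k c n
  two zero n = trans (cong ((k ≡ᵇ n) xor_) (xor-identityʳ (k ≡ᵇ suc n))) (cong₂ _xor_ (≡ᵇ-comm k n) (≡ᵇ-comm k (suc n)))
  two (suc c) n = refl

module Classification {r K : ℕ} where
  open Ambient r K
  open Embeddings r K
  open Shapes r K

  -- Every hair is visible in `S`, so its length is `k` or `k + 1` and it hangs from `A`;
  -- distinctness then leaves one slot for each length.
  two⇒shape : ∀ {ℓ G} → Emb ℓ G → DistinctHairs ℓ → Two ℓ → IsTwoPathShape G
  two⇒shape {G = G} emb dist (A , k , h) with rotate-to-zero (toℕ A) A k refl emb dist h
  ... | ℓ , emb₀ , dist₀ , h₀ with S-witness ℓ zero k (trans (h₀ zero k) (twoHairs-top zero k))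
  ... | w₁ , ℓw₁ = 3 + r , k , s≤s (s≤s (s≤s z≤n)) , iso (second k h₀)
    where
    Second : ℕ → Set
    Second k = ∃ λ w₂ → 0 < k → ℓ zero w₂ ≡ k
    second : ∀ k → (∀ c n → S ℓ c n ≡ twoHairs zero k c n) → Second k
    second zero _ = w₁ , λ ()
    second (suc k) h with S-witness ℓ zero k (trans (h zero k) (twoHairs-snd zero k))
    ... | w₂ , eq = w₂ , λ _ → eq
    iso : Second k → Iso G (shape (3 + r) k)
    iso (w₂ , ℓw₂) = iso-emb emb₀ (ShapeEmbedding.shape-emb {ℓ = ℓ} {w₁} {w₂} ℓw₁ ℓw₂ only)
      where
      only : ∀ c w → 0 < ℓ c w → c ≡ zero × (w ≡ w₁ ⊎ (w ≡ w₂ × 0 < k))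
      only c w pos with ℓ c w in eq
      ... | suc n with trans (sym (hair⇒S {ℓ} dist₀ eq)) (h₀ c n)
      ... | t with c ≟ᶠ zero
      ...   | no c≢0 = ⊥-elim (true≢false (sym t) refl)
      ...   | yes refl with n ≟ℕ k
      ...     | yes refl = refl , inj₁ (dist₀ zero w w₁ (subst (0 <_) (sym eq) (s≤s z≤n)) (trans eq (sym ℓw₁)))
      ...     | no n≢k with suc n ≟ℕ k
      ...       | yes refl = refl , inj₂ (dist₀ zero w w₂ (subst (0 <_) (sym eq) (s≤s z≤n)) (trans eq (sym (ℓw₂ (s≤s z≤n)))) , s≤s z≤n)
      ...       | no sn≢k = ⊥-elim (true≢false (sym t) (cong₂ _xor_ (≢⇒≡ᵇ n≢k) (≢⇒≡ᵇ sn≢k)))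

-- The values of a given hairball in simplest form

module _ (G : Graph) (C : Cycle G) (hb : IsHairballWithCycle G C) where
  open UniqueCycle G C hb
  open Ambient (r C) (n G)
  open Embeddings (r C) (n G)
  open Shapes (r C) (n G)

  private
    L : Labelling
    L = proj₁ labelling

  open Labelling L

  label : Fin (n G) → V
  label x = proj₁ (proj₂ labelling x)

  f-label : ∀ x → f (label x) ≡ x × InCore ℓ (label x)
  f-label x = f-e (proj₂ (proj₂ labelling x))

  hairball-emb : Emb ℓ G
  hairball-emb = record
    { e = label
    ; e-inj = λ {x} {y} eq → trans (sym (proj₁ (f-label x))) (trans (cong f eq) (proj₁ (f-label y)))
    ; e-core = λ x → proj₂ (f-label x)
    ; e-onto = λ {v} p → f v , onto p
    ; e-adj = λ x y → trans (cong₂ (adj G) (sym (proj₁ (f-label x))) (sym (proj₁ (f-label y)))) (f-adj (proj₂ (f-label x)) (proj₂ (f-label y))) }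
    where
    onto : ∀ {v} → InCore ℓ v → label (f v) ≡ v
    onto {v} p with proj₁ (proj₂ labelling (f v)) | trans (sym (proj₂ (proj₂ labelling (f v)))) (e-f p)
    ... | _ | refl = refl

  -- Without hairs all vertices lie on the cycle, and `no-chord` makes every edge an edge of it.
  hair-exists : ¬ IsJustCycle G C → ∃ λ c → ∃ λ w → 0 < ℓ c w
  hair-exists not-cycle with anyFin? (λ c → anyFin? (λ w → 0 <?ℕ ℓ c w))
  ... | yes p = p
  ... | no none = ⊥-elim (not-cycle (on , λ i j → cyc-edge i j (on i) (on j)))
    where
    on : ∀ x → OnCycle C x
    on x with label x | f-label x
    ... | cyc i | eq , _ = i , trans (sym (f-cyc i)) eq
    ... | hair c w d | _ , p = ⊥-elim (none (c , w , ≤-trans (s≤s z≤n) p))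
    cyc-edge : ∀ x y → OnCycle C x → OnCycle C y → Edge G x y → CycEdge C x y
    cyc-edge _ _ (i , refl) (j , refl) xy with no-chord i j xy
    ... | inj₁ refl = cpred-CycEdge j
    ... | inj₂ refl = flip-edge (cpred-CycEdge i)
      where
      flip-edge : ∀ {x y} → CycEdge C x y → CycEdge C y x
      flip-edge (inj₁ (k , inj₁ (p , q))) = inj₁ (k , inj₂ (q , p))
      flip-edge (inj₁ (k , inj₂ (p , q))) = inj₁ (k , inj₁ (q , p))
      flip-edge (inj₂ (inj₁ (p , q))) = inj₂ (inj₂ (q , p))
      flip-edge (inj₂ (inj₂ (p , q))) = inj₂ (inj₁ (q , p))

  non-cyclic : DistinctHairs ℓ → ¬ IsJustCycle G C → ¬ Cyclic ℓ
  non-cyclic dist not-cycle cyclic with hair-exists not-cycle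
  ... | c , w , pos with ℓ c w in eq
  ...   | suc d = true≢false (hair⇒S {ℓ} dist eq) (cyclic c d)

  module _ (odd-cycle : Odd (cycleLength C)) (simplest : SimplestForm G) (not-cycle : ¬ IsJustCycle G C) where
    M-odd : odd M ≡ true
    M-odd = Odd⇒odd odd-cycle

    open Game (r C) (n G) M-odd

    distinct : DistinctHairs ℓ
    distinct = simplest⇒distinct hairball-emb simplest

    odd-value : Odd (n G) → nimValue G ≡ 3
    odd-value o = emb-value hairball-emb M-odd
      (oddΦ (trans (sym (emb-parity hairball-emb M-odd)) (Odd⇒odd o)) (non-cyclic distinct not-cycle))

    even-value : Even (n G) → ¬ IsTwoPathShape G → nimValue G ≡ 0
    even-value ev ¬shape = emb-value hairball-emb M-odd
      (evenΦ (trans (sym (emb-parity hairball-emb M-odd)) (Even⇒odd ev))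
        (λ two → ¬shape (Classification.two⇒shape hairball-emb distinct two)))

shape-value : ∀ {G} → Even (n G) → IsTwoPathShape G → nimValue G ≡ 4
shape-value {G} ev (m , k , 3≤m , iso) = two-path-value m k 3≤m (trans (cong odd (sym size)) (Even⇒odd ev)) iso
  where
  size : n G ≡ m + (k + suc k)
  size = ↔⇒≡ (proj₁ iso)

theorem6 : (G : Graph) (C : Cycle G) →
    IsHairballWithCycle G C →
    Odd (cycleLength C) →
    SimplestForm G →
    ¬ IsJustCycle G C →
    ((Even (n G) → IsTwoPathShape G → nimValue G ≡ 4)
    × (Even (n G) → ¬ IsTwoPathShape G → nimValue G ≡ 0)
    × (Odd (n G) → nimValue G ≡ 3))
theorem6 G C hairball odd-cycle simplest not-cycle =
  shape-value ,
  even-value G C hairball odd-cycle simplest not-cycle ,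
  odd-value G C hairball odd-cycle simplest not-cycle
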